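{- Let $r\ge 3$ be an integer. (i) Every linear equation $a_1x_1+\dots+a_{2m}x_{2m}=0$ with $m\ge 2$ and coefficients $a_i\in\mathbb{Z}\setminus\{0\}$ that has no canceling partition is $r$-uncommon over the integers. (ii) The equation $x+2y-z-2w=0$ is $r$-uncommon over the integers.
   Context: A linear equation $a_1x_1+\dots+a_kx_k=0$ with nonzero integer coefficients has a canceling partition if its coefficients (i.e. the index set $\{1,\dots,k\}$) can be partitioned into pairs $\{i,j\}$ with $a_i+a_j=0$. Write $[n]=\{1,\dots,n\}$. Let $E: a_1x_1+\dots+a_kx_k=0$ be a linear equation with nonzero integer coefficients, and let $r\ge 2$ be an integer. An $r$-coloring of $[n]$ is a map $c:[n]\to\{1,\dots,r\}$; a solution $(x_1,\dots,x_k)\in[n]^k$ of $E$ is monochromatic if $c(x_1)=\dots=c(x_k)$. The equation $E$ is $r$-common over the integers if any $r$-coloring of $[n]$ has at least as many monochromatic solutions asymptotically (as $n\to\infty$) as a uniformly random $r$-coloring; that is, the minimum over all $r$-colorings of $[n]$ of the proportion of solutions of $E$ in $[n]^k$ that are monochromatic is at least $r^{1-k}-o(1)$ as $n\to\infty$. Otherwise $E$ is $r$-uncommon over the integers. -}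

module Defs where

open import Data.Fin.Base using (Fin; toℕ)
import Data.Fin.Properties as Fin
open import Data.Integer.Base as ℤ using (ℤ; +_; 0ℤ)
import Data.Integer.Properties as ℤ
open import Data.List.Base
  using (List; [_]; length; filter; allFin; cartesianProductWith; concatMap)
  renaming ([] to []ₗ; _∷_ to _∷ₗ_)
open import Data.List.Relation.Unary.All using (All)
open import Data.List.Relation.Binary.Permutation.Propositional using (_↭_)
open import Data.Nat.Base as ℕ using (ℕ; zero; suc; NonZero)
import Data.Nat.Properties as ℕ
open import Data.Product.Base using (∃-syntax; Σ-syntax; _×_; _,_)
open import Data.Rational.Base as ℚ using (ℚ; 0ℚ)
open import Data.Vec.Base using (Vec; []; _∷_; lookup; map; foldr′; zipWith)
open import Relation.Binary.PropositionalEquality using (_≡_; _≢_)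
open import Relation.Nullary.Decidable.Core using (Dec)
open import Relation.Nullary.Negation.Core using (¬_)

private
  variable
    k n r : ℕ

-- Throughout, the equation a₁x₁ + ⋯ + aₖxₖ = 0 is given by its coefficient
-- vector a : Vec ℤ k, and i : Fin n stands for the element 1 + toℕ i of
-- [n] = {1, …, n}.

NonzeroCoefficients : Vec ℤ k → Set
NonzeroCoefficients {k} a = (i : Fin k) → lookup a i ≢ 0ℤ

-- A partition of the index set into pairs is a list of pairs in which,
-- altogether, every index occurs exactly once.
HasCancelingPartition : Vec ℤ k → Set
HasCancelingPartition {k} a =
  Σ[ ps ∈ List (Fin k × Fin k) ]
    (concatMap (λ (i , j) → i ∷ₗ j ∷ₗ []ₗ) ps ↭ allFin k) ×
    All (λ (i , j) → lookup a i ℤ.+ lookup a j ≡ 0ℤ) ps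

value : Fin n → ℤ
value i = + suc (toℕ i)

evaluate : Vec ℤ k → Vec (Fin n) k → ℤ
evaluate a x = foldr′ ℤ._+_ 0ℤ (zipWith ℤ._*_ a (map value x))

IsSolution : Vec ℤ k → Vec (Fin n) k → Set
IsSolution a x = evaluate a x ≡ 0ℤ

isSolution? : (a : Vec ℤ k) (x : Vec (Fin n) k) → Dec (IsSolution a x)
isSolution? a x = evaluate a x ℤ.≟ 0ℤ

Coloring : ℕ → ℕ → Set
Coloring r n = Fin n → Fin r

Monochromatic : Coloring r n → Vec (Fin n) k → Set
Monochromatic c x = ∀ i j → c (lookup x i) ≡ c (lookup x j)

monochromatic? : (c : Coloring r n) (x : Vec (Fin n) k) → Dec (Monochromatic c x)
monochromatic? c x =
  Fin.all? λ i → Fin.all? λ j → c (lookup x i) Fin.≟ c (lookup x j)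

-- All of [n]ᵏ, each tuple listed once.
tuples : ∀ n k → List (Vec (Fin n) k)
tuples n zero    = [ [] ]
tuples n (suc k) = cartesianProductWith _∷_ (allFin n) (tuples n k)

solutions : Vec ℤ k → ∀ n → List (Vec (Fin n) k)
solutions a n = filter (isSolution? a) (tuples n _)

monochromaticSolutions : Vec ℤ k → Coloring r n → List (Vec (Fin n) k)
monochromaticSolutions a c = filter (monochromatic? c) (solutions a _)

-- The quotient p / q, with the convention p / 0 = 0.
ratio : ℕ → ℕ → ℚ
ratio p zero      = 0ℚ
ratio p q@(suc _) = + p ℚ./ q

-- When [n]ᵏ contains no solution, the proportion is 0.  For nonzero
-- coefficients of both signs this concerns only finitely many n; if all
-- coefficients have the same sign it concerns every n, and the equation
-- counts as uncommon.
monochromaticProportion : Vec ℤ k → Coloring r n → ℚ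
monochromaticProportion {n = n} a c =
  ratio (length (monochromaticSolutions a c)) (length (solutions a n))

-- r^{1-k}, written as r / rᵏ so that the exponent is a natural number.
randomProportion : ∀ r .{{_ : NonZero r}} → ℕ → ℚ
randomProportion r k = (+ r ℚ./ (r ℕ.^ k)) {{ℕ.m^n≢0 r k}}

-- A bound on the minimum over all colorings is a bound for every coloring; the
-- o(1) term depends only on n, so N must not depend on the coloring.
Common : ∀ r .{{_ : NonZero r}} → Vec ℤ k → Set
Common {k} r a =
  ∀ ε → 0ℚ ℚ.< ε →
  ∃[ N ] ∀ n → N ℕ.≤ n → (c : Coloring r n) →
  randomProportion r k ℚ.- ε ℚ.≤ monochromaticProportion a c

Uncommon : ∀ r .{{_ : NonZero r}} → Vec ℤ k → Set
Uncommon r a = ¬ Common r a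

{-# OPTIONS --safe #-}
-- Colour x at random with weights (1 + g(x))/r, (1 - g(x))/r, 1/r, …, 1/r.  Over solutions
-- with distinct coordinates the expected number of monochromatic solutions is affine in the
-- weights of each x, so rounding one x at a time gives a colouring that is at least as good.
-- Hence it is enough to find g with |g| ≤ 1 for which the sum over the solutions of
-- ∏(1 + g(xᵢ)) + ∏(1 - g(xᵢ)) is at most (2 - η) times their number: solutions with a
-- repeated coordinate are O(n^(k-2)), against n^(k-1) solutions in all.
--
-- (i) Since there is no canceling partition, the sum A of the coefficients of some absolute
-- value b is non-zero.  Let g average the cosines with frequencies a_l, those with |a_l| = b
-- being shifted by the phase t a_l.  A product of such waves has frequency vector β with
-- entries among 0, ±a_l, and its sum over the solutions is O(n^(k-2)) unless β is
-- proportional to a, that is, β = 0 or |βⱼ| = |aⱼ| for all j.  The latter β contribute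
-- cos(tA) each, which is negative for suitable t.  To stay within the rationals, the angle is
-- that of (3 + 4i)/5, which is not a root of unity.
--
-- (ii) For x + 2y = z + 2w let g be constant on 12 blocks of length M = 2ʲ⁺¹.  The number of
-- solutions with given blocks obeys a linear recursion in j and so has a closed form, which
-- leaves a finite sum to be evaluated.

module Submission where

open import Data.Bool.Base using (Bool; true; false; if_then_else_)
open import Data.Empty using (⊥; ⊥-elim)
import Data.Fin.Base as Fin
open Fin using (Fin; toℕ)
import Data.Fin.Properties as Finₚ
import Data.Integer.Base as ℤ
open ℤ using (ℤ; +_; -[1+_]; 0ℤ)
import Data.Integer.Properties as ℤₚ
import Data.Integer.Tactic.RingSolver as ℤ-Solver
import Data.List.Base as List
open List using (List; []; _∷_; _++_; length; filter; allFin; upTo; applyUpTo; tabulate; cartesianProductWith; concatMap)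
import Data.List.Properties as Listₚ
open import Data.List.Membership.Propositional using (_∈_; _∉_)
open import Data.List.Relation.Unary.Any using (here; there)
open import Data.List.Relation.Unary.All using (All; []; _∷_)
open import Data.List.Relation.Binary.Permutation.Propositional using (_↭_)
open import Data.Maybe.Base using (Maybe; just; nothing)
import Data.Nat.Base as ℕ
open ℕ using (ℕ; zero; suc)
import Data.Nat.Coprimality as Coprime
import Data.Nat.Properties as ℕₚ
import Data.Nat.Tactic.RingSolver as ℕ-Solver
open import Data.Product.Base using (_×_; _,_; proj₁; proj₂; ∃-syntax; Σ-syntax)
import Data.Rational.Base as ℚ
open ℚ using (ℚ; mkℚ; 0ℚ; 1ℚ; ½; _+_; _*_; _-_; -_; _≤_; _<_; ∣_∣)
import Data.Rational.Properties as ℚₚ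
open import Data.Sum.Base using (_⊎_; inj₁; inj₂)
import Data.Vec.Base as Vec
open Vec using (Vec; []; _∷_; lookup)
import Data.Vec.Properties as Vecₚ
open import Function.Base using (_∘_; id)
open import Level using (0ℓ)
open import Relation.Binary.PropositionalEquality
  using (_≡_; _≢_; refl; sym; trans; cong; cong₂; subst; subst₂; module ≡-Reasoning)
open import Relation.Nullary using (¬_; Dec; yes; no; does)
open import Relation.Nullary.Decidable using (dec⇒maybe)
open import Tactic.RingSolver using (solve-∀)
open import Tactic.RingSolver.Core.AlmostCommutativeRing
  using (AlmostCommutativeRing; fromCommutativeRing)
open import Defs
open import Data.List.Relation.Unary.Unique.Propositional using (Unique)
open import Data.List.Relation.Unary.AllPairs.Core using ([]; _∷_)
import Data.List.Relation.Unary.All as All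
open import Data.List.Relation.Unary.Unique.Propositional.Properties using (allFin⁺)
open import Data.List.Membership.Propositional.Properties using (∈-allFin; ∈-filter⁻; ∈-upTo⁺; ∈-upTo⁻; ∈-cartesianProductWith⁻)
open import Relation.Binary.Bundles using (DecTotalOrder)
open import Relation.Binary.Definitions using (tri<; tri≈; tri>)
open import Data.List.Extrema (DecTotalOrder.totalOrder ℚₚ.≤-decTotalOrder) using (argmin; f[argmin]≤f[xs])
open import Relation.Nullary.Decidable using (_→-dec_; ¬?; decidable-stable; toWitness)
open import Function.Base using (case_of_)
import Data.Rational.Unnormalised.Base as ℚᵘ
import Data.Rational.Unnormalised.Properties as ℚᵘₚ
import Data.List.Extrema ℕₚ.≤-totalOrder as Extremaℕ
import Data.List.Relation.Binary.Permutation.Propositional as ↭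
import Data.List.Relation.Binary.Permutation.Propositional.Properties as ↭ₚ
import Data.List.Relation.Unary.Any as Any
import Data.List.Relation.Unary.Unique.Propositional.Properties as Uniqueₚ
import Data.List.Membership.Propositional.Properties as ∈ₚ
import Data.Bool.Properties as Boolₚ
import Data.Maybe.Properties as Maybeₚ
import Data.Product.Properties as Productₚ
import Data.Nat.DivMod as DivMod
import Data.Nat.Divisibility as Divisibility

-- Once every cosine is split into exponentials, the sum for g runs over words with one letter per
-- variable, each letter being the summand 1 or a wave of slope ± a_l. Words with an odd number of
-- waves cancel between the two colours. The word with slopes exactly a always occurs, since each aⱼ
-- is itself one of the frequencies, and it survives because the number of variables is even. Other
-- surviving words cannot spoil its gain: proportionality and equal absolute values force β = ± a,
-- and cosine is even. With a canceling partition every class sum would be 0 and the factor would be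
-- 1 for every phase.
--
-- The frequencies do not depend on n, so the exponential sums need no analysis: moving two
-- variables along the equation multiplies a wave by a fixed phase and costs only O(1) boundary
-- terms. It remains to see that the number of solutions really has order n^(k-1). This is shown for
-- n in one arithmetic progression, which is enough to refute a claim about all large n. If all
-- coefficients have one sign there are no solutions, and the convention for an empty proportion
-- decides.

private
  variable
    𝔸 𝔹 ℂ 𝕏 𝕐 : Set
    k n r : ℕ

-- Arithmetic of the rational numbers

ℚ-ring : AlmostCommutativeRing 0ℓ 0ℓ
ℚ-ring = fromCommutativeRing ℚₚ.+-*-commutativeRing λ x → dec⇒maybe (0ℚ ℚₚ.≟ x)

+-congˡ : ∀ p {q r} → q ≡ r → p + q ≡ p + r
+-congˡ p refl = refl

+-congʳ : ∀ p {q r} → q ≡ r → q + p ≡ r + p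
+-congʳ p refl = refl

0≤+ : ∀ {p q} → 0ℚ ≤ p → 0ℚ ≤ q → 0ℚ ≤ p + q
0≤+ {p} {q} 0≤p 0≤q = subst (_≤ p + q) (ℚₚ.+-identityˡ 0ℚ) (ℚₚ.+-mono-≤ 0≤p 0≤q)

*-monoˡ : ∀ {p q r} → 0ℚ ≤ p → q ≤ r → p * q ≤ p * r
*-monoˡ {p} 0≤p = ℚₚ.*-monoˡ-≤-nonNeg p {{ℚ.nonNegative 0≤p}}

*-monoʳ : ∀ {p q r} → 0ℚ ≤ p → q ≤ r → q * p ≤ r * p
*-monoʳ {p} 0≤p = ℚₚ.*-monoʳ-≤-nonNeg p {{ℚ.nonNegative 0≤p}}

0≤* : ∀ {p q} → 0ℚ ≤ p → 0ℚ ≤ q → 0ℚ ≤ p * q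
0≤* {p} {q} 0≤p 0≤q = subst (_≤ p * q) (ℚₚ.*-zeroʳ p) (*-monoˡ 0≤p 0≤q)

*-mono : ∀ {p q r s} → 0ℚ ≤ q → 0ℚ ≤ r → p ≤ q → r ≤ s → p * r ≤ q * s
*-mono 0≤q 0≤r p≤q r≤s = ℚₚ.≤-trans (*-monoʳ 0≤r p≤q) (*-monoˡ 0≤q r≤s)

0<* : ∀ {p q} → 0ℚ < p → 0ℚ < q → 0ℚ < p * q
0<* {p} {q} 0<p 0<q =
  ℚₚ.positive⁻¹ (p * q) {{ℚₚ.pos*pos⇒pos p {{ℚ.positive 0<p}} q {{ℚ.positive 0<q}}}}

p+[q-p]≡q : ∀ p q → p + (q - p) ≡ q
p+[q-p]≡q = solve-∀ ℚ-ring

≤-by : ∀ {p q d} → q - p ≡ d → 0ℚ ≤ d → p ≤ q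
≤-by {p} {q} {d} refl 0≤d =
  subst₂ _≤_ (ℚₚ.+-identityʳ p) (p+[q-p]≡q p q) (ℚₚ.+-monoʳ-≤ p 0≤d)

<-by : ∀ {p q d} → q - p ≡ d → 0ℚ < d → p < q
<-by {p} {q} {d} refl 0<d =
  subst₂ _<_ (ℚₚ.+-identityʳ p) (p+[q-p]≡q p q) (ℚₚ.+-monoʳ-< p 0<d)

0≤- : ∀ {p q} → p ≤ q → 0ℚ ≤ q - p
0≤- {p} {q} p≤q = subst (_≤ q - p) (ℚₚ.+-inverseʳ p) (ℚₚ.+-monoˡ-≤ (- p) p≤q)

0<- : ∀ {p q} → p < q → 0ℚ < q - p
0<- {p} {q} p<q = subst (_< q - p) (ℚₚ.+-inverseʳ p) (ℚₚ.+-monoˡ-< (- p) p<q)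

-- Built by the constructor instead of `ℚ._/_`: no gcd has to be normalised, closed terms compute,
-- and injectivity holds by matching on `refl`.
ι : ℤ → ℚ
ι z = mkℚ z 0 (Coprime.sym (Coprime.1-coprimeTo ℤ.∣ z ∣))

/1≡ι : ∀ z → z ℚ./ 1 ≡ ι z
/1≡ι z = ℚₚ.↥p/↧p≡p (ι z)

ι-+ : ∀ x y → ι (x ℤ.+ y) ≡ ι x + ι y
ι-+ x y = trans (sym (/1≡ι (x ℤ.+ y))) (cong (ℚ._/ 1) (sym (cong₂ ℤ._+_ (ℤₚ.*-identityʳ x) (ℤₚ.*-identityʳ y))))

ι-* : ∀ x y → ι (x ℤ.* y) ≡ ι x * ι y
ι-* x y = sym (/1≡ι (x ℤ.* y))

ι-neg : ∀ x → ι (ℤ.- x) ≡ - ι x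
ι-neg (+ zero)  = refl
ι-neg (+ suc n) = refl
ι-neg -[1+ n ]  = refl

ι-- : ∀ x y → ι (x ℤ.- y) ≡ ι x - ι y
ι-- x y = trans (ι-+ x (ℤ.- y)) (+-congˡ (ι x) (ι-neg y))

ι-mono-≤ : ∀ {x y} → x ℤ.≤ y → ι x ≤ ι y
ι-mono-≤ {x} {y} x≤y = ℚ.*≤* (subst₂ ℤ._≤_ (sym (ℤₚ.*-identityʳ x)) (sym (ℤₚ.*-identityʳ y)) x≤y)

ι-injective : ∀ {x y} → ι x ≡ ι y → x ≡ y
ι-injective refl = refl

ℕ→ℚ : ℕ → ℚ
ℕ→ℚ n = ι (+ n)

ℕ→ℚ-+ : ∀ m n → ℕ→ℚ (m ℕ.+ n) ≡ ℕ→ℚ m + ℕ→ℚ n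
ℕ→ℚ-+ m n = ι-+ (+ m) (+ n)

ℕ→ℚ-* : ∀ m n → ℕ→ℚ (m ℕ.* n) ≡ ℕ→ℚ m * ℕ→ℚ n
ℕ→ℚ-* m n = trans (cong ι (ℤₚ.pos-* m n)) (ι-* (+ m) (+ n))

ℕ→ℚ-mono-≤ : ∀ {m n} → m ℕ.≤ n → ℕ→ℚ m ≤ ℕ→ℚ n
ℕ→ℚ-mono-≤ m≤n = ι-mono-≤ (ℤ.+≤+ m≤n)

0≤ℕ→ℚ : ∀ n → 0ℚ ≤ ℕ→ℚ n
0≤ℕ→ℚ n = ℕ→ℚ-mono-≤ {0} {n} ℕ.z≤n

0≤1 : 0ℚ ≤ 1ℚ
0≤1 = 0≤ℕ→ℚ 1

∣p∣≤⇒≤ : ∀ {p q} → ∣ p ∣ ≤ q → p ≤ q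
∣p∣≤⇒≤ {p} ∣p∣≤q = ℚₚ.≤-trans (p≤∣p∣ p) ∣p∣≤q
  where
  p≤∣p∣ : ∀ p → p ≤ ∣ p ∣
  p≤∣p∣ p with ℚₚ.≤-total 0ℚ p
  ... | inj₁ 0≤p = ℚₚ.≤-reflexive (sym (ℚₚ.0≤p⇒∣p∣≡p 0≤p))
  ... | inj₂ p≤0 = ℚₚ.≤-trans p≤0 (ℚₚ.0≤∣p∣ p)

∣p∣≤⇒-≤ : ∀ {p q} → ∣ p ∣ ≤ q → - q ≤ p
∣p∣≤⇒-≤ {p} {q} ∣p∣≤q =
  subst (- q ≤_) (neg-neg p)
    (ℚₚ.neg-antimono-≤ (∣p∣≤⇒≤ (subst (_≤ q) (sym (ℚₚ.∣-p∣≡∣p∣ p)) ∣p∣≤q)))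
  where
  neg-neg : ∀ p → - (- p) ≡ p
  neg-neg = solve-∀ ℚ-ring

-- Finite sums and indicators

∑ : List 𝔸 → (𝔸 → ℚ) → ℚ
∑ []       f = 0ℚ
∑ (x ∷ xs) f = f x + ∑ xs f

∑-cong∈ : ∀ (xs : List 𝔸) {f g : 𝔸 → ℚ} → (∀ {x} → x ∈ xs → f x ≡ g x) → ∑ xs f ≡ ∑ xs g
∑-cong∈ []       f≡g = refl
∑-cong∈ (x ∷ xs) f≡g = cong₂ _+_ (f≡g (here refl)) (∑-cong∈ xs (f≡g ∘ there))

∑-cong : ∀ (xs : List 𝔸) {f g : 𝔸 → ℚ} → (∀ x → f x ≡ g x) → ∑ xs f ≡ ∑ xs g
∑-cong xs f≡g = ∑-cong∈ xs λ {x} _ → f≡g x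

∑-mono∈ : ∀ (xs : List 𝔸) {f g : 𝔸 → ℚ} → (∀ {x} → x ∈ xs → f x ≤ g x) → ∑ xs f ≤ ∑ xs g
∑-mono∈ []       f≤g = ℚₚ.≤-refl
∑-mono∈ (x ∷ xs) f≤g = ℚₚ.+-mono-≤ (f≤g (here refl)) (∑-mono∈ xs (f≤g ∘ there))

∑-mono : ∀ (xs : List 𝔸) {f g : 𝔸 → ℚ} → (∀ x → f x ≤ g x) → ∑ xs f ≤ ∑ xs g
∑-mono xs f≤g = ∑-mono∈ xs λ {x} _ → f≤g x

∑-zero : ∀ (xs : List 𝔸) → ∑ xs (λ _ → 0ℚ) ≡ 0ℚ
∑-zero []       = refl
∑-zero (x ∷ xs) = trans (ℚₚ.+-identityˡ _) (∑-zero xs)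

0≤∑ : ∀ (xs : List 𝔸) {f : 𝔸 → ℚ} → (∀ x → 0ℚ ≤ f x) → 0ℚ ≤ ∑ xs f
0≤∑ xs {f} 0≤f = subst (_≤ ∑ xs f) (∑-zero xs) (∑-mono xs 0≤f)

∑-+ : ∀ (xs : List 𝔸) (f g : 𝔸 → ℚ) → ∑ xs (λ x → f x + g x) ≡ ∑ xs f + ∑ xs g
∑-+ []       f g = refl
∑-+ (x ∷ xs) f g = trans (+-congˡ (f x + g x) (∑-+ xs f g)) (interchange (f x) (g x) (∑ xs f) (∑ xs g))
  where
  interchange : ∀ a b c d → (a + b) + (c + d) ≡ (a + c) + (b + d)
  interchange = solve-∀ ℚ-ring

∑-*ˡ : ∀ (xs : List 𝔸) c (f : 𝔸 → ℚ) → ∑ xs (λ x → c * f x) ≡ c * ∑ xs f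
∑-*ˡ []       c f = sym (ℚₚ.*-zeroʳ c)
∑-*ˡ (x ∷ xs) c f = trans (+-congˡ (c * f x) (∑-*ˡ xs c f)) (sym (ℚₚ.*-distribˡ-+ c (f x) (∑ xs f)))

∑-*ʳ : ∀ (xs : List 𝔸) c (f : 𝔸 → ℚ) → ∑ xs (λ x → f x * c) ≡ ∑ xs f * c
∑-*ʳ xs c f =
  trans (∑-cong xs λ x → ℚₚ.*-comm (f x) c) (trans (∑-*ˡ xs c f) (ℚₚ.*-comm c (∑ xs f)))

∑-neg : ∀ (xs : List 𝔸) (f : 𝔸 → ℚ) → ∑ xs (λ x → - f x) ≡ - ∑ xs f
∑-neg []       f = refl
∑-neg (x ∷ xs) f = trans (+-congˡ (- f x) (∑-neg xs f)) (sym (ℚₚ.neg-distrib-+ (f x) (∑ xs f)))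

∑-- : ∀ (xs : List 𝔸) (f g : 𝔸 → ℚ) → ∑ xs (λ x → f x - g x) ≡ ∑ xs f - ∑ xs g
∑-- xs f g = trans (∑-+ xs f (λ x → - g x)) (+-congˡ (∑ xs f) (∑-neg xs g))

∑-const : ∀ (xs : List 𝔸) c → ∑ xs (λ _ → c) ≡ ℕ→ℚ (length xs) * c
∑-const []       c = sym (ℚₚ.*-zeroˡ c)
∑-const (x ∷ xs) c = begin
  c + ∑ xs (λ _ → c)                ≡⟨ +-congˡ c (∑-const xs c) ⟩
  c + ℕ→ℚ (length xs) * c           ≡⟨ lemma c (ℕ→ℚ (length xs)) ⟩
  (1ℚ + ℕ→ℚ (length xs)) * c        ≡⟨ cong (_* c) (ℕ→ℚ-+ 1 (length xs)) ⟨
  ℕ→ℚ (suc (length xs)) * c         ∎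
  where
  open ≡-Reasoning
  lemma : ∀ c l → c + l * c ≡ (1ℚ + l) * c
  lemma = solve-∀ ℚ-ring

∑-swap : ∀ (xs : List 𝔸) (ys : List 𝔹) (f : 𝔸 → 𝔹 → ℚ) →
  ∑ xs (λ x → ∑ ys (f x)) ≡ ∑ ys (λ y → ∑ xs λ x → f x y)
∑-swap []       ys f = sym (∑-zero ys)
∑-swap (x ∷ xs) ys f = begin
  ∑ ys (f x) + ∑ xs (λ x → ∑ ys (f x))            ≡⟨ +-congˡ (∑ ys (f x)) (∑-swap xs ys f) ⟩
  ∑ ys (f x) + ∑ ys (λ y → ∑ xs λ x → f x y)      ≡⟨ ∑-+ ys (f x) _ ⟨
  ∑ ys (λ y → f x y + ∑ xs (λ x → f x y))         ∎
  where open ≡-Reasoning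

∑-++ : ∀ (xs ys : List 𝔸) (f : 𝔸 → ℚ) → ∑ (xs ++ ys) f ≡ ∑ xs f + ∑ ys f
∑-++ []       ys f = sym (ℚₚ.+-identityˡ _)
∑-++ (x ∷ xs) ys f = trans (+-congˡ (f x) (∑-++ xs ys f)) (sym (ℚₚ.+-assoc (f x) _ _))

∑-map : ∀ (h : 𝔸 → 𝔹) (xs : List 𝔸) (f : 𝔹 → ℚ) → ∑ (List.map h xs) f ≡ ∑ xs (f ∘ h)
∑-map h []       f = refl
∑-map h (x ∷ xs) f = +-congˡ (f (h x)) (∑-map h xs f)

∑-cartesian : ∀ (h : 𝔸 → 𝔹 → ℂ) xs ys (f : ℂ → ℚ) →
  ∑ (cartesianProductWith h xs ys) f ≡ ∑ xs λ x → ∑ ys λ y → f (h x y)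
∑-cartesian h []       ys f = refl
∑-cartesian h (x ∷ xs) ys f =
  trans (∑-++ (List.map (h x) ys) _ f) (cong₂ _+_ (∑-map (h x) ys f) (∑-cartesian h xs ys f))

∣∑∣≤∑∣∣ : ∀ (xs : List 𝔸) (f : 𝔸 → ℚ) → ∣ ∑ xs f ∣ ≤ ∑ xs (λ x → ∣ f x ∣)
∣∑∣≤∑∣∣ []       f = ℚₚ.≤-refl
∣∑∣≤∑∣∣ (x ∷ xs) f =
  ℚₚ.≤-trans (ℚₚ.∣p+q∣≤∣p∣+∣q∣ (f x) _) (ℚₚ.+-monoʳ-≤ ∣ f x ∣ (∣∑∣≤∑∣∣ xs f))

term≤∑ : ∀ {xs : List 𝔸} {x} {f : 𝔸 → ℚ} → (∀ y → 0ℚ ≤ f y) → x ∈ xs → f x ≤ ∑ xs f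
term≤∑ {xs = x ∷ xs} {f = f} 0≤f (here refl) =
  subst (_≤ f x + ∑ xs f) (ℚₚ.+-identityʳ (f x)) (ℚₚ.+-monoʳ-≤ (f x) (0≤∑ xs 0≤f))
term≤∑ {xs = x ∷ xs} {y} {f = f} 0≤f (there y∈xs) =
  subst (_≤ f x + ∑ xs f) (ℚₚ.+-identityˡ (f y)) (ℚₚ.+-mono-≤ (0≤f x) (term≤∑ 0≤f y∈xs))

𝟙 : Dec 𝕏 → ℚ
𝟙 d = if does d then 1ℚ else 0ℚ

0≤𝟙 : (d : Dec 𝕏) → 0ℚ ≤ 𝟙 d
0≤𝟙 (yes _) = 0≤1
0≤𝟙 (no  _) = ℚₚ.≤-refl

𝟙≤1 : (d : Dec 𝕏) → 𝟙 d ≤ 1ℚ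
𝟙≤1 (yes _) = ℚₚ.≤-refl
𝟙≤1 (no  _) = 0≤1

𝟙-yes : (d : Dec 𝕏) → 𝕏 → 𝟙 d ≡ 1ℚ
𝟙-yes (yes _) p = refl
𝟙-yes (no ¬p) p = ⊥-elim (¬p p)

𝟙-no : (d : Dec 𝕏) → ¬ 𝕏 → 𝟙 d ≡ 0ℚ
𝟙-no (yes p) ¬p = ⊥-elim (¬p p)
𝟙-no (no _)  ¬p = refl

𝟙-mono : (d : Dec 𝕏) (e : Dec 𝕐) → (𝕏 → 𝕐) → 𝟙 d ≤ 𝟙 e
𝟙-mono (yes p) e P⇒Q = ℚₚ.≤-reflexive (sym (𝟙-yes e (P⇒Q p)))
𝟙-mono (no _)  e P⇒Q = 0≤𝟙 e

𝟙-cong : (d : Dec 𝕏) (e : Dec 𝕐) → (𝕏 → 𝕐) → (𝕐 → 𝕏) → 𝟙 d ≡ 𝟙 e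
𝟙-cong d e P⇒Q Q⇒P = ℚₚ.≤-antisym (𝟙-mono d e P⇒Q) (𝟙-mono e d Q⇒P)

∑-filter : ∀ {P : 𝔸 → Set} (P? : ∀ x → Dec (P x)) xs (f : 𝔸 → ℚ) →
  ∑ (filter P? xs) f ≡ ∑ xs λ x → 𝟙 (P? x) * f x
∑-filter P? []       f = refl
∑-filter P? (x ∷ xs) f with P? x
... | yes _ = cong₂ _+_ (sym (ℚₚ.*-identityˡ (f x))) (∑-filter P? xs f)
... | no  _ = trans (∑-filter P? xs f)
                (sym (trans (+-congʳ (∑ xs λ x → 𝟙 (P? x) * f x) (ℚₚ.*-zeroˡ (f x))) (ℚₚ.+-identityˡ _)))

length≡∑ : ∀ (xs : List 𝔸) → ℕ→ℚ (length xs) ≡ ∑ xs (λ _ → 1ℚ)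
length≡∑ xs = trans (sym (ℚₚ.*-identityʳ _)) (sym (∑-const xs 1ℚ))

-- Sums over {0, …, n - 1}

∑< : ℕ → (ℕ → ℚ) → ℚ
∑< n = ∑ (upTo n)

∑-applyUpTo : ∀ (h : ℕ → 𝔸) n (f : 𝔸 → ℚ) → ∑ (applyUpTo h n) f ≡ ∑< n (f ∘ h)
∑-applyUpTo h zero    f = refl
∑-applyUpTo h (suc n) f =
  +-congˡ (f (h 0)) (trans (∑-applyUpTo (h ∘ suc) n f) (sym (∑-applyUpTo suc n (f ∘ h))))

∑<-suc : ∀ n f → ∑< (suc n) f ≡ f 0 + ∑< n (f ∘ suc)
∑<-suc n f = +-congˡ (f 0) (∑-applyUpTo suc n f)

∑<-+ : ∀ m n f → ∑< (m ℕ.+ n) f ≡ ∑< m f + ∑< n (f ∘ (m ℕ.+_))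
∑<-+ zero    n f = sym (ℚₚ.+-identityˡ _)
∑<-+ (suc m) n f = begin
  ∑< (suc (m ℕ.+ n)) f                                  ≡⟨ ∑<-suc (m ℕ.+ n) f ⟩
  f 0 + ∑< (m ℕ.+ n) (f ∘ suc)                          ≡⟨ +-congˡ (f 0) (∑<-+ m n (f ∘ suc)) ⟩
  f 0 + (∑< m (f ∘ suc) + ∑< n (f ∘ (suc m ℕ.+_)))      ≡⟨ ℚₚ.+-assoc (f 0) _ _ ⟨
  f 0 + ∑< m (f ∘ suc) + ∑< n (f ∘ (suc m ℕ.+_))        ≡⟨ +-congʳ _ (∑<-suc m f) ⟨
  ∑< (suc m) f + ∑< n (f ∘ (suc m ℕ.+_))                ∎
  where open ≡-Reasoning

∑<-const : ∀ n c → ∑< n (λ _ → c) ≡ ℕ→ℚ n * c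
∑<-const n c = trans (∑-const (upTo n) c) (cong (λ l → ℕ→ℚ l * c) (Listₚ.length-upTo n))

∑<-cong : ∀ n {f g : ℕ → ℚ} → (∀ i → f i ≡ g i) → ∑< n f ≡ ∑< n g
∑<-cong n = ∑-cong (upTo n)

∑<-mono : ∀ n {f g : ℕ → ℚ} → (∀ i → f i ≤ g i) → ∑< n f ≤ ∑< n g
∑<-mono n = ∑-mono (upTo n)

∑-tabulate : ∀ n (h : Fin n → 𝔸) (f : 𝔸 → ℚ) (g : ℕ → ℚ) →
  (∀ i → f (h i) ≡ g (toℕ i)) → ∑ (tabulate h) f ≡ ∑< n g
∑-tabulate zero    h f g eq = refl
∑-tabulate (suc n) h f g eq = trans
  (cong₂ _+_ (eq Fin.zero) (∑-tabulate n (h ∘ Fin.suc) f (g ∘ suc) (eq ∘ Fin.suc)))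
  (sym (∑<-suc n g))

∑-allFin : ∀ n (g : ℕ → ℚ) → ∑ (allFin n) (g ∘ toℕ) ≡ ∑< n g
∑-allFin n g = ∑-tabulate n id (g ∘ toℕ) g λ _ → refl

-- Meant for indicators of a linear equation in one unknown, which holds for at most one index:
-- either the first term is the non-zero one and all later terms vanish, or it is dropped.
∑<-unique : ∀ n {f : ℕ → ℚ} → (∀ i → f i ≤ 1ℚ) → (∀ i → 0ℚ ≤ f i) →
  (∀ i j → f i ≢ 0ℚ → f j ≢ 0ℚ → i ≡ j) → ∑< n f ≤ 1ℚ
∑<-unique zero    f≤1 0≤f uniq = 0≤1
∑<-unique (suc n) {f} f≤1 0≤f uniq = subst (_≤ 1ℚ) (sym (∑<-suc n f)) (go (f 0 ℚₚ.≟ 0ℚ))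
  where
  go : Dec (f 0 ≡ 0ℚ) → f 0 + ∑< n (f ∘ suc) ≤ 1ℚ
  go (yes f0≡0) = subst (_≤ 1ℚ) (sym (trans (+-congʳ (∑< n (f ∘ suc)) f0≡0) (ℚₚ.+-identityˡ _)))
    (∑<-unique n (f≤1 ∘ suc) (0≤f ∘ suc) λ i j p q → ℕₚ.suc-injective (uniq (suc i) (suc j) p q))
  go (no f0≢0) = subst (_≤ 1ℚ)
    (sym (trans (+-congˡ (f 0) (trans (∑<-cong n zeros) (∑-zero (upTo n)))) (ℚₚ.+-identityʳ _))) (f≤1 0)
    where
    zeros : ∀ i → f (suc i) ≡ 0ℚ
    zeros i with f (suc i) ℚₚ.≟ 0ℚ
    ... | yes eq = eq
    ... | no neq with uniq 0 (suc i) f0≢0 neq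
    ... | ()

-- Sums over k-tuples

vecs : List 𝔸 → ∀ k → List (Vec 𝔸 k)
vecs xs zero    = [] ∷ []
vecs xs (suc k) = cartesianProductWith _∷_ xs (vecs xs k)

∑ᵛ : List 𝔸 → ∀ k → (Vec 𝔸 k → ℚ) → ℚ
∑ᵛ xs k = ∑ (vecs xs k)

∑ᵛ-suc : ∀ (xs : List 𝔸) k (f : Vec 𝔸 (suc k) → ℚ) →
  ∑ᵛ xs (suc k) f ≡ ∑ xs λ x → ∑ᵛ xs k λ v → f (x ∷ v)
∑ᵛ-suc xs k = ∑-cartesian _∷_ xs (vecs xs k)

-- Sums over `Fin n` are moved to `ℕ`, where a summand can also be evaluated beyond n; the shifting
-- arguments below need this.
∑-tuples : ∀ n k (f : Vec (Fin n) k → ℚ) (g : Vec ℕ k → ℚ) →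
  (∀ x → f x ≡ g (Vec.map toℕ x)) → ∑ (tuples n k) f ≡ ∑ᵛ (upTo n) k g
∑-tuples n zero    f g eq = +-congʳ 0ℚ (eq [])
∑-tuples n (suc k) f g eq = begin
  ∑ (tuples n (suc k)) f                                    ≡⟨ ∑-cartesian _∷_ (allFin n) (tuples n k) f ⟩
  (∑ (allFin n) λ i → ∑ (tuples n k) λ x → f (i ∷ x))       ≡⟨ ∑-cong (allFin n) (λ i → ∑-tuples n k _ (λ v → g (toℕ i ∷ v)) λ x → eq (i ∷ x)) ⟩
  (∑ (allFin n) λ i → ∑ᵛ (upTo n) k λ v → g (toℕ i ∷ v))    ≡⟨ ∑-allFin n (λ i → ∑ᵛ (upTo n) k λ v → g (i ∷ v)) ⟩
  (∑< n λ i → ∑ᵛ (upTo n) k λ v → g (i ∷ v))                ≡⟨ ∑ᵛ-suc (upTo n) k g ⟨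
  ∑ᵛ (upTo n) (suc k) g                                     ∎
  where open ≡-Reasoning

length-vecs : ∀ (xs : List 𝔸) k → length (vecs xs k) ≡ length xs ℕ.^ k
length-vecs xs zero    = refl
length-vecs xs (suc k) = trans (length-cPW xs (vecs xs k)) (cong (length xs ℕ.*_) (length-vecs xs k))
  where
  length-cPW : ∀ (xs : List 𝔸) {k} (vs : List (Vec 𝔸 k)) → length (cartesianProductWith _∷_ xs vs) ≡ length xs ℕ.* length vs
  length-cPW []       vs = refl
  length-cPW (x ∷ xs) vs = trans (Listₚ.length-++ (List.map (x ∷_) vs))
    (cong₂ ℕ._+_ (Listₚ.length-map (x ∷_) vs) (length-cPW xs vs))

2ℚ : ℚ
2ℚ = ℕ→ℚ 2

∑-δ : ∀ {xs : List 𝔸} {d} (_≟_ : (x y : 𝔸) → Dec (x ≡ y)) → Unique xs → d ∈ xs →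
  (f : 𝔸 → ℚ) → ∑ xs (λ x → 𝟙 (x ≟ d) * f x) ≡ f d
∑-δ {xs = x ∷ xs} _≟_ (x∉xs ∷ _) (here refl) f = begin
  𝟙 (x ≟ x) * f x + ∑ xs (λ y → 𝟙 (y ≟ x) * f y)
    ≡⟨ cong₂ _+_ (cong (_* f x) (𝟙-yes (x ≟ x) refl)) (trans (∑-cong∈ xs vanish) (∑-zero xs)) ⟩
  1ℚ * f x + 0ℚ
    ≡⟨ trans (ℚₚ.+-identityʳ _) (ℚₚ.*-identityˡ (f x)) ⟩
  f x ∎
  where
  open ≡-Reasoning
  vanish : ∀ {y} → y ∈ xs → 𝟙 (y ≟ x) * f y ≡ 0ℚ
  vanish {y} y∈xs = trans
    (cong (_* f y) (𝟙-no (y ≟ x) λ y≡x → All.lookup x∉xs y∈xs (sym y≡x))) (ℚₚ.*-zeroˡ (f y))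
∑-δ {xs = x ∷ xs} {d} _≟_ (x∉xs ∷ xs!) (there d∈xs) f = begin
  𝟙 (x ≟ d) * f x + ∑ xs (λ y → 𝟙 (y ≟ d) * f y)
    ≡⟨ cong₂ _+_ (trans (cong (_* f x) (𝟙-no (x ≟ d) (All.lookup x∉xs d∈xs))) (ℚₚ.*-zeroˡ (f x)))
                 (∑-δ _≟_ xs! d∈xs f) ⟩
  0ℚ + f d
    ≡⟨ ℚₚ.+-identityˡ (f d) ⟩
  f d ∎
  where open ≡-Reasoning

-- Rounding of fractional colourings

infixr 7 ∏
∏ : Vec 𝔸 k → (𝔸 → ℚ) → ℚ
∏ []       f = 1ℚ
∏ (x ∷ xs) f = f x * ∏ xs f

0≤∏ : ∀ (xs : Vec 𝔸 k) {f : 𝔸 → ℚ} → (∀ x → 0ℚ ≤ f x) → 0ℚ ≤ ∏ xs f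
0≤∏ []       0≤f = 0≤1
0≤∏ (x ∷ xs) 0≤f = 0≤* (0≤f x) (0≤∏ xs 0≤f)

∏-cong : ∀ (xs : Vec 𝔸 k) {f g : 𝔸 → ℚ} → (∀ x → f x ≡ g x) → ∏ xs f ≡ ∏ xs g
∏-cong []       f≡g = refl
∏-cong (x ∷ xs) f≡g = cong₂ _*_ (f≡g x) (∏-cong xs f≡g)

∏-map : ∀ {B : Set} (h : 𝔸 → B) (xs : Vec 𝔸 k) (f : B → ℚ) → ∏ (Vec.map h xs) f ≡ ∏ xs (f ∘ h)
∏-map h []       f = refl
∏-map h (x ∷ xs) f = cong (f (h x) *_) (∏-map h xs f)

Distinct : Vec (Fin n) k → Set
Distinct x = ∀ i j → lookup x i ≡ lookup x j → i ≡ j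

distinct? : (x : Vec (Fin n) k) → Dec (Distinct x)
distinct? x = Finₚ.all? λ i → Finₚ.all? λ j → (lookup x i Finₚ.≟ lookup x j) →-dec (i Finₚ.≟ j)

module _ {r : ℕ} (ρ : ℚ) where

  -- Probabilities are multiplied by ρ, so that weights sum to ρ and nothing is divided by the
  -- number of colours. In this scale `vertex c` is the deterministic choice of the colour c.
  vertex : Fin r → Fin r → ℚ
  vertex c d = 𝟙 (c Finₚ.≟ d) * ρ

  -- Multiplied through by ρ: p is the convex combination of the vertices with coefficients p c / ρ.
  Affine : (Vec (Fin r → ℚ) n → ℚ) → Set
  Affine {n} Φ = ∀ (i : Fin n) fs p → ∑ (allFin r) p ≡ ρ →
    ρ * Φ (fs Vec.[ i ]≔ p) ≡ ∑ (allFin r) λ c → p c * Φ (fs Vec.[ i ]≔ vertex c)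

  IsWeight : (Fin r → ℚ) → Set
  IsWeight p = (∀ c → 0ℚ ≤ p c) × ∑ (allFin r) p ≡ ρ

  -- A minimum does not exceed a weighted average. Positivity of ρ guarantees that there is a colour
  -- at all.
  below-average : 0ℚ < ρ → ∀ p → IsWeight p → ∀ (f : Fin r → ℚ) x →
    ρ * x ≡ ∑ (allFin r) (λ c → p c * f c) → ∃[ c ] f c ≤ x
  below-average 0<ρ p (0≤p , ∑p) f x avg = go (allFin r) refl
    where
    go : ∀ cs → cs ≡ allFin r → ∃[ c ] f c ≤ x
    go []         eq = ⊥-elim (ℚₚ.<-irrefl (trans (cong (λ cs → ∑ cs p) eq) ∑p) 0<ρ)
    go (c₀ ∷ _) _  = c , ℚₚ.*-cancelˡ-≤-pos ρ {{ℚ.positive 0<ρ}} (begin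
      ρ * f c                           ≡⟨ cong (_* f c) ∑p ⟨
      ∑ (allFin r) p * f c              ≡⟨ ∑-*ʳ (allFin r) (f c) p ⟨
      ∑ (allFin r) (λ d → p d * f c)    ≤⟨ ∑-mono∈ (allFin r) (λ {d} d∈ → *-monoˡ (0≤p d) (All.lookup (f[argmin]≤f[xs] {f = f} c₀ (allFin r)) d∈)) ⟩
      ∑ (allFin r) (λ d → p d * f d)    ≡⟨ avg ⟨
      ρ * x                             ∎)
      where
      open ℚₚ.≤-Reasoning
      c = argmin f c₀ (allFin r)

  -- The method of conditional expectations: since Φ is affine in each entry, some vertex at the
  -- first entry does not increase it, and the other entries are treated with this one fixed.
  rounding : 0ℚ < ρ → ∀ {n} (Φ : Vec (Fin r → ℚ) n → ℚ) → Affine Φ →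
    ∀ fs → (∀ i → IsWeight (lookup fs i)) → ∃[ c ] Φ (Vec.map vertex c) ≤ Φ fs
  rounding 0<ρ Φ aff []       w = [] , ℚₚ.≤-refl
  rounding 0<ρ Φ aff (p ∷ fs) w =
    let c₀ , Φc₀≤ = below-average 0<ρ p (w Fin.zero) (λ c → Φ (vertex c ∷ fs)) (Φ (p ∷ fs))
                      (aff Fin.zero (p ∷ fs) p (proj₂ (w Fin.zero)))
        c , Φc≤   = rounding 0<ρ (λ gs → Φ (vertex c₀ ∷ gs)) (λ i gs → aff (Fin.suc i) (vertex c₀ ∷ gs))
                      fs (λ i → w (Fin.suc i))
    in c₀ ∷ c , ℚₚ.≤-trans Φc≤ Φc₀≤

  weightAt : Fin r → Vec (Fin r → ℚ) n → Vec (Fin n) k → ℚ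
  weightAt col fs x = ∏ x λ i → lookup fs i col

  weightAt-unaffected : ∀ col (fs : Vec (Fin r → ℚ) n) i p (x : Vec (Fin n) k) →
    (∀ j → lookup x j ≢ i) → weightAt col (fs Vec.[ i ]≔ p) x ≡ weightAt col fs x
  weightAt-unaffected col fs i p []      i∉x = refl
  weightAt-unaffected col fs i p (j ∷ x) i∉x = cong₂ _*_
    (cong (λ q → q col) (Vecₚ.lookup∘updateAt′ j i (i∉x Fin.zero) fs))
    (weightAt-unaffected col fs i p x (i∉x ∘ Fin.suc))

  -- The entries of x are different positions, so the weight of any one position occurs at most once
  -- in the product. A repeated position would make the product quadratic in that weight.
  weightAt-affine : ∀ col (x : Vec (Fin n) k) → Distinct x → Affine (λ fs → weightAt col fs x)
  weightAt-affine col []      x! i fs p ∑p = begin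
    ρ * 1ℚ                          ≡⟨ cong (_* 1ℚ) ∑p ⟨
    ∑ (allFin r) p * 1ℚ             ≡⟨ ∑-*ʳ (allFin r) 1ℚ p ⟨
    ∑ (allFin r) (λ c → p c * 1ℚ)   ∎
    where open ≡-Reasoning
  weightAt-affine col (j ∷ x) x! i fs p ∑p with j Finₚ.≟ i
  ... | yes refl = begin
    ρ * (lookup (fs Vec.[ i ]≔ p) i col * weightAt col (fs Vec.[ i ]≔ p) x)
      ≡⟨ cong (ρ *_) (eq p) ⟩
    ρ * (p col * R)
      ≡⟨ lemma ρ (p col) R ⟩
    (p col * ρ) * R
      -- Among the vertices only the one at `col` has non-zero weight at `col`, which lets p col be
      -- rewritten as a sum over all colours.
      ≡⟨ cong (_* R) (∑-δ Finₚ._≟_ (allFin⁺ r) (∈-allFin col) (λ c → p c * ρ)) ⟨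
    ∑ (allFin r) (λ c → 𝟙 (c Finₚ.≟ col) * (p c * ρ)) * R
      ≡⟨ ∑-*ʳ (allFin r) R _ ⟨
    ∑ (allFin r) (λ c → 𝟙 (c Finₚ.≟ col) * (p c * ρ) * R)
      ≡⟨ ∑-cong (allFin r) (λ c → trans (lemma′ (𝟙 (c Finₚ.≟ col)) (p c) ρ R) (cong (p c *_) (sym (eq (vertex c))))) ⟩
    ∑ (allFin r) (λ c → p c * (lookup (fs Vec.[ i ]≔ vertex c) i col * weightAt col (fs Vec.[ i ]≔ vertex c) x)) ∎
    where
    open ≡-Reasoning
    R = weightAt col fs x
    eq : ∀ q → lookup (fs Vec.[ i ]≔ q) i col * weightAt col (fs Vec.[ i ]≔ q) x ≡ q col * R
    eq q = cong₂ _*_ (cong (λ q → q col) (Vecₚ.lookup∘updateAt i fs))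
      (weightAt-unaffected col fs i q x λ j eq → case x! (Fin.suc j) Fin.zero eq of λ ())
    lemma : ∀ a b c → a * (b * c) ≡ b * a * c
    lemma = solve-∀ ℚ-ring
    lemma′ : ∀ d p ρ R → d * (p * ρ) * R ≡ p * (d * ρ * R)
    lemma′ = solve-∀ ℚ-ring
  ... | no j≢i = begin
    ρ * (lookup (fs Vec.[ i ]≔ p) j col * weightAt col (fs Vec.[ i ]≔ p) x)
      ≡⟨ cong (λ y → ρ * (y * weightAt col (fs Vec.[ i ]≔ p) x)) (eq p) ⟩
    ρ * (y * weightAt col (fs Vec.[ i ]≔ p) x)
      ≡⟨ lemma ρ y _ ⟩
    y * (ρ * weightAt col (fs Vec.[ i ]≔ p) x)
      ≡⟨ cong (y *_) (weightAt-affine col x tail! i fs p ∑p) ⟩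
    y * ∑ (allFin r) (λ c → p c * weightAt col (fs Vec.[ i ]≔ vertex c) x)
      ≡⟨ ∑-*ˡ (allFin r) y _ ⟨
    ∑ (allFin r) (λ c → y * (p c * weightAt col (fs Vec.[ i ]≔ vertex c) x))
      ≡⟨ ∑-cong (allFin r) (λ c → trans (lemma y (p c) _) (cong (λ y → p c * (y * weightAt col (fs Vec.[ i ]≔ vertex c) x)) (sym (eq (vertex c))))) ⟩
    ∑ (allFin r) (λ c → p c * (lookup (fs Vec.[ i ]≔ vertex c) j col * weightAt col (fs Vec.[ i ]≔ vertex c) x)) ∎
    where
    open ≡-Reasoning
    y = lookup fs j col
    eq : ∀ q → lookup (fs Vec.[ i ]≔ q) j col ≡ y
    eq q = cong (λ q → q col) (Vecₚ.lookup∘updateAt′ j i j≢i fs)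
    tail! : Distinct x
    tail! a b eq = Finₚ.suc-injective (x! (Fin.suc a) (Fin.suc b) eq)
    lemma : ∀ a b c → a * (b * c) ≡ b * (a * c)
    lemma = solve-∀ ℚ-ring

  ∑-affine : ∀ {n} (xs : List 𝔸) (Φ : 𝔸 → Vec (Fin r → ℚ) n → ℚ) →
    (∀ {x} → x ∈ xs → Affine (Φ x)) → Affine (λ fs → ∑ xs λ x → Φ x fs)
  ∑-affine xs Φ aff i fs p ∑p = begin
    ρ * ∑ xs (λ x → Φ x (fs Vec.[ i ]≔ p))
      ≡⟨ ∑-*ˡ xs ρ _ ⟨
    ∑ xs (λ x → ρ * Φ x (fs Vec.[ i ]≔ p))
      ≡⟨ ∑-cong∈ xs (λ x∈xs → aff x∈xs i fs p ∑p) ⟩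
    ∑ xs (λ x → ∑ (allFin r) λ c → p c * Φ x (fs Vec.[ i ]≔ vertex c))
      ≡⟨ ∑-swap xs (allFin r) _ ⟩
    ∑ (allFin r) (λ c → ∑ xs λ x → p c * Φ x (fs Vec.[ i ]≔ vertex c))
      ≡⟨ ∑-cong (allFin r) (λ c → ∑-*ˡ xs (p c) _) ⟩
    ∑ (allFin r) (λ c → p c * ∑ xs λ x → Φ x (fs Vec.[ i ]≔ vertex c)) ∎
    where open ≡-Reasoning

monochromatic-weight : ∀ {r n k} (c : Vec (Fin r) n) (x : Vec (Fin n) k) col →
  (∀ i → lookup c (lookup x i) ≡ col) →
  weightAt (ℕ→ℚ r) col (Vec.map (vertex (ℕ→ℚ r)) c) x ≡ ℕ→ℚ (r ℕ.^ k)
monochromatic-weight c []      col eq = refl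
monochromatic-weight {r} {k = suc k} c (i ∷ x) col eq = trans
  (cong₂ _*_
    (trans (cong (λ q → q col) (Vecₚ.lookup-map i (vertex (ℕ→ℚ r)) c))
      (trans (cong (_* ℕ→ℚ r) (𝟙-yes (lookup c i Finₚ.≟ col) (eq Fin.zero))) (ℚₚ.*-identityˡ (ℕ→ℚ r))))
    (monochromatic-weight c x col (eq ∘ Fin.suc)))
  (sym (ℕ→ℚ-* r (r ℕ.^ k)))

-- A criterion for uncommonness

solutionCount : Vec ℤ k → ℕ → ℚ
solutionCount a n = ℕ→ℚ (length (solutions a n))

degenerateCount : Vec ℤ k → ℕ → ℚ
degenerateCount a n = ∑ (solutions a n) λ x → 1ℚ - 𝟙 (distinct? x)

-- Over solutions with distinct coordinates, this is r ^ k times the expected number of those in one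
-- of the first two colours. Each remaining colour has weight 1 in this scale and adds 1 per
-- solution.
twoColourSum : Vec ℤ k → ℕ → (ℕ → ℚ) → ℚ
twoColourSum a n g = ∑ (solutions a n) λ x →
  ∏ x (λ i → 1ℚ + g (toℕ i)) + ∏ x (λ i → 1ℚ - g (toℕ i))

weights : (r : ℕ) → ℚ → Fin (2 ℕ.+ r) → ℚ
weights r y Fin.zero              = 1ℚ + y
weights r y (Fin.suc Fin.zero)    = 1ℚ - y
weights r y (Fin.suc (Fin.suc _)) = 1ℚ

weights-isWeight : ∀ r y → ∣ y ∣ ≤ 1ℚ → IsWeight (ℕ→ℚ (2 ℕ.+ r)) (weights r y)
weights-isWeight r y ∣y∣≤1 = nonneg , total
  where
  nonneg : ∀ c → 0ℚ ≤ weights r y c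
  nonneg Fin.zero              = ≤-by {d = y - - 1ℚ} (lemma y) (0≤- (∣p∣≤⇒-≤ ∣y∣≤1))
    where
    lemma : ∀ y → 1ℚ + y - 0ℚ ≡ y - - 1ℚ
    lemma = solve-∀ ℚ-ring
  nonneg (Fin.suc Fin.zero)    = 0≤- (∣p∣≤⇒≤ ∣y∣≤1)
  nonneg (Fin.suc (Fin.suc _)) = 0≤1
  total : ∑ (allFin (2 ℕ.+ r)) (weights r y) ≡ ℕ→ℚ (2 ℕ.+ r)
  total = begin
    1ℚ + y + (1ℚ - y + ∑ (tabulate (λ i → Fin.suc (Fin.suc i))) (weights r y))
      ≡⟨ cong (λ z → 1ℚ + y + (1ℚ - y + z))
           (trans (∑-tabulate r (λ i → Fin.suc (Fin.suc i)) (weights r y) (λ _ → 1ℚ) (λ _ → refl)) (∑<-const r 1ℚ)) ⟩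
    1ℚ + y + (1ℚ - y + ℕ→ℚ r * 1ℚ)
      ≡⟨ lemma y (ℕ→ℚ r) ⟩
    2ℚ + ℕ→ℚ r
      ≡⟨ ℕ→ℚ-+ 2 r ⟨
    ℕ→ℚ (2 ℕ.+ r) ∎
    where
    open ≡-Reasoning
    lemma : ∀ y r → 1ℚ + y + (1ℚ - y + r * 1ℚ) ≡ 2ℚ + r
    lemma = solve-∀ ℚ-ring

∏-1 : ∀ {A : Set} (x : Vec A k) → ∏ x (λ _ → 1ℚ) ≡ 1ℚ
∏-1 []      = refl
∏-1 (_ ∷ x) = trans (ℚₚ.*-identityˡ _) (∏-1 x)

module FewMonochromatic {k : ℕ} (a : Vec ℤ (suc k)) (r n : ℕ) (g : ℕ → ℚ) (∣g∣≤1 : ∀ i → ∣ g i ∣ ≤ 1ℚ) where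

  private
    R = 2 ℕ.+ r
    ρ = ℕ→ℚ R
    D = filter distinct? (solutions a n)
    fs : Vec (Fin R → ℚ) n
    fs = Vec.tabulate λ i → weights r (g (toℕ i))

    Φ : Vec (Fin R → ℚ) n → ℚ
    Φ gs = ∑ D λ x → ∑ (allFin R) λ col → weightAt ρ col gs x

    Φ-affine : Affine ρ Φ
    Φ-affine = ∑-affine ρ D (λ x gs → ∑ (allFin R) λ col → weightAt ρ col gs x) λ {x} x∈D →
      ∑-affine ρ (allFin R) (λ col gs → weightAt ρ col gs x) λ {col} _ →
        weightAt-affine ρ col x (proj₂ (∈-filter⁻ distinct? {xs = solutions a n} x∈D))

    fs-weight : ∀ i → IsWeight ρ (lookup fs i)
    fs-weight i = subst (IsWeight ρ) (sym (Vecₚ.lookup∘tabulate _ i)) (weights-isWeight r _ (∣g∣≤1 (toℕ i)))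

    rounded : ∃[ c ] Φ (Vec.map (vertex ρ) c) ≤ Φ fs
    rounded = rounding ρ (ℚₚ.positive⁻¹ ρ) Φ Φ-affine fs fs-weight

    Φ-fs : ∀ (x : Vec (Fin n) (suc k)) → ∑ (allFin R) (λ col → weightAt ρ col fs x) ≡
      (∏ x (λ i → 1ℚ + g (toℕ i)) + ∏ x (λ i → 1ℚ - g (toℕ i))) + ℕ→ℚ r
    Φ-fs x = begin
      weightAt ρ Fin.zero fs x + (weightAt ρ (Fin.suc Fin.zero) fs x +
        ∑ (tabulate (λ i → Fin.suc (Fin.suc i))) (λ col → weightAt ρ col fs x))
        ≡⟨ cong₂ _+_ (row Fin.zero) (cong₂ _+_ (row (Fin.suc Fin.zero))
             (trans (∑-tabulate r (λ i → Fin.suc (Fin.suc i)) (λ col → weightAt ρ col fs x) (λ _ → 1ℚ)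
                (λ i → trans (row (Fin.suc (Fin.suc i))) (∏-1 x))) (∑<-const r 1ℚ))) ⟩
      p + (q + ℕ→ℚ r * 1ℚ)
        ≡⟨ lemma p q (ℕ→ℚ r) ⟩
      (p + q) + ℕ→ℚ r ∎
      where
      open ≡-Reasoning
      p = ∏ x λ i → 1ℚ + g (toℕ i)
      q = ∏ x λ i → 1ℚ - g (toℕ i)
      row : ∀ col → weightAt ρ col fs x ≡ ∏ x λ i → weights r (g (toℕ i)) col
      row col = ∏-cong x λ i → cong (λ (q : Fin R → ℚ) → q col) (Vecₚ.lookup∘tabulate (λ i → weights r (g (toℕ i))) i)
      lemma : ∀ p q r → p + (q + r * 1ℚ) ≡ (p + q) + r
      lemma = solve-∀ ℚ-ring

    P : ℚ
    P = ℕ→ℚ (R ℕ.^ suc k)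

    0≤P : 0ℚ ≤ P
    0≤P = 0≤ℕ→ℚ (R ℕ.^ suc k)

    Φfs≤ : Φ fs ≤ twoColourSum a n g + ℕ→ℚ r * solutionCount a n
    Φfs≤ = begin
      Φ fs
        ≡⟨ ∑-filter distinct? (solutions a n) _ ⟩
      ∑ (solutions a n) (λ x → 𝟙 (distinct? x) * ∑ (allFin R) (λ col → weightAt ρ col fs x))
        ≤⟨ ∑-mono (solutions a n) (λ x → subst (𝟙 (distinct? x) * ∑ (allFin R) (λ col → weightAt ρ col fs x) ≤_)
             (trans (ℚₚ.*-identityˡ _) (Φ-fs x))
             (*-monoʳ (subst (0ℚ ≤_) (sym (Φ-fs x)) (0≤+ (0≤+ (0≤∏ x λ i → 0≤w Fin.zero i) (0≤∏ x λ i → 0≤w (Fin.suc Fin.zero) i)) (0≤ℕ→ℚ r)))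
                (𝟙≤1 (distinct? x)))) ⟩
      ∑ (solutions a n) (λ x → (∏ x (λ i → 1ℚ + g (toℕ i)) + ∏ x (λ i → 1ℚ - g (toℕ i))) + ℕ→ℚ r)
        ≡⟨ ∑-+ (solutions a n) _ (λ _ → ℕ→ℚ r) ⟩
      twoColourSum a n g + ∑ (solutions a n) (λ _ → ℕ→ℚ r)
        ≡⟨ +-congˡ (twoColourSum a n g) (trans (∑-const (solutions a n) (ℕ→ℚ r)) (ℚₚ.*-comm (solutionCount a n) (ℕ→ℚ r))) ⟩
      twoColourSum a n g + ℕ→ℚ r * solutionCount a n ∎
      where
      open ℚₚ.≤-Reasoning
      0≤w : ∀ c (i : Fin n) → 0ℚ ≤ weights r (g (toℕ i)) c
      0≤w c i = proj₁ (weights-isWeight r _ (∣g∣≤1 (toℕ i))) c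

    monochromatic≤Φ : ∀ (c : Vec (Fin R) n) (x : Vec (Fin n) (suc k)) →
      P * 𝟙 (monochromatic? (lookup c) x) ≤ ∑ (allFin R) λ col → weightAt ρ col (Vec.map (vertex ρ) c) x
    monochromatic≤Φ c x = go (monochromatic? (lookup c) x)
      where
      col = lookup c (lookup x Fin.zero)
      nonneg : ∀ col → 0ℚ ≤ weightAt ρ col (Vec.map (vertex ρ) c) x
      nonneg col = 0≤∏ x λ i → subst (λ q → 0ℚ ≤ q col) (sym (Vecₚ.lookup-map i (vertex ρ) c))
        (0≤* (0≤𝟙 (lookup c i Finₚ.≟ col)) (0≤ℕ→ℚ R))
      go : (d : Dec (Monochromatic (lookup c) x)) →
        P * 𝟙 d ≤ ∑ (allFin R) λ col → weightAt ρ col (Vec.map (vertex ρ) c) x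
      go (yes mono) = begin
        P * 1ℚ
            ≡⟨ ℚₚ.*-identityʳ P ⟩
        P
          ≡⟨ monochromatic-weight c x col (λ i → mono i Fin.zero) ⟨
        weightAt ρ col (Vec.map (vertex ρ) c) x
          ≤⟨ term≤∑ {f = λ col → weightAt ρ col (Vec.map (vertex ρ) c) x} nonneg (∈-allFin col) ⟩
        ∑ (allFin R) (λ col → weightAt ρ col (Vec.map (vertex ρ) c) x) ∎
        where open ℚₚ.≤-Reasoning
      go (no _) = subst (_≤ ∑ (allFin R) λ col → weightAt ρ col (Vec.map (vertex ρ) c) x)
        (sym (ℚₚ.*-zeroʳ P)) (0≤∑ (allFin R) nonneg)

  -- Rounding says nothing about solutions with repeated coordinates; all of them are counted as
  -- monochromatic, at a cost of `P` each. Extending the fractional sum from distinct to all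
  -- solutions only increases it, because the weights are non-negative.
  few-monochromatic : ∃[ c ] P * ℕ→ℚ (length (monochromaticSolutions {r = R} {n = n} a c)) ≤
    twoColourSum a n g + ℕ→ℚ r * solutionCount a n + P * degenerateCount a n
  few-monochromatic = lookup c , (begin
    P * ℕ→ℚ (length (monochromaticSolutions a (lookup c)))
      ≡⟨ cong (P *_) (trans (length≡∑ (monochromaticSolutions a (lookup c))) (trans (∑-filter mono? S (λ _ → 1ℚ)) (∑-cong S λ x → ℚₚ.*-identityʳ _))) ⟩
    P * ∑ S (𝟙 ∘ mono?)
      ≤⟨ *-monoˡ 0≤P (∑-mono S λ x → split x) ⟩
    P * ∑ S (λ x → 𝟙 (distinct? x) * 𝟙 (mono? x) + (1ℚ - 𝟙 (distinct? x)))
      ≡⟨ trans (cong (P *_) (∑-+ S (λ x → 𝟙 (distinct? x) * 𝟙 (mono? x)) (λ x → 1ℚ - 𝟙 (distinct? x))))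
           (ℚₚ.*-distribˡ-+ P (∑ S λ x → 𝟙 (distinct? x) * 𝟙 (mono? x)) (degenerateCount a n)) ⟩
    P * ∑ S (λ x → 𝟙 (distinct? x) * 𝟙 (mono? x)) + P * degenerateCount a n
      ≤⟨ ℚₚ.+-monoˡ-≤ (P * degenerateCount a n) main ⟩
    twoColourSum a n g + ℕ→ℚ r * solutionCount a n + P * degenerateCount a n ∎)
    where
    open ℚₚ.≤-Reasoning
    S = solutions a n
    c = proj₁ rounded
    mono? : (x : Vec (Fin n) (suc k)) → Dec (Monochromatic (lookup c) x)
    mono? = monochromatic? (lookup c)
    split : ∀ x → 𝟙 (mono? x) ≤ 𝟙 (distinct? x) * 𝟙 (mono? x) + (1ℚ - 𝟙 (distinct? x))
    split x = ≤-by (lemma (𝟙 (distinct? x)) (𝟙 (mono? x)))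
      (0≤* (0≤- (𝟙≤1 (distinct? x))) (0≤- (𝟙≤1 (mono? x))))
      where
      lemma : ∀ d m → d * m + (1ℚ - d) - m ≡ (1ℚ - d) * (1ℚ - m)
      lemma = solve-∀ ℚ-ring
    main : P * ∑ S (λ x → 𝟙 (distinct? x) * 𝟙 (mono? x)) ≤ twoColourSum a n g + ℕ→ℚ r * solutionCount a n
    main = begin
      P * ∑ S (λ x → 𝟙 (distinct? x) * 𝟙 (mono? x))
        ≡⟨ cong (P *_) (∑-filter distinct? S (𝟙 ∘ mono?)) ⟨
      P * ∑ D (𝟙 ∘ mono?)
        ≡⟨ ∑-*ˡ D P (𝟙 ∘ mono?) ⟨
      ∑ D (λ x → P * 𝟙 (mono? x))
        ≤⟨ ∑-mono D (monochromatic≤Φ c) ⟩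
      Φ (Vec.map (vertex ρ) c)
        ≤⟨ proj₂ rounded ⟩
      Φ fs
        ≤⟨ Φfs≤ ⟩
      twoColourSum a n g + ℕ→ℚ r * solutionCount a n ∎

-- The comparison takes place among unnormalised fractions, where both sides are explicit and no gcd
-- appears.
/-* : ∀ z d .{{_ : ℕ.NonZero d}} → z ℚ./ d * ℕ→ℚ d ≡ ι z
/-* z (suc d) = ℚₚ.toℚᵘ-injective (begin-equality
  ℚ.toℚᵘ (z ℚ./ suc d * ℕ→ℚ (suc d))                ≃⟨ ℚₚ.toℚᵘ-homo-* (z ℚ./ suc d) (ℕ→ℚ (suc d)) ⟩
  ℚ.toℚᵘ (z ℚ./ suc d) ℚᵘ.* ℚᵘ.mkℚᵘ (+ suc d) 0      ≃⟨ ℚᵘₚ.*-congʳ {ℚᵘ.mkℚᵘ (+ suc d) 0} (ℚₚ.toℚᵘ-fromℚᵘ (ℚᵘ.mkℚᵘ z d)) ⟩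
  ℚᵘ.mkℚᵘ z d ℚᵘ.* ℚᵘ.mkℚᵘ (+ suc d) 0               ≃⟨ ℚᵘ.*≡* (lemma z (+ suc d)) ⟩
  ℚᵘ.mkℚᵘ z 0 ∎)
  where
  open ℚᵘₚ.≤-Reasoning
  lemma : ∀ z d → z ℤ.* d ℤ.* + 1 ≡ z ℤ.* (d ℤ.* + 1)
  lemma = ℤ-Solver.solve-∀

randomProportion-* : ∀ r .{{_ : ℕ.NonZero r}} k → randomProportion r k * ℕ→ℚ (r ℕ.^ k) ≡ ℕ→ℚ r
randomProportion-* r k = /-* (+ r) (r ℕ.^ k) {{ℕₚ.m^n≢0 r k}}

-- Multiplied by `P`, commonness gives the rounded colouring at least R - η/2 per solution, while
-- rounding gives at most R - η.
uncommon-criterion : ∀ {k} (a : Vec ℤ (suc k)) r .{{_ : ℕ.NonZero r}} → 2 ℕ.≤ r → ∀ η → 0ℚ < η → η ≤ 1ℚ →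
  (∀ N → ∃[ n ] N ℕ.≤ n × ∃[ g ] (∀ i → ∣ g i ∣ ≤ 1ℚ) ×
    twoColourSum a n g + ℕ→ℚ (r ℕ.^ suc k) * degenerateCount a n ≤ (2ℚ - η) * solutionCount a n) →
  Uncommon r a
uncommon-criterion {k} a (suc (suc r)) (ℕ.s≤s (ℕ.s≤s ℕ.z≤n)) η 0<η η≤1 few common = final (length (solutions a M)) refl
  where
  R = suc (suc r)
  instance
    R^k≢0 : ℕ.NonZero (R ℕ.^ suc k)
    R^k≢0 = ℕₚ.m^n≢0 R (suc k)
  P = ℕ→ℚ (R ℕ.^ suc k)
  rp = randomProportion R (suc k)
  u = + 1 ℚ./ (R ℕ.^ suc k)
  0<P : 0ℚ < P
  0<P = ℚₚ.positive⁻¹ P {{Pos (R ℕ.^ suc k)}}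
    where
    Pos : ∀ m .{{_ : ℕ.NonZero m}} → ℚ.Positive (ℕ→ℚ m)
    Pos (suc m) = _
  0<u : 0ℚ < u
  0<u = ℚₚ.positive⁻¹ u {{ℚₚ.normalize-pos 1 (R ℕ.^ suc k)}}
  -- This is η/2 after multiplication by `P`, so that a gap of η/2 remains.
  ε = η * ½ * u
  N = proj₁ (common ε (0<* (0<* 0<η (ℚₚ.positive⁻¹ ½)) 0<u))
  M = proj₁ (few N)
  g = proj₁ (proj₂ (proj₂ (few N)))
  colouring = FewMonochromatic.few-monochromatic a r M g (proj₁ (proj₂ (proj₂ (proj₂ (few N)))))
  c = proj₁ colouring
  m = ℕ→ℚ (length (monochromaticSolutions a c))
  s = solutionCount a M
  T = twoColourSum a M g
  d = degenerateCount a M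

  m≤ : P * m ≤ (ℕ→ℚ R - η) * s
  m≤ = begin
    P * m                                    ≤⟨ proj₂ colouring ⟩
    T + ℕ→ℚ r * s + P * d                    ≡⟨ lemma T (ℕ→ℚ r * s) (P * d) ⟩
    (T + P * d) + ℕ→ℚ r * s                  ≤⟨ ℚₚ.+-monoˡ-≤ (ℕ→ℚ r * s) (proj₂ (proj₂ (proj₂ (proj₂ (few N))))) ⟩
    (2ℚ - η) * s + ℕ→ℚ r * s                 ≡⟨ lemma′ η s (ℕ→ℚ r) ⟩
    (2ℚ + ℕ→ℚ r - η) * s                     ≡⟨ cong (λ x → (x - η) * s) (ℕ→ℚ-+ 2 r) ⟨
    (ℕ→ℚ R - η) * s                          ∎
    where
    open ℚₚ.≤-Reasoning
    lemma : ∀ x y z → x + y + z ≡ (x + z) + y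
    lemma = solve-∀ ℚ-ring
    lemma′ : ∀ η s r → (2ℚ - η) * s + r * s ≡ (2ℚ + r - η) * s
    lemma′ = solve-∀ ℚ-ring

  bound : rp - ε ≤ monochromaticProportion a c
  bound = proj₂ (common ε _) M (proj₁ (proj₂ (few N))) c

  scaled : P * (rp - ε) ≡ ℕ→ℚ R - η * ½
  scaled = trans (lemma P rp (η * ½) u) (trans
    (cong₂ (λ x y → x - η * ½ * y) (randomProportion-* R (suc k)) (/-* (+ 1) (R ℕ.^ suc k)))
    (cong (λ e → ℕ→ℚ R - e) (ℚₚ.*-identityʳ (η * ½))))
    where
    lemma : ∀ P q e u → P * (q - e * u) ≡ q * P - e * (u * P)
    lemma = solve-∀ ℚ-ring

  final : ∀ l → length (solutions a M) ≡ l → ⊥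
  -- Without solutions the proportion is 0 by convention, yet R - η/2 is positive because R ≥ 2 and
  -- η ≤ 1.
  final zero    eq = ℚₚ.<-irrefl {0ℚ} refl (ℚₚ.<-≤-trans positive nonpositive)
    where
    nonpositive : ℕ→ℚ R - η * ½ ≤ 0ℚ
    nonpositive = subst₂ _≤_ scaled (trans (cong (λ l → P * ratio (length (monochromaticSolutions a c)) l) eq) (ℚₚ.*-zeroʳ P))
      (*-monoˡ (ℚₚ.<⇒≤ 0<P) bound)
    positive : 0ℚ < ℕ→ℚ R - η * ½
    positive = <-by {d = (1ℚ + ℕ→ℚ r) + ((1ℚ - η) + η * ½)}
      (trans (cong (λ x → x - η * ½ - 0ℚ) (ℕ→ℚ-+ 2 r)) (lemma η (ℕ→ℚ r)))
      (ℚₚ.<-≤-trans (ℚₚ.positive⁻¹ 1ℚ) (≤-by (lemma₂ (ℕ→ℚ r) ((1ℚ - η) + η * ½))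
        (0≤+ (0≤ℕ→ℚ r) (0≤+ (0≤- η≤1) (0≤* (ℚₚ.<⇒≤ 0<η) (ℚₚ.<⇒≤ (ℚₚ.positive⁻¹ ½)))))))
      where
      lemma : ∀ η r → 2ℚ + r - η * ½ - 0ℚ ≡ (1ℚ + r) + ((1ℚ - η) + η * ½)
      lemma = solve-∀ ℚ-ring
      lemma₂ : ∀ r e → 1ℚ + r + e - 1ℚ ≡ r + e
      lemma₂ = solve-∀ ℚ-ring
  final (suc l) eq = ℚₚ.<-irrefl {0ℚ} refl (ℚₚ.<-≤-trans (0<* (0<* 0<η (ℚₚ.positive⁻¹ ½)) 0<s) nonpositive)
    where
    0<s : 0ℚ < s
    0<s = subst (λ l → 0ℚ < ℕ→ℚ l) (sym eq) (ℚₚ.positive⁻¹ (ℕ→ℚ (suc l)))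
    ratio-* : ∀ p q → q ≡ suc l → ratio p q * ℕ→ℚ q ≡ ℕ→ℚ p
    ratio-* p .(suc l) refl = /-* (+ p) (suc l)
    chain : (ℕ→ℚ R - η * ½) * s ≤ (ℕ→ℚ R - η) * s
    chain = begin
      (ℕ→ℚ R - η * ½) * s                    ≡⟨ cong (_* s) scaled ⟨
      P * (rp - ε) * s                       ≤⟨ *-monoʳ (ℚₚ.<⇒≤ 0<s) (*-monoˡ (ℚₚ.<⇒≤ 0<P) bound) ⟩
      P * monochromaticProportion a c * s    ≡⟨ ℚₚ.*-assoc P (monochromaticProportion a c) s ⟩
      P * (monochromaticProportion a c * s)  ≡⟨ cong (P *_) (ratio-* (length (monochromaticSolutions a c)) (length (solutions a M)) eq) ⟩
      P * m                                  ≤⟨ m≤ ⟩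
      (ℕ→ℚ R - η) * s                        ∎
      where open ℚₚ.≤-Reasoning
    nonpositive : η * ½ * s ≤ 0ℚ
    nonpositive = ≤-by (lemma (ℕ→ℚ R) η s) (0≤- chain)
      where
      lemma : ∀ R η s → 0ℚ - η * ½ * s ≡ (R - η) * s - (R - η * ½) * s
      lemma = solve-∀ ℚ-ring

≤ι∣↥∣ : ∀ q → q ≤ ℕ→ℚ ℤ.∣ ℚ.↥ q ∣
≤ι∣↥∣ (mkℚ n d _) = ℚ.*≤* (begin
  n ℤ.* + 1                    ≡⟨ ℤₚ.*-identityʳ n ⟩
  n                            ≤⟨ n≤∣n∣ n ⟩
  + ℤ.∣ n ∣                    ≤⟨ ℤ.+≤+ (ℕₚ.m≤m*n ℤ.∣ n ∣ (suc d)) ⟩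
  + (ℤ.∣ n ∣ ℕ.* suc d)        ≡⟨ ℤₚ.pos-* ℤ.∣ n ∣ (suc d) ⟩
  + ℤ.∣ n ∣ ℤ.* + suc d        ∎)
  where
  open ℤₚ.≤-Reasoning
  n≤∣n∣ : ∀ n → n ℤ.≤ + ℤ.∣ n ∣
  n≤∣n∣ (+ n)    = ℤₚ.≤-refl
  n≤∣n∣ -[1+ n ] = ℤ.-≤+

-- The witness is the absolute numerator of p times the denominator of q: the former bounds p, and
-- the latter turns q into a positive integer.
archimedean : ∀ q → 0ℚ < q → ∀ p → ∃[ N ] p ≤ ℕ→ℚ N * q
archimedean q 0<q p = ℤ.∣ ℚ.↥ p ∣ ℕ.* ℚ.↧ₙ q , (begin
  p                                             ≤⟨ ≤ι∣↥∣ p ⟩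
  ℕ→ℚ ℤ.∣ ℚ.↥ p ∣                               ≡⟨ ℚₚ.*-identityʳ (ℕ→ℚ ℤ.∣ ℚ.↥ p ∣) ⟨
  ℕ→ℚ ℤ.∣ ℚ.↥ p ∣ * 1ℚ                          ≤⟨ *-monoˡ (0≤ℕ→ℚ ℤ.∣ ℚ.↥ p ∣) 1≤ ⟩
  ℕ→ℚ ℤ.∣ ℚ.↥ p ∣ * (ℕ→ℚ (ℚ.↧ₙ q) * q)          ≡⟨ ℚₚ.*-assoc (ℕ→ℚ ℤ.∣ ℚ.↥ p ∣) (ℕ→ℚ (ℚ.↧ₙ q)) q ⟨
  ℕ→ℚ ℤ.∣ ℚ.↥ p ∣ * ℕ→ℚ (ℚ.↧ₙ q) * q            ≡⟨ cong (_* q) (ℕ→ℚ-* ℤ.∣ ℚ.↥ p ∣ (ℚ.↧ₙ q)) ⟨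
  ℕ→ℚ (ℤ.∣ ℚ.↥ p ∣ ℕ.* ℚ.↧ₙ q) * q              ∎)
  where
  open ℚₚ.≤-Reasoning
  1≤ι↥ : ∀ q .{{_ : ℚ.Positive q}} → 1ℚ ≤ ι (ℚ.↥ q)
  1≤ι↥ (mkℚ (+ suc n) _ _) = ℕ→ℚ-mono-≤ {1} (ℕ.s≤s ℕ.z≤n)
  clear : ℕ→ℚ (ℚ.↧ₙ q) * q ≡ ι (ℚ.↥ q)
  clear = trans (ℚₚ.*-comm (ℕ→ℚ (ℚ.↧ₙ q)) q)
    (trans (cong (_* ℕ→ℚ (ℚ.↧ₙ q)) (sym (ℚₚ.↥p/↧p≡p q))) (/-* (ℚ.↥ q) (ℚ.↧ₙ q)))
  1≤ : 1ℚ ≤ ℕ→ℚ (ℚ.↧ₙ q) * q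
  1≤ = subst (1ℚ ≤_) (sym clear) (1≤ι↥ q {{ℚ.positive 0<q}})

0≤p² : ∀ p → 0ℚ ≤ p * p
0≤p² p with ℚₚ.≤-total 0ℚ p
... | inj₁ 0≤p = 0≤* 0≤p 0≤p
... | inj₂ p≤0 = subst (0ℚ ≤_) (lemma p) (0≤* (0≤- p≤0) (0≤- p≤0))
  where
  lemma : ∀ p → (0ℚ - p) * (0ℚ - p) ≡ p * p
  lemma = solve-∀ ℚ-ring

-- A cosine with rational values: the real part of the powers of (3 + 4i)/5,
-- which is on the unit circle but not a root of unity.

⅗ ⅘ : ℚ
⅗ = + 3 ℚ./ 5
⅘ = + 4 ℚ./ 5

cosℕ sinℕ : ℕ → ℚ
cosℕ zero    = 1ℚ
cosℕ (suc m) = ⅗ * cosℕ m - ⅘ * sinℕ m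
sinℕ zero    = 0ℚ
sinℕ (suc m) = ⅘ * cosℕ m + ⅗ * sinℕ m

cosℕ-+ : ∀ m n → cosℕ (m ℕ.+ n) ≡ cosℕ m * cosℕ n - sinℕ m * sinℕ n
sinℕ-+ : ∀ m n → sinℕ (m ℕ.+ n) ≡ sinℕ m * cosℕ n + cosℕ m * sinℕ n
cosℕ-+ zero    n = lemma (cosℕ n) (sinℕ n)
  where
  lemma : ∀ x y → x ≡ 1ℚ * x - 0ℚ * y
  lemma = solve-∀ ℚ-ring
cosℕ-+ (suc m) n = trans
  (cong₂ (λ x y → ⅗ * x - ⅘ * y) (cosℕ-+ m n) (sinℕ-+ m n))
  (lemma (cosℕ m) (sinℕ m) (cosℕ n) (sinℕ n))
  where
  lemma : ∀ a b x y → ⅗ * (a * x - b * y) - ⅘ * (b * x + a * y) ≡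
    (⅗ * a - ⅘ * b) * x - (⅘ * a + ⅗ * b) * y
  lemma = solve-∀ ℚ-ring
sinℕ-+ zero    n = lemma (cosℕ n) (sinℕ n)
  where
  lemma : ∀ x y → y ≡ 0ℚ * x + 1ℚ * y
  lemma = solve-∀ ℚ-ring
sinℕ-+ (suc m) n = trans
  (cong₂ (λ x y → ⅘ * x + ⅗ * y) (cosℕ-+ m n) (sinℕ-+ m n))
  (lemma (cosℕ m) (sinℕ m) (cosℕ n) (sinℕ n))
  where
  lemma : ∀ a b x y → ⅘ * (a * x - b * y) + ⅗ * (b * x + a * y) ≡
    (⅘ * a + ⅗ * b) * x + (⅗ * a - ⅘ * b) * y
  lemma = solve-∀ ℚ-ring

cosℕ²+sinℕ² : ∀ m → cosℕ m * cosℕ m + sinℕ m * sinℕ m ≡ 1ℚ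
cosℕ²+sinℕ² zero    = refl
cosℕ²+sinℕ² (suc m) = trans (lemma (cosℕ m) (sinℕ m)) (cosℕ²+sinℕ² m)
  where
  lemma : ∀ a b → (⅗ * a - ⅘ * b) * (⅗ * a - ⅘ * b) + (⅘ * a + ⅗ * b) * (⅘ * a + ⅗ * b) ≡ a * a + b * b
  lemma = solve-∀ ℚ-ring

cos sin : ℤ → ℚ
cos x = cosℕ ℤ.∣ x ∣
sin (+ m)      = sinℕ m
sin -[1+ m ]   = - sinℕ (suc m)

cos-⊖ : ∀ m n → cos (m ℤ.⊖ n) ≡ cosℕ m * cosℕ n + sinℕ m * sinℕ n
cos-⊖ zero    zero    = refl
cos-⊖ (suc m) zero    = lemma (cosℕ (suc m)) (sinℕ (suc m))
  where
  lemma : ∀ a b → a ≡ a * 1ℚ + b * 0ℚ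
  lemma = solve-∀ ℚ-ring
cos-⊖ zero    (suc n) = lemma (cosℕ (suc n)) (sinℕ (suc n))
  where
  lemma : ∀ a b → a ≡ 1ℚ * a + 0ℚ * b
  lemma = solve-∀ ℚ-ring
cos-⊖ (suc m) (suc n) = trans (cong cos (ℤₚ.[1+m]⊖[1+n]≡m⊖n m n)) (trans (cos-⊖ m n)
  (lemma (cosℕ m) (sinℕ m) (cosℕ n) (sinℕ n)))
  where
  lemma : ∀ a b x y → a * x + b * y ≡
    (⅗ * a - ⅘ * b) * (⅗ * x - ⅘ * y) + (⅘ * a + ⅗ * b) * (⅘ * x + ⅗ * y)
  lemma = solve-∀ ℚ-ring

cos-+ : ∀ x y → cos (x ℤ.+ y) ≡ cos x * cos y - sin x * sin y
cos-+ (+ m)    (+ n)    = cosℕ-+ m n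
cos-+ (+ m)    -[1+ n ] = trans (cos-⊖ m (suc n)) (lemma (cosℕ m) (sinℕ m) (cosℕ (suc n)) (sinℕ (suc n)))
  where
  lemma : ∀ a b x y → a * x + b * y ≡ a * x - b * (- y)
  lemma = solve-∀ ℚ-ring
cos-+ -[1+ m ] (+ n)    = trans (cos-⊖ n (suc m)) (lemma (cosℕ n) (sinℕ n) (cosℕ (suc m)) (sinℕ (suc m)))
  where
  lemma : ∀ a b x y → a * x + b * y ≡ x * a - (- y) * b
  lemma = solve-∀ ℚ-ring
cos-+ -[1+ m ] -[1+ n ] = trans (cong cosℕ (cong suc (sym (ℕₚ.+-suc m n))))
  (trans (cosℕ-+ (suc m) (suc n)) (lemma (cosℕ (suc m)) (sinℕ (suc m)) (cosℕ (suc n)) (sinℕ (suc n))))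
  where
  lemma : ∀ a b x y → a * x - b * y ≡ a * x - (- b) * (- y)
  lemma = solve-∀ ℚ-ring

cos-neg : ∀ x → cos (ℤ.- x) ≡ cos x
cos-neg x = cong cosℕ (ℤₚ.∣-i∣≡∣i∣ x)

sin-neg : ∀ x → sin (ℤ.- x) ≡ - sin x
sin-neg (+ zero)  = refl
sin-neg (+ suc m) = refl
sin-neg -[1+ m ]  = lemma (sinℕ (suc m))
  where
  lemma : ∀ a → a ≡ - (- a)
  lemma = solve-∀ ℚ-ring

cos-product : ∀ x y → cos (x ℤ.+ y) + cos (x ℤ.- y) ≡ 2ℚ * (cos x * cos y)
cos-product x y = trans
  (cong₂ _+_ (cos-+ x y) (trans (cos-+ x (ℤ.- y))
    (cong₂ (λ a b → cos x * a - sin x * b) (cos-neg y) (sin-neg y))))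
  (lemma (cos x) (sin x) (cos y) (sin y))
  where
  lemma : ∀ a b x y → a * x - b * y + (a * x - b * (- y)) ≡ 2ℚ * (a * x)
  lemma = solve-∀ ℚ-ring

-- Otherwise 1 < |c| ≤ c² ≤ c² + s² = 1.
∣cos∣≤1 : ∀ x → ∣ cos x ∣ ≤ 1ℚ
∣cos∣≤1 x with ℚₚ.<-cmp 1ℚ ∣ cos x ∣
... | tri≈ _ eq _ = ℚₚ.≤-reflexive (sym eq)
... | tri> _ _ lt = ℚₚ.<⇒≤ lt
... | tri< 1<c _ _ = ⊥-elim (ℚₚ.<-irrefl {1ℚ} refl (begin-strict
  1ℚ                              <⟨ 1<c ⟩
  ∣ c ∣                           ≡⟨ ℚₚ.*-identityˡ ∣ c ∣ ⟨
  1ℚ * ∣ c ∣                      ≤⟨ *-monoʳ (ℚₚ.0≤∣p∣ c) (ℚₚ.<⇒≤ 1<c) ⟩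
  ∣ c ∣ * ∣ c ∣                   ≡⟨ ℚₚ.∣p*q∣≡∣p∣*∣q∣ c c ⟨
  ∣ c * c ∣                       ≡⟨ ℚₚ.0≤p⇒∣p∣≡p (0≤p² c) ⟩
  c * c                           ≤⟨ ≤-by (lemma c s) (0≤p² s) ⟩
  c * c + s * s                   ≡⟨ cosℕ²+sinℕ² ℤ.∣ x ∣ ⟩
  1ℚ                              ∎))
  where
  open ℚₚ.≤-Reasoning
  c = cos x
  s = sinℕ ℤ.∣ x ∣
  lemma : ∀ c s → c * c + s * s - c * c ≡ s * s
  lemma = solve-∀ ℚ-ring

cos≤1 : ∀ x → cos x ≤ 1ℚ
cos≤1 x = ∣p∣≤⇒≤ (∣cos∣≤1 x)

-- (3 + 4i)ᵐ, whose real and imaginary parts are 3 and 4 modulo 5 when m > 0.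

gaussRe gaussIm : ℕ → ℤ
gaussRe zero    = + 1
gaussRe (suc m) = + 3 ℤ.* gaussRe m ℤ.- + 4 ℤ.* gaussIm m
gaussIm zero    = + 0
gaussIm (suc m) = + 4 ℤ.* gaussRe m ℤ.+ + 3 ℤ.* gaussIm m

gauss-scale : ∀ m → (ℕ→ℚ (5 ℕ.^ m) * cosℕ m ≡ ι (gaussRe m)) × (ℕ→ℚ (5 ℕ.^ m) * sinℕ m ≡ ι (gaussIm m))
gauss-scale zero    = refl , refl
gauss-scale (suc m) with gauss-scale m
... | re , im =
  (begin
    ℕ→ℚ (5 ℕ.^ suc m) * (⅗ * cosℕ m - ⅘ * sinℕ m)
      ≡⟨ cong (_* (⅗ * cosℕ m - ⅘ * sinℕ m)) (ℕ→ℚ-* 5 (5 ℕ.^ m)) ⟩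
    ℕ→ℚ 5 * f * (⅗ * cosℕ m - ⅘ * sinℕ m)
      ≡⟨ lemma f (cosℕ m) (sinℕ m) ⟩
    ℕ→ℚ 3 * (f * cosℕ m) + ι (ℤ.- + 4) * (f * sinℕ m)
      ≡⟨ cong₂ (λ x y → ℕ→ℚ 3 * x + ι (ℤ.- + 4) * y) re im ⟩
    ι (+ 3) * ι (gaussRe m) + ι (ℤ.- + 4) * ι (gaussIm m)
      ≡⟨ cong₂ _+_ (ι-* (+ 3) (gaussRe m)) (ι-* (ℤ.- + 4) (gaussIm m)) ⟨
    ι (+ 3 ℤ.* gaussRe m) + ι (ℤ.- + 4 ℤ.* gaussIm m)
      ≡⟨ ι-+ (+ 3 ℤ.* gaussRe m) (ℤ.- + 4 ℤ.* gaussIm m) ⟨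
    ι (+ 3 ℤ.* gaussRe m ℤ.+ ℤ.- + 4 ℤ.* gaussIm m)
      ≡⟨ cong (λ z → ι (+ 3 ℤ.* gaussRe m ℤ.+ z)) (ℤₚ.neg-distribˡ-* (+ 4) (gaussIm m)) ⟨
    ι (gaussRe (suc m)) ∎) ,
  (begin
    ℕ→ℚ (5 ℕ.^ suc m) * (⅘ * cosℕ m + ⅗ * sinℕ m)
      ≡⟨ cong (_* (⅘ * cosℕ m + ⅗ * sinℕ m)) (ℕ→ℚ-* 5 (5 ℕ.^ m)) ⟩
    ℕ→ℚ 5 * f * (⅘ * cosℕ m + ⅗ * sinℕ m)
      ≡⟨ lemma′ f (cosℕ m) (sinℕ m) ⟩
    ℕ→ℚ 4 * (f * cosℕ m) + ℕ→ℚ 3 * (f * sinℕ m)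
      ≡⟨ cong₂ (λ x y → ℕ→ℚ 4 * x + ℕ→ℚ 3 * y) re im ⟩
    ι (+ 4) * ι (gaussRe m) + ι (+ 3) * ι (gaussIm m)
      ≡⟨ cong₂ _+_ (ι-* (+ 4) (gaussRe m)) (ι-* (+ 3) (gaussIm m)) ⟨
    ι (+ 4 ℤ.* gaussRe m) + ι (+ 3 ℤ.* gaussIm m)
      ≡⟨ ι-+ (+ 4 ℤ.* gaussRe m) (+ 3 ℤ.* gaussIm m) ⟨
    ι (gaussIm (suc m)) ∎)
  where
  open ≡-Reasoning
  f = ℕ→ℚ (5 ℕ.^ m)
  lemma : ∀ f c s → ℕ→ℚ 5 * f * (⅗ * c - ⅘ * s) ≡ ℕ→ℚ 3 * (f * c) + ι (ℤ.- + 4) * (f * s)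
  lemma = solve-∀ ℚ-ring
  lemma′ : ∀ f c s → ℕ→ℚ 5 * f * (⅘ * c + ⅗ * s) ≡ ℕ→ℚ 4 * (f * c) + ℕ→ℚ 3 * (f * s)
  lemma′ = solve-∀ ℚ-ring

gauss-mod-5 : ∀ m → ∃[ u ] ∃[ v ]
  gaussRe (suc m) ≡ + 5 ℤ.* u ℤ.+ + 3 × gaussIm (suc m) ≡ + 5 ℤ.* v ℤ.+ + 4
gauss-mod-5 zero    = + 0 , + 0 , refl , refl
gauss-mod-5 (suc m) with gauss-mod-5 m
... | u , v , re , im =
  + 3 ℤ.* u ℤ.- + 4 ℤ.* v ℤ.- + 2 , + 4 ℤ.* u ℤ.+ + 3 ℤ.* v ℤ.+ + 4 ,
  trans (cong₂ (λ x y → + 3 ℤ.* x ℤ.- + 4 ℤ.* y) re im) (lemma u v) ,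
  trans (cong₂ (λ x y → + 4 ℤ.* x ℤ.+ + 3 ℤ.* y) re im) (lemma′ u v)
  where
  lemma : ∀ u v → + 3 ℤ.* (+ 5 ℤ.* u ℤ.+ + 3) ℤ.- + 4 ℤ.* (+ 5 ℤ.* v ℤ.+ + 4) ≡
    + 5 ℤ.* (+ 3 ℤ.* u ℤ.- + 4 ℤ.* v ℤ.- + 2) ℤ.+ + 3
  lemma = ℤ-Solver.solve-∀
  lemma′ : ∀ u v → + 4 ℤ.* (+ 5 ℤ.* u ℤ.+ + 3) ℤ.+ + 3 ℤ.* (+ 5 ℤ.* v ℤ.+ + 4) ≡
    + 5 ℤ.* (+ 4 ℤ.* u ℤ.+ + 3 ℤ.* v ℤ.+ + 4) ℤ.+ + 4
  lemma′ = ℤ-Solver.solve-∀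

-- Here the angle is seen to be no rational multiple of π: cosine 1 would make the real part of (3 +
-- 4i)^(m+1) equal to 5^(m+1), but it is 3 modulo 5.
cosℕ≢1 : ∀ m → cosℕ (suc m) ≢ 1ℚ
cosℕ≢1 m cos≡1 with gauss-mod-5 m
... | u , _ , re , _ = 5z≢3 (ℤ.∣ + (5 ℕ.^ m) ℤ.- u ∣) (trans (sym (ℤₚ.∣i*j∣≡∣i∣*∣j∣ (+ 5) (+ (5 ℕ.^ m) ℤ.- u))) (cong ℤ.∣_∣ 5z≡3))
  where
  5z≢3 : ∀ z → 5 ℕ.* z ≢ 3
  5z≢3 (suc z) eq with trans (sym (ℕₚ.*-suc 5 z)) eq
  ... | ()
  power : + 5 ℤ.* + (5 ℕ.^ m) ≡ + 5 ℤ.* u ℤ.+ + 3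
  power = trans (sym (ℤₚ.pos-* 5 (5 ℕ.^ m))) (trans (ι-injective (begin
    ℕ→ℚ (5 ℕ.^ suc m)                       ≡⟨ ℚₚ.*-identityʳ (ℕ→ℚ (5 ℕ.^ suc m)) ⟨
    ℕ→ℚ (5 ℕ.^ suc m) * 1ℚ                  ≡⟨ cong (ℕ→ℚ (5 ℕ.^ suc m) *_) cos≡1 ⟨
    ℕ→ℚ (5 ℕ.^ suc m) * cosℕ (suc m)        ≡⟨ proj₁ (gauss-scale (suc m)) ⟩
    ι (gaussRe (suc m))                     ∎)) re)
    where open ≡-Reasoning
  5z≡3 : + 5 ℤ.* (+ (5 ℕ.^ m) ℤ.- u) ≡ + 3
  5z≡3 = trans (lemma (+ (5 ℕ.^ m)) u) (trans (cong (ℤ._- (+ 5 ℤ.* u)) power) (lemma′ u))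
    where
    lemma : ∀ p u → + 5 ℤ.* (p ℤ.- u) ≡ + 5 ℤ.* p ℤ.- + 5 ℤ.* u
    lemma = ℤ-Solver.solve-∀
    lemma′ : ∀ u → + 5 ℤ.* u ℤ.+ + 3 ℤ.- + 5 ℤ.* u ≡ + 3
    lemma′ = ℤ-Solver.solve-∀

cos≢1 : ∀ {x} → x ≢ 0ℤ → cos x ≢ 1ℚ
cos≢1 {+ zero}   x≢0 = ⊥-elim (x≢0 refl)
cos≢1 {+ suc m}  x≢0 = cosℕ≢1 m
cos≢1 { -[1+ m ]} x≢0 = cosℕ≢1 m

0<1-cos : ∀ {x} → x ≢ 0ℤ → 0ℚ < 1ℚ - cos x
0<1-cos {x} x≢0 with ℚₚ.<-cmp (cos x) 1ℚ
... | tri< lt _ _ = 0<- lt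
... | tri≈ _ eq _ = ⊥-elim (cos≢1 x≢0 eq)
... | tri> _ _ gt = ⊥-elim (ℚₚ.<-irrefl refl (ℚₚ.<-≤-trans gt (cos≤1 x)))

-- While the cosine stays non-negative, doubling the angle at least doubles 1 - cos.
negative-cos-or-small : ∀ j x → (∃[ t ] cos (t ℤ.* x) < 0ℚ) ⊎ ℕ→ℚ (2 ℕ.^ j) * (1ℚ - cos x) ≤ 1ℚ
negative-cos-or-small j x with cos x ℚₚ.<? 0ℚ
... | yes c<0 = inj₁ (+ 1 , subst (λ z → cos z < 0ℚ) (sym (ℤₚ.*-identityˡ x)) c<0)
negative-cos-or-small zero    x | no c≮0 = inj₂ (≤-by (lemma (cos x)) (ℚₚ.≮⇒≥ c≮0))
  where
  lemma : ∀ c → 1ℚ - 1ℚ * (1ℚ - c) ≡ c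
  lemma = solve-∀ ℚ-ring
negative-cos-or-small (suc j) x | no c≮0 with negative-cos-or-small j (x ℤ.+ x)
... | inj₁ (t , c<0) = inj₁ (t ℤ.+ t , subst (λ z → cos z < 0ℚ) (lemma t x) c<0)
  where
  lemma : ∀ t x → t ℤ.* (x ℤ.+ x) ≡ (t ℤ.+ t) ℤ.* x
  lemma = ℤ-Solver.solve-∀
... | inj₂ small = inj₂ (begin
  ℕ→ℚ (2 ℕ.^ suc j) * (1ℚ - c)             ≡⟨ cong (_* (1ℚ - c)) (ℕ→ℚ-* 2 (2 ℕ.^ j)) ⟩
  2ℚ * p * (1ℚ - c)                        ≤⟨ ≤-by (lemma p c) (0≤* 0≤2p (0≤* (ℚₚ.≮⇒≥ c≮0) (0≤- (cos≤1 x)))) ⟩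
  p * (2ℚ - 2ℚ * (c * c))                  ≡⟨ cong (λ y → p * (2ℚ - y)) (trans (sym (cos-product x x)) (+-congˡ (cos (x ℤ.+ x)) (cong cos (ℤₚ.+-inverseʳ x)))) ⟩
  p * (2ℚ - (cos (x ℤ.+ x) + 1ℚ))          ≡⟨ lemma′ p (cos (x ℤ.+ x)) ⟩
  p * (1ℚ - cos (x ℤ.+ x))                 ≤⟨ small ⟩
  1ℚ                                       ∎)
  where
  open ℚₚ.≤-Reasoning
  c = cos x
  p = ℕ→ℚ (2 ℕ.^ j)
  0≤2p : 0ℚ ≤ 2ℚ * p
  0≤2p = 0≤* (0≤ℕ→ℚ 2) (0≤ℕ→ℚ (2 ℕ.^ j))
  lemma : ∀ p c → p * (2ℚ - 2ℚ * (c * c)) - 2ℚ * p * (1ℚ - c) ≡ 2ℚ * p * (c * (1ℚ - c))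
  lemma = solve-∀ ℚ-ring
  lemma′ : ∀ p d → p * (2ℚ - (d + 1ℚ)) ≡ p * (1ℚ - d)
  lemma′ = solve-∀ ℚ-ring

n≤2^n : ∀ n → n ℕ.≤ 2 ℕ.^ n
n≤2^n zero    = ℕ.z≤n
n≤2^n (suc n) = ℕₚ.+-mono-≤ (ℕₚ.m^n>0 2 n) (ℕₚ.≤-trans (n≤2^n n) (ℕₚ.m≤m+n (2 ℕ.^ n) 0))

-- If no multiple worked, 2 ^ N (1 - cos x) would stay at most 1 for every N, although 1 - cos x is
-- positive.
negative-cos : ∀ {x} → x ≢ 0ℤ → ∃[ t ] cos (t ℤ.* x) < 0ℚ
negative-cos {x} x≢0 = go (archimedean (1ℚ - cos x) (0<1-cos x≢0) 2ℚ)
  where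
  2≰1 : ¬ 2ℚ ≤ 1ℚ
  2≰1 (ℚ.*≤* (ℤ.+≤+ (ℕ.s≤s ())))
  go : (∃[ N ] 2ℚ ≤ ℕ→ℚ N * (1ℚ - cos x)) → ∃[ t ] cos (t ℤ.* x) < 0ℚ
  go (N , 2≤) = case negative-cos-or-small N x of λ where
    (inj₁ found) → found
    (inj₂ small) → ⊥-elim (2≰1 (ℚₚ.≤-trans 2≤
      (ℚₚ.≤-trans (*-monoʳ (0≤- (cos≤1 x)) (ℕ→ℚ-mono-≤ (n≤2^n N))) small)))

-- Linear forms and sums of their indicators

val : ℕ → ℤ
val i = + suc i

dot : Vec ℤ k → Vec ℕ k → ℤ
dot []      []      = 0ℤ
dot (a ∷ as) (i ∷ v) = a ℤ.* val i ℤ.+ dot as v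

val-+ : ∀ h i → val (h ℕ.+ i) ≡ + h ℤ.+ val i
val-+ h i = cong +_ (sym (ℕₚ.+-suc h i))

val-injective : ∀ {i j} → val i ≡ val j → i ≡ j
val-injective refl = refl

infix 4 _≟0
_≟0 : (z : ℤ) → Dec (z ≡ 0ℤ)
z ≟0 = z ℤₚ.≟ 0ℤ

𝟙≢0 : ∀ {P : Set} (d : Dec P) → 𝟙 d ≢ 0ℚ → P
𝟙≢0 (yes p) _  = p
𝟙≢0 (no _)  ne = ⊥-elim (ne refl)

affine-cancel : ∀ {D x y} c → D ≢ 0ℤ → c ℤ.+ D ℤ.* x ≡ 0ℤ → c ℤ.+ D ℤ.* y ≡ 0ℤ → x ≡ y
affine-cancel {D} {x} {y} c D≢0 eq eq′ = ℤₚ.*-cancelˡ-≡ D x y {{ℤ.≢-nonZero D≢0}}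
  (trans (lemma c (D ℤ.* x)) (trans (cong (ℤ._- c) (trans eq (sym eq′))) (sym (lemma c (D ℤ.* y)))))
  where
  lemma : ∀ c z → z ≡ c ℤ.+ z ℤ.- c
  lemma = ℤ-Solver.solve-∀

∑<-linear : ∀ n c {D} → D ≢ 0ℤ → ∑< n (λ i → 𝟙 (c ℤ.+ D ℤ.* val i ≟0)) ≤ 1ℚ
∑<-linear n c {D} D≢0 = ∑<-unique n (λ i → 𝟙≤1 (z i ≟0)) (λ i → 0≤𝟙 (z i ≟0)) λ i j p q →
  val-injective (affine-cancel c D≢0 (𝟙≢0 (z i ≟0) p) (𝟙≢0 (z j ≟0) q))
  where
  z : ℕ → ℤ
  z i = c ℤ.+ D ℤ.* val i

∣∑<∣-bound : ∀ n {f : ℕ → ℚ} C → (∀ i → ∣ f i ∣ ≤ C) → ∣ ∑< n f ∣ ≤ ℕ→ℚ n * C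
∣∑<∣-bound n {f} C ∣f∣≤C = begin
  ∣ ∑< n f ∣                  ≤⟨ ∣∑∣≤∑∣∣ (upTo n) f ⟩
  ∑< n (λ i → ∣ f i ∣)        ≤⟨ ∑<-mono n ∣f∣≤C ⟩
  ∑< n (λ _ → C)              ≡⟨ ∑<-const n C ⟩
  ℕ→ℚ n * C                   ∎
  where open ℚₚ.≤-Reasoning

-- The windows [h, h + n) and [0, n) differ by at most h terms at either end.
∑<-shift : ∀ n h {f : ℕ → ℚ} → (∀ i → ∣ f i ∣ ≤ 1ℚ) →
  ∣ ∑< n (λ i → f (h ℕ.+ i)) - ∑< n f ∣ ≤ 2ℚ * ℕ→ℚ h
∑<-shift n h {f} ∣f∣≤1 = begin
  ∣ X - Y ∣                                       ≡⟨ cong ∣_∣ difference ⟩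
  ∣ ∑< h (λ i → f (n ℕ.+ i)) - ∑< h f ∣           ≤⟨ ℚₚ.∣p-q∣≤∣p∣+∣q∣ (∑< h (λ i → f (n ℕ.+ i))) (∑< h f) ⟩
  ∣ ∑< h (λ i → f (n ℕ.+ i)) ∣ + ∣ ∑< h f ∣       ≤⟨ ℚₚ.+-mono-≤ (∣∑<∣-bound h 1ℚ (λ i → ∣f∣≤1 (n ℕ.+ i))) (∣∑<∣-bound h 1ℚ ∣f∣≤1) ⟩
  ℕ→ℚ h * 1ℚ + ℕ→ℚ h * 1ℚ                         ≡⟨ lemma (ℕ→ℚ h) ⟩
  2ℚ * ℕ→ℚ h                                      ∎
  where
  open ℚₚ.≤-Reasoning
  X = ∑< n (λ i → f (h ℕ.+ i))
  Y = ∑< n f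
  Z = ∑< h (λ i → f (n ℕ.+ i))
  W = ∑< h f
  total : W + X ≡ Y + Z
  total = trans (sym (∑<-+ h n f)) (trans (cong (λ m → ∑< m f) (ℕₚ.+-comm h n)) (∑<-+ n h f))
  lemma₁ : ∀ w x y → x - y ≡ w + x - w - y
  lemma₁ = solve-∀ ℚ-ring
  lemma₂ : ∀ w y z → y + z - w - y ≡ z - w
  lemma₂ = solve-∀ ℚ-ring
  difference : X - Y ≡ Z - W
  difference = trans (lemma₁ W X Y) (trans (cong (λ s → s - W - Y) total) (lemma₂ W Y Z))
  lemma : ∀ h → h * 1ℚ + h * 1ℚ ≡ 2ℚ * h
  lemma = solve-∀ ℚ-ring

triangle : ∀ x y z → ∣ x - z ∣ ≤ ∣ x - y ∣ + ∣ y - z ∣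
triangle x y z = subst (λ w → ∣ w ∣ ≤ ∣ x - y ∣ + ∣ y - z ∣) (lemma x y z) (ℚₚ.∣p+q∣≤∣p∣+∣q∣ (x - y) (y - z))
  where
  lemma : ∀ x y z → x - y + (y - z) ≡ x - z
  lemma = solve-∀ ℚ-ring

∣p-q∣≡∣q-p∣ : ∀ p q → ∣ p - q ∣ ≡ ∣ q - p ∣
∣p-q∣≡∣q-p∣ p q = trans (sym (ℚₚ.∣-p∣≡∣p∣ (p - q))) (cong ∣_∣ (lemma p q))
  where
  lemma : ∀ p q → - (p - q) ≡ q - p
  lemma = solve-∀ ℚ-ring

∑∑ : ℕ → (ℕ → ℕ → ℚ) → ℚ
∑∑ n f = ∑< n λ i → ∑< n (f i)

∑∑-cong : ∀ n {f g : ℕ → ℕ → ℚ} → (∀ i j → f i j ≡ g i j) → ∑∑ n f ≡ ∑∑ n g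
∑∑-cong n f≡g = ∑<-cong n λ i → ∑<-cong n (f≡g i)

∑∑-+ : ∀ n f g → ∑∑ n (λ i j → f i j + g i j) ≡ ∑∑ n f + ∑∑ n g
∑∑-+ n f g = trans (∑<-cong n λ i → ∑-+ (upTo n) (f i) (g i))
  (∑-+ (upTo n) (λ i → ∑< n (f i)) (λ i → ∑< n (g i)))

∑∑-*ˡ : ∀ n c f → ∑∑ n (λ i j → c * f i j) ≡ c * ∑∑ n f
∑∑-*ˡ n c f = trans (∑<-cong n λ i → ∑-*ˡ (upTo n) c (f i)) (∑-*ˡ (upTo n) c λ i → ∑< n (f i))

divide : ∀ w → 0ℚ < w → ∃[ u ] 0ℚ ≤ u × (∀ {x y} → w * x ≤ y → x ≤ u * y)
divide w 0<w = u , ℚₚ.<⇒≤ 0<u , λ {x} {y} wx≤y →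
  subst (_≤ u * y) (trans (sym (ℚₚ.*-assoc u w x)) (trans (cong (_* x) (ℚₚ.*-inverseˡ w)) (ℚₚ.*-identityˡ x)))
    (*-monoˡ (ℚₚ.<⇒≤ 0<u) wx≤y)
  where
  instance
    w>0 : ℚ.Positive w
    w>0 = ℚ.positive 0<w
    w≢0 : ℚ.NonZero w
    w≢0 = ℚₚ.pos⇒nonZero w
  u = ℚ.1/ w
  0<u : 0ℚ < u
  0<u = ℚₚ.positive⁻¹ u {{ℚₚ.1/pos⇒pos w}}

-- Sums over pairs of variables

-- s and t receive the contributions of all other variables, so C has to be uniform in them. In the
-- kernels below the first form vanishes on at most n pairs, and a constant bound saves this factor
-- n.
PairBounded : (ℤ → ℤ → ℚ) → (a₀ a₁ b₀ b₁ : ℤ) → Set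
PairBounded φ a₀ a₁ b₀ b₁ = ∃[ C ] 0ℚ ≤ C × (∀ n s t →
  ∣ ∑∑ n (λ i j → φ (s ℤ.+ (a₀ ℤ.* val i ℤ.+ a₁ ℤ.* val j)) (t ℤ.+ (b₀ ℤ.* val i ℤ.+ b₁ ℤ.* val j))) ∣ ≤ C)

-- A step (h₀, h₁) with a₀ h₀ + a₁ h₁ = 0 keeps the equation and changes the phase by δ = b₀ h₀ + b₁
-- h₁. The sum over the square changes only at the boundary, so it is nearly invariant under adding
-- δ to γ.
module CosineSum (a₀ a₁ b₀ b₁ : ℤ) (a₀≢0 : a₀ ≢ 0ℤ) (a₁≢0 : a₁ ≢ 0ℤ) (n : ℕ) (s : ℤ) where

  A B : ℕ → ℕ → ℤ
  A i j = a₀ ℤ.* val i ℤ.+ a₁ ℤ.* val j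
  B i j = b₀ ℤ.* val i ℤ.+ b₁ ℤ.* val j

  E : ℤ → ℕ → ℕ → ℚ
  E γ i j = 𝟙 (s ℤ.+ A i j ≟0) * cos (γ ℤ.+ B i j)

  ∣E∣≤ : ∀ γ i j → ∣ E γ i j ∣ ≤ 𝟙 (s ℤ.+ A i j ≟0)
  ∣E∣≤ γ i j = begin
    ∣ d * cos (γ ℤ.+ B i j) ∣           ≡⟨ ℚₚ.∣p*q∣≡∣p∣*∣q∣ d (cos (γ ℤ.+ B i j)) ⟩
    ∣ d ∣ * ∣ cos (γ ℤ.+ B i j) ∣       ≤⟨ *-monoˡ (ℚₚ.0≤∣p∣ d) (∣cos∣≤1 (γ ℤ.+ B i j)) ⟩
    ∣ d ∣ * 1ℚ                          ≡⟨ ℚₚ.*-identityʳ ∣ d ∣ ⟩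
    ∣ d ∣                               ≡⟨ ℚₚ.0≤p⇒∣p∣≡p (0≤𝟙 (s ℤ.+ A i j ≟0)) ⟩
    d                                   ∎
    where
    open ℚₚ.≤-Reasoning
    d = 𝟙 (s ℤ.+ A i j ≟0)

  -- At most one j fits a given i because a₁ is non-zero, so a whole row is bounded by 1 and can be
  -- moved as a single term by `∑<-shift`. The offset h covers rows whose columns have already been
  -- moved.
  row-bound : ∀ γ h i → ∣ ∑< n (λ j → E γ i (h ℕ.+ j)) ∣ ≤ 1ℚ
  row-bound γ h i = begin
    ∣ ∑< n (λ j → E γ i (h ℕ.+ j)) ∣             ≤⟨ ∣∑∣≤∑∣∣ (upTo n) (λ j → E γ i (h ℕ.+ j)) ⟩
    ∑< n (λ j → ∣ E γ i (h ℕ.+ j) ∣)             ≤⟨ ∑<-mono n (λ j → ∣E∣≤ γ i (h ℕ.+ j)) ⟩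
    ∑< n (λ j → 𝟙 (s ℤ.+ A i (h ℕ.+ j) ≟0))      ≡⟨ ∑<-cong n (λ j → cong (λ z → 𝟙 (z ≟0))
                                                      (trans (cong (λ z → s ℤ.+ (a₀ ℤ.* val i ℤ.+ a₁ ℤ.* z)) (val-+ h j)) (lemma s (a₀ ℤ.* val i) a₁ (+ h) (val j)))) ⟩
    ∑< n (λ j → 𝟙 (s ℤ.+ a₀ ℤ.* val i ℤ.+ a₁ ℤ.* + h ℤ.+ a₁ ℤ.* val j ≟0))
                                                 ≤⟨ ∑<-linear n (s ℤ.+ a₀ ℤ.* val i ℤ.+ a₁ ℤ.* + h) a₁≢0 ⟩
    1ℚ                                           ∎
    where
    open ℚₚ.≤-Reasoning
    lemma : ∀ s x a h y → s ℤ.+ (x ℤ.+ a ℤ.* (h ℤ.+ y)) ≡ s ℤ.+ x ℤ.+ a ℤ.* h ℤ.+ a ℤ.* y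
    lemma = ℤ-Solver.solve-∀

  column-bound : ∀ γ j → ∣ ∑< n (λ i → E γ i j) ∣ ≤ 1ℚ
  column-bound γ j = begin
    ∣ ∑< n (λ i → E γ i j) ∣                                      ≤⟨ ∣∑∣≤∑∣∣ (upTo n) (λ i → E γ i j) ⟩
    ∑< n (λ i → ∣ E γ i j ∣)                                      ≤⟨ ∑<-mono n (λ i → ∣E∣≤ γ i j) ⟩
    ∑< n (λ i → 𝟙 (s ℤ.+ A i j ≟0))                               ≡⟨ ∑<-cong n (λ i → cong (λ z → 𝟙 (z ≟0)) (lemma s (a₀ ℤ.* val i) (a₁ ℤ.* val j))) ⟩
    ∑< n (λ i → 𝟙 (s ℤ.+ a₁ ℤ.* val j ℤ.+ a₀ ℤ.* val i ≟0))       ≤⟨ ∑<-linear n (s ℤ.+ a₁ ℤ.* val j) a₀≢0 ⟩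
    1ℚ                                                            ∎
    where
    open ℚₚ.≤-Reasoning
    lemma : ∀ s x y → s ℤ.+ (x ℤ.+ y) ≡ s ℤ.+ y ℤ.+ x
    lemma = ℤ-Solver.solve-∀

  S : ℤ → ℚ
  S γ = ∑∑ n (E γ)

  row-shift : ∀ γ h → ∣ ∑∑ n (λ i j → E γ (h ℕ.+ i) j) - S γ ∣ ≤ 2ℚ * ℕ→ℚ h
  row-shift γ h = ∑<-shift n h (row-bound γ 0)

  column-shift : ∀ γ h → ∣ ∑∑ n (λ i j → E γ i (h ℕ.+ j)) - S γ ∣ ≤ 2ℚ * ℕ→ℚ h
  column-shift γ h = subst₂ (λ x y → ∣ x - y ∣ ≤ 2ℚ * ℕ→ℚ h)
    (∑-swap (upTo n) (upTo n) (λ j i → E γ i (h ℕ.+ j))) (∑-swap (upTo n) (upTo n) (λ j i → E γ i j))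
    (∑<-shift n h (column-bound γ))

  E-cong : ∀ γ γ′ i j i′ j′ → A i j ≡ A i′ j′ → γ ℤ.+ B i j ≡ γ′ ℤ.+ B i′ j′ → E γ i j ≡ E γ′ i′ j′
  E-cong γ γ′ i j i′ j′ eq eq′ = cong₂ (λ x y → 𝟙 (s ℤ.+ x ≟0) * cos y) eq eq′

  Invariant : ℕ → ℕ → ℤ → Set
  Invariant h₀ h₁ δ = ∀ γ → ∣ S (γ ℤ.+ δ) - S γ ∣ ≤ 2ℚ * ℕ→ℚ h₀ + 2ℚ * ℕ→ℚ h₁

  invariant-opposite : ∀ h₀ h₁ → a₀ ℤ.* + h₀ ℤ.+ a₁ ℤ.* + h₁ ≡ 0ℤ → Invariant h₀ h₁ (b₀ ℤ.* + h₀ ℤ.+ b₁ ℤ.* + h₁)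
  invariant-opposite h₀ h₁ balanced γ = begin
    ∣ S (γ ℤ.+ δ) - S γ ∣
      ≡⟨ cong (λ x → ∣ x - S γ ∣) (∑∑-cong n λ i j → E-cong (γ ℤ.+ δ) γ i j (h₀ ℕ.+ i) (h₁ ℕ.+ j) (eqA i j) (eqB i j)) ⟩
    ∣ X - S γ ∣
      ≤⟨ triangle X Y (S γ) ⟩
    ∣ X - Y ∣ + ∣ Y - S γ ∣
      ≤⟨ ℚₚ.+-mono-≤ (∑<-shift n h₀ (row-bound γ h₁)) (column-shift γ h₁) ⟩
    2ℚ * ℕ→ℚ h₀ + 2ℚ * ℕ→ℚ h₁ ∎
    where
    open ℚₚ.≤-Reasoning
    δ = b₀ ℤ.* + h₀ ℤ.+ b₁ ℤ.* + h₁
    X = ∑∑ n (λ i j → E γ (h₀ ℕ.+ i) (h₁ ℕ.+ j))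
    Y = ∑∑ n (λ i j → E γ i (h₁ ℕ.+ j))
    lemma : ∀ a₀ a₁ h₀ h₁ x y → a₀ ℤ.* x ℤ.+ a₁ ℤ.* y ℤ.+ (a₀ ℤ.* h₀ ℤ.+ a₁ ℤ.* h₁) ≡ a₀ ℤ.* (h₀ ℤ.+ x) ℤ.+ a₁ ℤ.* (h₁ ℤ.+ y)
    lemma = ℤ-Solver.solve-∀
    lemma′ : ∀ b₀ b₁ h₀ h₁ x y γ → γ ℤ.+ (b₀ ℤ.* h₀ ℤ.+ b₁ ℤ.* h₁) ℤ.+ (b₀ ℤ.* x ℤ.+ b₁ ℤ.* y) ≡ γ ℤ.+ (b₀ ℤ.* (h₀ ℤ.+ x) ℤ.+ b₁ ℤ.* (h₁ ℤ.+ y))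
    lemma′ = ℤ-Solver.solve-∀
    eqA : ∀ i j → A i j ≡ A (h₀ ℕ.+ i) (h₁ ℕ.+ j)
    eqA i j = trans (sym (trans (cong (λ z → A i j ℤ.+ z) balanced) (ℤₚ.+-identityʳ (A i j))))
      (trans (lemma a₀ a₁ (+ h₀) (+ h₁) (val i) (val j)) (cong₂ (λ x y → a₀ ℤ.* x ℤ.+ a₁ ℤ.* y) (sym (val-+ h₀ i)) (sym (val-+ h₁ j))))
    eqB : ∀ i j → γ ℤ.+ δ ℤ.+ B i j ≡ γ ℤ.+ B (h₀ ℕ.+ i) (h₁ ℕ.+ j)
    eqB i j = trans (lemma′ b₀ b₁ (+ h₀) (+ h₁) (val i) (val j) γ)
      (cong₂ (λ x y → γ ℤ.+ (b₀ ℤ.* x ℤ.+ b₁ ℤ.* y)) (sym (val-+ h₀ i)) (sym (val-+ h₁ j)))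
  -- Now the step is (h₀, - h₁). Indices cannot be moved below 0, so `S` at γ + δ is shifted by h₁
  -- in j and `S` at γ by h₀ in i, and the two shifted sums coincide.
  invariant-same : ∀ h₀ h₁ → a₀ ℤ.* + h₀ ≡ a₁ ℤ.* + h₁ → Invariant h₀ h₁ (b₀ ℤ.* + h₀ ℤ.- b₁ ℤ.* + h₁)
  invariant-same h₀ h₁ balanced γ = begin
    ∣ S (γ ℤ.+ δ) - S γ ∣
      ≤⟨ triangle (S (γ ℤ.+ δ)) X (S γ) ⟩
    ∣ S (γ ℤ.+ δ) - X ∣ + ∣ X - S γ ∣
      ≤⟨ ℚₚ.+-mono-≤ (subst (_≤ 2ℚ * ℕ→ℚ h₁) first (column-shift (γ ℤ.+ δ) h₁)) (row-shift γ h₀) ⟩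
    2ℚ * ℕ→ℚ h₁ + 2ℚ * ℕ→ℚ h₀
      ≡⟨ ℚₚ.+-comm (2ℚ * ℕ→ℚ h₁) (2ℚ * ℕ→ℚ h₀) ⟩
    2ℚ * ℕ→ℚ h₀ + 2ℚ * ℕ→ℚ h₁ ∎
    where
    open ℚₚ.≤-Reasoning
    δ = b₀ ℤ.* + h₀ ℤ.- b₁ ℤ.* + h₁
    X = ∑∑ n (λ i j → E γ (h₀ ℕ.+ i) j)
    lemma : ∀ a₀ a₁ h₀ h₁ x y → a₀ ℤ.* x ℤ.+ a₁ ℤ.* (h₁ ℤ.+ y) ≡ a₀ ℤ.* x ℤ.+ a₁ ℤ.* h₁ ℤ.+ a₁ ℤ.* y
    lemma = ℤ-Solver.solve-∀
    lemma₂ : ∀ a₀ a₁ h₀ x y → a₀ ℤ.* x ℤ.+ a₀ ℤ.* h₀ ℤ.+ a₁ ℤ.* y ≡ a₀ ℤ.* (h₀ ℤ.+ x) ℤ.+ a₁ ℤ.* y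
    lemma₂ = ℤ-Solver.solve-∀
    lemma′ : ∀ b₀ b₁ h₀ h₁ x y γ → γ ℤ.+ (b₀ ℤ.* h₀ ℤ.- b₁ ℤ.* h₁) ℤ.+ (b₀ ℤ.* x ℤ.+ b₁ ℤ.* (h₁ ℤ.+ y)) ≡ γ ℤ.+ (b₀ ℤ.* (h₀ ℤ.+ x) ℤ.+ b₁ ℤ.* y)
    lemma′ = ℤ-Solver.solve-∀
    eqA : ∀ i j → A i (h₁ ℕ.+ j) ≡ A (h₀ ℕ.+ i) j
    eqA i j = trans (cong (λ y → a₀ ℤ.* val i ℤ.+ a₁ ℤ.* y) (val-+ h₁ j))
      (trans (lemma a₀ a₁ (+ h₀) (+ h₁) (val i) (val j))
      (trans (cong (λ z → a₀ ℤ.* val i ℤ.+ z ℤ.+ a₁ ℤ.* val j) (sym balanced))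
      (trans (lemma₂ a₀ a₁ (+ h₀) (val i) (val j)) (cong (λ x → a₀ ℤ.* x ℤ.+ a₁ ℤ.* val j) (sym (val-+ h₀ i))))))
    eqB : ∀ i j → γ ℤ.+ δ ℤ.+ B i (h₁ ℕ.+ j) ≡ γ ℤ.+ B (h₀ ℕ.+ i) j
    eqB i j = trans (cong (λ y → γ ℤ.+ δ ℤ.+ (b₀ ℤ.* val i ℤ.+ b₁ ℤ.* y)) (val-+ h₁ j))
      (trans (lemma′ b₀ b₁ (+ h₀) (+ h₁) (val i) (val j) γ) (cong (λ x → γ ℤ.+ (b₀ ℤ.* x ℤ.+ b₁ ℤ.* val j)) (sym (val-+ h₀ i))))
    first : ∣ ∑∑ n (λ i j → E (γ ℤ.+ δ) i (h₁ ℕ.+ j)) - S (γ ℤ.+ δ) ∣ ≡ ∣ S (γ ℤ.+ δ) - X ∣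
    first = trans (∣p-q∣≡∣q-p∣ (∑∑ n (λ i j → E (γ ℤ.+ δ) i (h₁ ℕ.+ j))) (S (γ ℤ.+ δ)))
      (cong (λ x → ∣ S (γ ℤ.+ δ) - x ∣) (∑∑-cong n λ i j → E-cong (γ ℤ.+ δ) γ i (h₁ ℕ.+ j) (h₀ ℕ.+ i) j (eqA i j) (eqB i j)))

  -- S (γ + δ) + S (γ - δ) = 2 cos δ · S γ exactly, while S is nearly δ-periodic.
  eigen-bound : ∀ h₀ h₁ δ → Invariant h₀ h₁ δ → ∀ γ → (1ℚ - cos δ) * ∣ S γ ∣ ≤ 2ℚ * ℕ→ℚ h₀ + 2ℚ * ℕ→ℚ h₁
  eigen-bound h₀ h₁ δ inv γ = ℚₚ.*-cancelˡ-≤-pos 2ℚ (begin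
    2ℚ * ((1ℚ - cos δ) * ∣ S γ ∣)
      ≡⟨ cong (λ x → 2ℚ * (x * ∣ S γ ∣)) (ℚₚ.0≤p⇒∣p∣≡p (0≤- (cos≤1 δ))) ⟨
    2ℚ * (∣ 1ℚ - cos δ ∣ * ∣ S γ ∣)
      ≡⟨ cong (2ℚ *_) (ℚₚ.∣p*q∣≡∣p∣*∣q∣ (1ℚ - cos δ) (S γ)) ⟨
    2ℚ * ∣ (1ℚ - cos δ) * S γ ∣
      ≡⟨ ℚₚ.∣p*q∣≡∣p∣*∣q∣ 2ℚ ((1ℚ - cos δ) * S γ) ⟨
    ∣ 2ℚ * ((1ℚ - cos δ) * S γ) ∣
      ≡⟨ cong ∣_∣ (trans (lemma (cos δ) (S γ)) (trans (cong (λ x → (S γ + S γ) - x) (sym eigen)) (lemma₂ (S γ) (S (γ ℤ.+ δ)) (S (γ ℤ.- δ))))) ⟩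
    ∣ (S γ - S (γ ℤ.- δ)) - (S (γ ℤ.+ δ) - S γ) ∣
      ≤⟨ ℚₚ.∣p-q∣≤∣p∣+∣q∣ (S γ - S (γ ℤ.- δ)) (S (γ ℤ.+ δ) - S γ) ⟩
    ∣ S γ - S (γ ℤ.- δ) ∣ + ∣ S (γ ℤ.+ δ) - S γ ∣
      ≤⟨ ℚₚ.+-mono-≤ (subst (λ z → ∣ S z - S (γ ℤ.- δ) ∣ ≤ K) (cancel γ δ) (inv (γ ℤ.- δ))) (inv γ) ⟩
    K + K
      ≡⟨ lemma₃ K ⟩
    2ℚ * K ∎)
    where
    open ℚₚ.≤-Reasoning
    K = 2ℚ * ℕ→ℚ h₀ + 2ℚ * ℕ→ℚ h₁
    cancel : ∀ γ δ → γ ℤ.- δ ℤ.+ δ ≡ γ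
    cancel = ℤ-Solver.solve-∀
    lemma : ∀ c x → 2ℚ * ((1ℚ - c) * x) ≡ (x + x) - 2ℚ * c * x
    lemma = solve-∀ ℚ-ring
    lemma₂ : ∀ x y z → (x + x) - (y + z) ≡ (x - z) - (y - x)
    lemma₂ = solve-∀ ℚ-ring
    lemma₃ : ∀ k → k + k ≡ 2ℚ * k
    lemma₃ = solve-∀ ℚ-ring
    swap⁺ : ∀ γ δ b → γ ℤ.+ δ ℤ.+ b ≡ γ ℤ.+ b ℤ.+ δ
    swap⁺ = ℤ-Solver.solve-∀
    swap⁻ : ∀ γ δ b → γ ℤ.- δ ℤ.+ b ≡ γ ℤ.+ b ℤ.- δ
    swap⁻ = ℤ-Solver.solve-∀
    lemma₄ : ∀ d x y → d * x + d * y ≡ d * (x + y)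
    lemma₄ = solve-∀ ℚ-ring
    lemma₅ : ∀ d c e → d * (2ℚ * (c * e)) ≡ 2ℚ * e * (d * c)
    lemma₅ = solve-∀ ℚ-ring
    pointwise : ∀ i j → E (γ ℤ.+ δ) i j + E (γ ℤ.- δ) i j ≡ 2ℚ * cos δ * E γ i j
    pointwise i j = begin-equality
      d * cos (γ ℤ.+ δ ℤ.+ B i j) + d * cos (γ ℤ.- δ ℤ.+ B i j)
        ≡⟨ lemma₄ d (cos (γ ℤ.+ δ ℤ.+ B i j)) (cos (γ ℤ.- δ ℤ.+ B i j)) ⟩
      d * (cos (γ ℤ.+ δ ℤ.+ B i j) + cos (γ ℤ.- δ ℤ.+ B i j))
        ≡⟨ cong₂ (λ x y → d * (cos x + cos y)) (swap⁺ γ δ (B i j)) (swap⁻ γ δ (B i j)) ⟩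
      d * (cos (γ ℤ.+ B i j ℤ.+ δ) + cos (γ ℤ.+ B i j ℤ.- δ))
        ≡⟨ cong (d *_) (cos-product (γ ℤ.+ B i j) δ) ⟩
      d * (2ℚ * (cos (γ ℤ.+ B i j) * cos δ))
        ≡⟨ lemma₅ d (cos (γ ℤ.+ B i j)) (cos δ) ⟩
      2ℚ * cos δ * (d * cos (γ ℤ.+ B i j)) ∎
      where d = 𝟙 (s ℤ.+ A i j ≟0)
    eigen : S (γ ℤ.+ δ) + S (γ ℤ.- δ) ≡ 2ℚ * cos δ * S γ
    eigen = trans (sym (∑∑-+ n (E (γ ℤ.+ δ)) (E (γ ℤ.- δ)))) (trans (∑∑-cong n pointwise) (∑∑-*ˡ n (2ℚ * cos δ) (E γ)))

cosKernel : ℤ → ℤ → ℚ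
cosKernel x y = 𝟙 (x ≟0) * cos y

-- The step is made of |a₁| and |a₀|, so δ becomes plus or minus the determinant a₁ b₀ - a₀ b₁. This
-- is non-zero, hence 1 - cos δ is positive and can be divided out.
cosKernel-bounded : ∀ a₀ a₁ b₀ b₁ → a₀ ≢ 0ℤ → a₁ ≢ 0ℤ → a₀ ℤ.* b₁ ≢ a₁ ℤ.* b₀ → PairBounded cosKernel a₀ a₁ b₀ b₁
cosKernel-bounded a₀ a₁ b₀ b₁ a₀≢0 a₁≢0 ∦ = go a₀ a₁ refl refl
  where
  open CosineSum a₀ a₁ b₀ b₁ a₀≢0 a₁≢0
  bound : ∀ h₀ h₁ δ → δ ≢ 0ℤ → (∀ n s → Invariant n s h₀ h₁ δ) → PairBounded cosKernel a₀ a₁ b₀ b₁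
  bound h₀ h₁ δ δ≢0 inv =
    let u , 0≤u , u≤ = divide (1ℚ - cos δ) (0<1-cos δ≢0) in
    u * K , 0≤* 0≤u (0≤+ (0≤* (0≤ℕ→ℚ 2) (0≤ℕ→ℚ h₀)) (0≤* (0≤ℕ→ℚ 2) (0≤ℕ→ℚ h₁))) ,
    λ n s t → u≤ (eigen-bound n s h₀ h₁ δ (inv n s) t)
    where K = 2ℚ * ℕ→ℚ h₀ + 2ℚ * ℕ→ℚ h₁
  ∦⇒≢0 : ∀ {δ} → a₀ ℤ.* b₁ ≡ a₁ ℤ.* b₀ ℤ.- δ → δ ≢ 0ℤ
  ∦⇒≢0 eq refl = ∦ (trans eq (ℤₚ.+-identityʳ _))
  ∦⇒≢0′ : ∀ {δ} → a₀ ℤ.* b₁ ≡ a₁ ℤ.* b₀ ℤ.+ δ → δ ≢ 0ℤ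
  ∦⇒≢0′ eq refl = ∦ (trans eq (ℤₚ.+-identityʳ _))
  go : ∀ x y → a₀ ≡ x → a₁ ≡ y → PairBounded cosKernel a₀ a₁ b₀ b₁
  go (+ p) (+ q) refl refl = bound q p _ (∦⇒≢0 (lemma (+ p) (+ q) b₀ b₁)) λ n s → invariant-same n s q p (ℤₚ.*-comm (+ p) (+ q))
    where
    lemma : ∀ p q b₀ b₁ → p ℤ.* b₁ ≡ q ℤ.* b₀ ℤ.- (b₀ ℤ.* q ℤ.- b₁ ℤ.* p)
    lemma = ℤ-Solver.solve-∀
  go -[1+ p ] -[1+ q ] refl refl = bound (suc q) (suc p) _ (∦⇒≢0′ (lemma (+ suc p) (+ suc q) b₀ b₁))
    λ n s → invariant-same n s (suc q) (suc p) (lemma′ (+ suc p) (+ suc q))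
    where
    lemma : ∀ p q b₀ b₁ → ℤ.- p ℤ.* b₁ ≡ ℤ.- q ℤ.* b₀ ℤ.+ (b₀ ℤ.* q ℤ.- b₁ ℤ.* p)
    lemma = ℤ-Solver.solve-∀
    lemma′ : ∀ p q → ℤ.- p ℤ.* q ≡ ℤ.- q ℤ.* p
    lemma′ = ℤ-Solver.solve-∀
  go (+ p) -[1+ q ] refl refl = bound (suc q) p _ (∦⇒≢0′ (lemma (+ p) (+ suc q) b₀ b₁))
    λ n s → invariant-opposite n s (suc q) p (lemma′ (+ p) (+ suc q))
    where
    lemma : ∀ p q b₀ b₁ → p ℤ.* b₁ ≡ ℤ.- q ℤ.* b₀ ℤ.+ (b₀ ℤ.* q ℤ.+ b₁ ℤ.* p)
    lemma = ℤ-Solver.solve-∀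
    lemma′ : ∀ p q → p ℤ.* q ℤ.+ ℤ.- q ℤ.* p ≡ 0ℤ
    lemma′ = ℤ-Solver.solve-∀
  go -[1+ p ] (+ q) refl refl = bound q (suc p) _ (∦⇒≢0 (lemma (+ suc p) (+ q) b₀ b₁))
    λ n s → invariant-opposite n s q (suc p) (lemma′ (+ suc p) (+ q))
    where
    lemma : ∀ p q b₀ b₁ → ℤ.- p ℤ.* b₁ ≡ q ℤ.* b₀ ℤ.- (b₀ ℤ.* q ℤ.+ b₁ ℤ.* p)
    lemma = ℤ-Solver.solve-∀
    lemma′ : ∀ p q → ℤ.- p ℤ.* q ℤ.+ q ℤ.* p ≡ 0ℤ
    lemma′ = ℤ-Solver.solve-∀

zeroKernel : ℤ → ℤ → ℚ
zeroKernel x y = 𝟙 (x ≟0) * 𝟙 (y ≟0)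

-- Cramer's rule: eliminating j leaves a linear equation in i with the determinant `D` as
-- coefficient, so there is at most one i, and then at most one j.
zeroKernel-bounded : ∀ a₀ a₁ b₀ b₁ → a₀ ≢ 0ℤ → a₁ ≢ 0ℤ → a₀ ℤ.* b₁ ≢ a₁ ℤ.* b₀ → PairBounded zeroKernel a₀ a₁ b₀ b₁
zeroKernel-bounded a₀ a₁ b₀ b₁ a₀≢0 a₁≢0 ∦ = 1ℚ , 0≤1 , λ n s t →
  subst (_≤ 1ℚ) (sym (ℚₚ.0≤p⇒∣p∣≡p (0≤∑ (upTo n) λ i → 0≤∑ (upTo n) λ j → 0≤*
    (0≤𝟙 (s ℤ.+ (a₀ ℤ.* val i ℤ.+ a₁ ℤ.* val j) ≟0)) (0≤𝟙 (t ℤ.+ (b₀ ℤ.* val i ℤ.+ b₁ ℤ.* val j) ≟0))))) (bound n s t)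
  where
  D = a₁ ℤ.* b₀ ℤ.- b₁ ℤ.* a₀
  D≢0 : D ≢ 0ℤ
  D≢0 eq = ∦ (trans (ℤₚ.*-comm a₀ b₁) (sym (ℤₚ.i-j≡0⇒i≡j (a₁ ℤ.* b₀) (b₁ ℤ.* a₀) eq)))
  bound : ∀ n s t → ∑∑ n (λ i j → zeroKernel (s ℤ.+ (a₀ ℤ.* val i ℤ.+ a₁ ℤ.* val j)) (t ℤ.+ (b₀ ℤ.* val i ℤ.+ b₁ ℤ.* val j))) ≤ 1ℚ
  bound n s t = begin
    ∑∑ n (λ i j → 𝟙 (X i j ≟0) * 𝟙 (Y i j ≟0))
      ≤⟨ ∑<-mono n (λ i → ∑<-mono n λ j → pointwise i j) ⟩
    ∑∑ n (λ i j → 𝟙 (w ℤ.+ D ℤ.* val i ≟0) * 𝟙 (s ℤ.+ a₀ ℤ.* val i ℤ.+ a₁ ℤ.* val j ≟0))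
      ≡⟨ ∑<-cong n (λ i → ∑-*ˡ (upTo n) (𝟙 (w ℤ.+ D ℤ.* val i ≟0)) λ j → 𝟙 (s ℤ.+ a₀ ℤ.* val i ℤ.+ a₁ ℤ.* val j ≟0)) ⟩
    ∑< n (λ i → 𝟙 (w ℤ.+ D ℤ.* val i ≟0) * ∑< n λ j → 𝟙 (s ℤ.+ a₀ ℤ.* val i ℤ.+ a₁ ℤ.* val j ≟0))
      ≤⟨ ∑<-mono n (λ i → *-monoˡ (0≤𝟙 (w ℤ.+ D ℤ.* val i ≟0)) (∑<-linear n (s ℤ.+ a₀ ℤ.* val i) a₁≢0)) ⟩
    ∑< n (λ i → 𝟙 (w ℤ.+ D ℤ.* val i ≟0) * 1ℚ)
      ≡⟨ ∑<-cong n (λ i → ℚₚ.*-identityʳ (𝟙 (w ℤ.+ D ℤ.* val i ≟0))) ⟩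
    ∑< n (λ i → 𝟙 (w ℤ.+ D ℤ.* val i ≟0))
      ≤⟨ ∑<-linear n w D≢0 ⟩
    1ℚ ∎
    where
    open ℚₚ.≤-Reasoning
    X Y : ℕ → ℕ → ℤ
    X i j = s ℤ.+ (a₀ ℤ.* val i ℤ.+ a₁ ℤ.* val j)
    Y i j = t ℤ.+ (b₀ ℤ.* val i ℤ.+ b₁ ℤ.* val j)
    w = a₁ ℤ.* t ℤ.- b₁ ℤ.* s
    lemma : ∀ a₀ a₁ b₀ b₁ s t x y → a₁ ℤ.* t ℤ.- b₁ ℤ.* s ℤ.+ (a₁ ℤ.* b₀ ℤ.- b₁ ℤ.* a₀) ℤ.* x ≡
      a₁ ℤ.* (t ℤ.+ (b₀ ℤ.* x ℤ.+ b₁ ℤ.* y)) ℤ.- b₁ ℤ.* (s ℤ.+ (a₀ ℤ.* x ℤ.+ a₁ ℤ.* y))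
    lemma = ℤ-Solver.solve-∀
    eliminate : ∀ i j → X i j ≡ 0ℤ → Y i j ≡ 0ℤ → w ℤ.+ D ℤ.* val i ≡ 0ℤ
    eliminate i j X≡0 Y≡0 = trans (lemma a₀ a₁ b₀ b₁ s t (val i) (val j))
      (trans (cong₂ (λ x y → a₁ ℤ.* y ℤ.- b₁ ℤ.* x) X≡0 Y≡0) (zeros a₁ b₁))
      where
      zeros : ∀ a b → a ℤ.* 0ℤ ℤ.- b ℤ.* 0ℤ ≡ 0ℤ
      zeros = ℤ-Solver.solve-∀
    product : ∀ {P Q P′ Q′ : Set} (p : Dec P) (q : Dec Q) (p′ : Dec P′) (q′ : Dec Q′) →
      (P → Q → P′) → (P → Q′) → 𝟙 p * 𝟙 q ≤ 𝟙 p′ * 𝟙 q′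
    product (yes p) (yes q) p′ q′ f g = ℚₚ.≤-reflexive (sym (cong₂ _*_ (𝟙-yes p′ (f p q)) (𝟙-yes q′ (g p))))
    product (yes _) (no _)  p′ q′ f g = 0≤* (0≤𝟙 p′) (0≤𝟙 q′)
    product (no _)  q       p′ q′ f g = subst (_≤ 𝟙 p′ * 𝟙 q′) (sym (ℚₚ.*-zeroˡ (𝟙 q))) (0≤* (0≤𝟙 p′) (0≤𝟙 q′))
    pointwise : ∀ i j → 𝟙 (X i j ≟0) * 𝟙 (Y i j ≟0) ≤ 𝟙 (w ℤ.+ D ℤ.* val i ≟0) * 𝟙 (s ℤ.+ a₀ ℤ.* val i ℤ.+ a₁ ℤ.* val j ≟0)
    pointwise i j = product (X i j ≟0) (Y i j ≟0) (w ℤ.+ D ℤ.* val i ≟0) (s ℤ.+ a₀ ℤ.* val i ℤ.+ a₁ ℤ.* val j ≟0)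
      (eliminate i j) (trans (ℤₚ.+-assoc s (a₀ ℤ.* val i) (a₁ ℤ.* val j)))

-- Adjacent coordinates suffice: across non-zero entries of a, proportionality is transitive.
data Skew : ∀ {k} → Vec ℤ (2 ℕ.+ k) → Vec ℤ (2 ℕ.+ k) → Set where
  here  : ∀ {k a₀ a₁ b₀ b₁} {as bs : Vec ℤ k} → a₀ ≢ 0ℤ → a₁ ≢ 0ℤ → a₀ ℤ.* b₁ ≢ a₁ ℤ.* b₀ →
          Skew (a₀ ∷ a₁ ∷ as) (b₀ ∷ b₁ ∷ bs)
  there : ∀ {k a₀ b₀} {as bs : Vec ℤ (2 ℕ.+ k)} → Skew as bs → Skew (a₀ ∷ as) (b₀ ∷ bs)

-- All variables but the two of the skew pair are frozen and absorbed into s and t; each of their n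
-- ^ k values costs at most C.
skew-bound : (φ : ℤ → ℤ → ℚ) →
  (∀ a₀ a₁ b₀ b₁ → a₀ ≢ 0ℤ → a₁ ≢ 0ℤ → a₀ ℤ.* b₁ ≢ a₁ ℤ.* b₀ → PairBounded φ a₀ a₁ b₀ b₁) →
  ∀ {k} {a b : Vec ℤ (2 ℕ.+ k)} → Skew a b →
  ∃[ C ] 0ℚ ≤ C × (∀ n s t → ∣ ∑ᵛ (upTo n) (2 ℕ.+ k) (λ v → φ (s ℤ.+ dot a v) (t ℤ.+ dot b v)) ∣ ≤ C * ℕ→ℚ (n ℕ.^ k))
skew-bound φ bounded {k} (here {a₀ = a₀} {a₁} {b₀} {b₁} {as} {bs} a₀≢0 a₁≢0 ∦) = C , 0≤C , bound
  where
  C = proj₁ (bounded a₀ a₁ b₀ b₁ a₀≢0 a₁≢0 ∦)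
  0≤C = proj₁ (proj₂ (bounded a₀ a₁ b₀ b₁ a₀≢0 a₁≢0 ∦))
  lemma : ∀ s x y z → s ℤ.+ (x ℤ.+ (y ℤ.+ z)) ≡ s ℤ.+ z ℤ.+ (x ℤ.+ y)
  lemma = ℤ-Solver.solve-∀
  bound : ∀ n s t → ∣ ∑ᵛ (upTo n) (2 ℕ.+ k) (λ v → φ (s ℤ.+ dot (a₀ ∷ a₁ ∷ as) v) (t ℤ.+ dot (b₀ ∷ b₁ ∷ bs) v)) ∣ ≤ C * ℕ→ℚ (n ℕ.^ k)
  bound n s t = begin
    ∣ ∑ᵛ (upTo n) (2 ℕ.+ k) F ∣
      ≡⟨ cong ∣_∣ (trans (∑ᵛ-suc (upTo n) (suc k) F) (∑<-cong n λ i → ∑ᵛ-suc (upTo n) k (λ v → F (i ∷ v)))) ⟩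
    ∣ ∑< n (λ i → ∑< n λ j → ∑ᵛ (upTo n) k λ v → F (i ∷ j ∷ v)) ∣
      ≡⟨ cong ∣_∣ (trans (∑<-cong n λ i → ∑-swap (upTo n) (vecs (upTo n) k) (λ j v → F (i ∷ j ∷ v)))
           (∑-swap (upTo n) (vecs (upTo n) k) (λ i v → ∑< n λ j → F (i ∷ j ∷ v)))) ⟩
    ∣ ∑ᵛ (upTo n) k (λ v → ∑∑ n λ i j → F (i ∷ j ∷ v)) ∣
      ≤⟨ ∣∑∣≤∑∣∣ (vecs (upTo n) k) (λ v → ∑∑ n λ i j → F (i ∷ j ∷ v)) ⟩
    ∑ᵛ (upTo n) k (λ v → ∣ ∑∑ n (λ i j → F (i ∷ j ∷ v)) ∣)
      ≤⟨ ∑-mono (vecs (upTo n) k) inner ⟩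
    ∑ᵛ (upTo n) k (λ _ → C)
      ≡⟨ ∑-const (vecs (upTo n) k) C ⟩
    ℕ→ℚ (length (vecs (upTo n) k)) * C
      ≡⟨ trans (ℚₚ.*-comm (ℕ→ℚ (length (vecs (upTo n) k))) C)
           (cong (λ l → C * ℕ→ℚ l) (trans (length-vecs (upTo n) k) (cong (ℕ._^ k) (Listₚ.length-upTo n)))) ⟩
    C * ℕ→ℚ (n ℕ.^ k) ∎
    where
    open ℚₚ.≤-Reasoning
    F : Vec ℕ (2 ℕ.+ k) → ℚ
    F v = φ (s ℤ.+ dot (a₀ ∷ a₁ ∷ as) v) (t ℤ.+ dot (b₀ ∷ b₁ ∷ bs) v)
    inner : ∀ v → ∣ ∑∑ n (λ i j → F (i ∷ j ∷ v)) ∣ ≤ C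
    inner v = subst (λ x → ∣ x ∣ ≤ C)
      (∑∑-cong n λ i j → cong₂ φ (sym (lemma s (a₀ ℤ.* val i) (a₁ ℤ.* val j) (dot as v))) (sym (lemma t (b₀ ℤ.* val i) (b₁ ℤ.* val j) (dot bs v))))
      (proj₂ (proj₂ (bounded a₀ a₁ b₀ b₁ a₀≢0 a₁≢0 ∦)) n (s ℤ.+ dot as v) (t ℤ.+ dot bs v))
skew-bound φ bounded {suc k} (there {a₀ = a₀} {b₀} {as} {bs} skew) = C , 0≤C , bound
  where
  C = proj₁ (skew-bound φ bounded skew)
  0≤C = proj₁ (proj₂ (skew-bound φ bounded skew))
  lemma : ∀ c n p → n * (c * p) ≡ c * (n * p)
  lemma = solve-∀ ℚ-ring
  bound : ∀ n s t → ∣ ∑ᵛ (upTo n) (3 ℕ.+ k) (λ v → φ (s ℤ.+ dot (a₀ ∷ as) v) (t ℤ.+ dot (b₀ ∷ bs) v)) ∣ ≤ C * ℕ→ℚ (n ℕ.^ suc k)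
  bound n s t = begin
    ∣ ∑ᵛ (upTo n) (3 ℕ.+ k) F ∣
      ≡⟨ cong ∣_∣ (∑ᵛ-suc (upTo n) (2 ℕ.+ k) F) ⟩
    ∣ ∑< n (λ i → ∑ᵛ (upTo n) (2 ℕ.+ k) λ v → F (i ∷ v)) ∣
      ≤⟨ ∣∑<∣-bound n (C * ℕ→ℚ (n ℕ.^ k)) inner ⟩
    ℕ→ℚ n * (C * ℕ→ℚ (n ℕ.^ k))
      ≡⟨ trans (lemma C (ℕ→ℚ n) (ℕ→ℚ (n ℕ.^ k))) (cong (C *_) (sym (ℕ→ℚ-* n (n ℕ.^ k)))) ⟩
    C * ℕ→ℚ (n ℕ.^ suc k) ∎
    where
    open ℚₚ.≤-Reasoning
    F : Vec ℕ (3 ℕ.+ k) → ℚ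
    F v = φ (s ℤ.+ dot (a₀ ∷ as) v) (t ℤ.+ dot (b₀ ∷ bs) v)
    inner : ∀ i → ∣ ∑ᵛ (upTo n) (2 ℕ.+ k) (λ v → F (i ∷ v)) ∣ ≤ C * ℕ→ℚ (n ℕ.^ k)
    inner i = subst (λ x → ∣ x ∣ ≤ C * ℕ→ℚ (n ℕ.^ k))
      (∑-cong (vecs (upTo n) (2 ℕ.+ k)) λ v → cong₂ φ (ℤₚ.+-assoc s (a₀ ℤ.* val i) (dot as v)) (ℤₚ.+-assoc t (b₀ ℤ.* val i) (dot bs v)))
      (proj₂ (proj₂ (skew-bound φ bounded skew)) n (s ℤ.+ a₀ ℤ.* val i) (t ℤ.+ b₀ ℤ.* val i))

-- Sums over solutions, and proportional vectors

evaluate≡dot : ∀ (a : Vec ℤ k) (x : Vec (Fin n) k) → evaluate a x ≡ dot a (Vec.map toℕ x)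
evaluate≡dot []      []      = refl
evaluate≡dot (a ∷ as) (i ∷ x) = cong (λ z → a ℤ.* value i ℤ.+ z) (evaluate≡dot as x)

∑-solutions : ∀ (a : Vec ℤ k) n (f : Vec (Fin n) k → ℚ) (g : Vec ℕ k → ℚ) →
  (∀ x → f x ≡ g (Vec.map toℕ x)) →
  ∑ (solutions a n) f ≡ ∑ᵛ (upTo n) k λ v → 𝟙 (dot a v ≟0) * g v
∑-solutions {k} a n f g f≡g = trans (∑-filter (isSolution? a) (tuples n k) f)
  (∑-tuples n k _ (λ v → 𝟙 (dot a v ≟0) * g v)
    λ x → cong₂ (λ z y → 𝟙 (z ≟0) * y) (evaluate≡dot a x) (f≡g x))

solutionCount≡∑ : ∀ (a : Vec ℤ k) n → solutionCount a n ≡ ∑ᵛ (upTo n) k λ v → 𝟙 (dot a v ≟0)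
solutionCount≡∑ {k} a n = trans (length≡∑ (solutions a n))
  (trans (∑-solutions a n (λ _ → 1ℚ) (λ _ → 1ℚ) λ _ → refl)
    (∑-cong (vecs (upTo n) k) λ v → ℚₚ.*-identityʳ (𝟙 (dot a v ≟0))))

Proportional : Vec ℤ k → Vec ℤ k → Set
Proportional a b = ∀ i j → lookup a i ℤ.* lookup b j ≡ lookup a j ℤ.* lookup b i

-- Proportionality is passed on through the first entry of `as`, which can be cancelled because it
-- is non-zero.
proportional-∷ : ∀ a₀ b₀ (as bs : Vec ℤ (suc k)) → lookup as Fin.zero ≢ 0ℤ →
  a₀ ℤ.* lookup bs Fin.zero ≡ lookup as Fin.zero ℤ.* b₀ → Proportional as bs → Proportional (a₀ ∷ as) (b₀ ∷ bs)
proportional-∷ a₀ b₀ as bs a₁≢0 ∥ prop = prop′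
  where
  a₁ = lookup as Fin.zero
  b₁ = lookup bs Fin.zero
  lemma : ∀ x y z → x ℤ.* (y ℤ.* z) ≡ y ℤ.* (x ℤ.* z)
  lemma = ℤ-Solver.solve-∀
  cons : ∀ j → a₀ ℤ.* lookup bs j ≡ lookup as j ℤ.* b₀
  cons j = ℤₚ.*-cancelˡ-≡ a₁ _ _ {{ℤ.≢-nonZero a₁≢0}} (begin
    a₁ ℤ.* (a₀ ℤ.* bⱼ)     ≡⟨ lemma a₁ a₀ bⱼ ⟩
    a₀ ℤ.* (a₁ ℤ.* bⱼ)     ≡⟨ cong (a₀ ℤ.*_) (prop Fin.zero j) ⟩
    a₀ ℤ.* (aⱼ ℤ.* b₁)     ≡⟨ lemma a₀ aⱼ b₁ ⟩
    aⱼ ℤ.* (a₀ ℤ.* b₁)     ≡⟨ cong (aⱼ ℤ.*_) ∥ ⟩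
    aⱼ ℤ.* (a₁ ℤ.* b₀)     ≡⟨ lemma aⱼ a₁ b₀ ⟩
    a₁ ℤ.* (aⱼ ℤ.* b₀)     ∎)
    where
    open ≡-Reasoning
    aⱼ = lookup as j
    bⱼ = lookup bs j
  prop′ : Proportional (a₀ ∷ as) (b₀ ∷ bs)
  prop′ Fin.zero    Fin.zero    = refl
  prop′ Fin.zero    (Fin.suc j) = cons j
  prop′ (Fin.suc i) Fin.zero    = sym (cons i)
  prop′ (Fin.suc i) (Fin.suc j) = prop i j

skew-or-proportional : ∀ {k} (a b : Vec ℤ (2 ℕ.+ k)) → NonzeroCoefficients a → Skew a b ⊎ Proportional a b
skew-or-proportional {k} (a₀ ∷ a₁ ∷ as) (b₀ ∷ b₁ ∷ bs) a≢0 with a₀ ℤ.* b₁ ℤₚ.≟ a₁ ℤ.* b₀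
... | no  ∦ = inj₁ (here (a≢0 Fin.zero) (a≢0 (Fin.suc Fin.zero)) ∦)
... | yes ∥ = tail k as bs a≢0
  where
  extend : ∀ {k} {as bs : Vec ℤ k} → Proportional (a₁ ∷ as) (b₁ ∷ bs) → Proportional (a₀ ∷ a₁ ∷ as) (b₀ ∷ b₁ ∷ bs)
  extend = proportional-∷ a₀ b₀ (a₁ ∷ _) (b₁ ∷ _) (a≢0 (Fin.suc Fin.zero)) ∥
  singleton : Proportional (a₁ ∷ []) (b₁ ∷ [])
  singleton Fin.zero Fin.zero = refl
  singleton Fin.zero (Fin.suc ())
  singleton (Fin.suc ())
  tail : ∀ k (as bs : Vec ℤ k) → NonzeroCoefficients (a₀ ∷ a₁ ∷ as) →
    Skew (a₀ ∷ a₁ ∷ as) (b₀ ∷ b₁ ∷ bs) ⊎ Proportional (a₀ ∷ a₁ ∷ as) (b₀ ∷ b₁ ∷ bs)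
  tail zero    []       []       _   = inj₂ (extend singleton)
  tail (suc k) as       bs       a≢0 with skew-or-proportional (a₁ ∷ as) (b₁ ∷ bs) (a≢0 ∘ Fin.suc)
  ... | inj₁ skew = inj₁ (there skew)
  ... | inj₂ prop = inj₂ (extend prop)

dot-scale : ∀ p q (a b : Vec ℤ k) v → (∀ j → p ℤ.* lookup b j ≡ q ℤ.* lookup a j) →
  p ℤ.* dot b v ≡ q ℤ.* dot a v
dot-scale p q []      []      []      eq = trans (ℤₚ.*-zeroʳ p) (sym (ℤₚ.*-zeroʳ q))
dot-scale p q (a ∷ as) (b ∷ bs) (i ∷ v) eq = begin
  p ℤ.* (b ℤ.* val i ℤ.+ dot bs v)              ≡⟨ lemma p b (val i) (dot bs v) ⟩
  p ℤ.* b ℤ.* val i ℤ.+ p ℤ.* dot bs v          ≡⟨ cong₂ (λ x y → x ℤ.* val i ℤ.+ y) (eq Fin.zero) (dot-scale p q as bs v (eq ∘ Fin.suc)) ⟩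
  q ℤ.* a ℤ.* val i ℤ.+ q ℤ.* dot as v          ≡⟨ lemma q a (val i) (dot as v) ⟨
  q ℤ.* (a ℤ.* val i ℤ.+ dot as v)              ∎
  where
  open ≡-Reasoning
  lemma : ∀ p b x y → p ℤ.* (b ℤ.* x ℤ.+ y) ≡ p ℤ.* b ℤ.* x ℤ.+ p ℤ.* y
  lemma = ℤ-Solver.solve-∀

proportional-dot : ∀ (a b : Vec ℤ (suc k)) → NonzeroCoefficients a → Proportional a b →
  ∀ v → dot a v ≡ 0ℤ → dot b v ≡ 0ℤ
proportional-dot a b a≢0 prop v a·v≡0 = ℤₚ.*-cancelˡ-≡ (lookup a Fin.zero) _ _ {{ℤ.≢-nonZero (a≢0 Fin.zero)}} (begin
  lookup a Fin.zero ℤ.* dot b v     ≡⟨ dot-scale (lookup a Fin.zero) (lookup b Fin.zero) a b v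
                                         (λ j → trans (prop Fin.zero j) (ℤₚ.*-comm (lookup a j) (lookup b Fin.zero))) ⟩
  lookup b Fin.zero ℤ.* dot a v     ≡⟨ cong (lookup b Fin.zero ℤ.*_) a·v≡0 ⟩
  lookup b Fin.zero ℤ.* 0ℤ          ≡⟨ trans (ℤₚ.*-zeroʳ (lookup b Fin.zero)) (sym (ℤₚ.*-zeroʳ (lookup a Fin.zero))) ⟩
  lookup a Fin.zero ℤ.* 0ℤ          ∎)
  where open ≡-Reasoning

-- Solutions with repeated coordinates

basis : Fin k → Vec ℤ k
basis Fin.zero    = + 1 ∷ Vec.replicate _ 0ℤ
basis (Fin.suc i) = 0ℤ ∷ basis i

lookup-basis-≡ : ∀ (i : Fin k) → lookup (basis i) i ≡ + 1
lookup-basis-≡ Fin.zero    = refl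
lookup-basis-≡ (Fin.suc i) = lookup-basis-≡ i

lookup-basis-≢ : ∀ (i l : Fin k) → l ≢ i → lookup (basis i) l ≡ 0ℤ
lookup-basis-≢ Fin.zero    Fin.zero    l≢i = ⊥-elim (l≢i refl)
lookup-basis-≢ Fin.zero    (Fin.suc l) l≢i = Vecₚ.lookup-replicate l 0ℤ
lookup-basis-≢ (Fin.suc i) Fin.zero    l≢i = refl
lookup-basis-≢ (Fin.suc i) (Fin.suc l) l≢i = lookup-basis-≢ i l (l≢i ∘ cong Fin.suc)

dot-zero : ∀ (v : Vec ℕ k) → dot (Vec.replicate k 0ℤ) v ≡ 0ℤ
dot-zero []      = refl
dot-zero (i ∷ v) = trans (ℤₚ.+-identityˡ _) (dot-zero v)

dot-basis : ∀ (i : Fin k) (v : Vec ℕ k) → dot (basis i) v ≡ val (lookup v i)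
dot-basis Fin.zero    (j ∷ v) = trans (cong₂ ℤ._+_ (ℤₚ.*-identityˡ (val j)) (dot-zero v)) (ℤₚ.+-identityʳ (val j))
dot-basis (Fin.suc i) (j ∷ v) = trans (ℤₚ.+-identityˡ _) (dot-basis i v)

dot-minus : ∀ (a b : Vec ℤ k) v → dot (Vec.zipWith ℤ._-_ a b) v ≡ dot a v ℤ.- dot b v
dot-minus []      []      []      = refl
dot-minus (a ∷ as) (b ∷ bs) (i ∷ v) = trans (cong (λ z → (a ℤ.- b) ℤ.* val i ℤ.+ z) (dot-minus as bs v))
  (lemma a b (val i) (dot as v) (dot bs v))
  where
  lemma : ∀ a b x y z → (a ℤ.- b) ℤ.* x ℤ.+ (y ℤ.- z) ≡ (a ℤ.* x ℤ.+ y) ℤ.- (b ℤ.* x ℤ.+ z)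
  lemma = ℤ-Solver.solve-∀

third : ∀ (i j : Fin (3 ℕ.+ k)) → ∃[ l ] l ≢ i × l ≢ j
third Fin.zero              Fin.zero              = Fin.suc Fin.zero , (λ ()) , (λ ())
third Fin.zero              (Fin.suc Fin.zero)    = Fin.suc (Fin.suc Fin.zero) , (λ ()) , (λ ())
third Fin.zero              (Fin.suc (Fin.suc _)) = Fin.suc Fin.zero , (λ ()) , (λ ())
third (Fin.suc Fin.zero)    Fin.zero              = Fin.suc (Fin.suc Fin.zero) , (λ ()) , (λ ())
third (Fin.suc (Fin.suc _)) Fin.zero              = Fin.suc Fin.zero , (λ ()) , (λ ())
third (Fin.suc _)           (Fin.suc _)           = Fin.zero , (λ ()) , (λ ())

collision : Vec (Fin n) k → Fin k → Fin k → ℚ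
collision x i j = 𝟙 (¬? (i Finₚ.≟ j)) * 𝟙 (lookup x i Finₚ.≟ lookup x j)

0≤collision : ∀ (x : Vec (Fin n) k) i j → 0ℚ ≤ collision x i j
0≤collision x i j = 0≤* (0≤𝟙 (¬? (i Finₚ.≟ j))) (0≤𝟙 (lookup x i Finₚ.≟ lookup x j))

-- A coincidence xᵢ = xⱼ is a second linear equation, with coefficient vector eᵢ - eⱼ. Among at
-- least three variables this vector has a zero entry and a has none, so they are not proportional
-- and the coincidence loses a factor n.
collision-bound : ∀ {k} (a : Vec ℤ (3 ℕ.+ k)) → NonzeroCoefficients a → ∀ i j →
  ∃[ C ] 0ℚ ≤ C × (∀ n → ∑ (solutions a n) (λ x → collision x i j) ≤ C * ℕ→ℚ (n ℕ.^ suc k))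
collision-bound {k} a a≢0 i j with i Finₚ.≟ j
... | yes refl = 0ℚ , ℚₚ.≤-refl , λ n → ℚₚ.≤-reflexive (begin
  ∑ (solutions a n) (λ x → 0ℚ * 𝟙 (lookup x i Finₚ.≟ lookup x i))
    ≡⟨ ∑-cong (solutions a n) (λ x → ℚₚ.*-zeroˡ (𝟙 (lookup x i Finₚ.≟ lookup x i))) ⟩
  ∑ (solutions a n) (λ _ → 0ℚ)     ≡⟨ ∑-zero (solutions a n) ⟩
  0ℚ                               ≡⟨ ℚₚ.*-zeroˡ (ℕ→ℚ (n ℕ.^ suc k)) ⟨
  0ℚ * ℕ→ℚ (n ℕ.^ suc k)           ∎)
  where open ≡-Reasoning
... | no i≢j = go (skew-or-proportional a b a≢0)
  where
  b = Vec.zipWith ℤ._-_ (basis i) (basis j)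
  bᵢ≡1 : lookup b i ≡ + 1
  bᵢ≡1 = trans (Vecₚ.lookup-zipWith ℤ._-_ i (basis i) (basis j))
    (cong₂ ℤ._-_ (lookup-basis-≡ i) (lookup-basis-≢ j i i≢j))
  dot-b : ∀ v → dot b v ≡ val (lookup v i) ℤ.- val (lookup v j)
  dot-b v = trans (dot-minus (basis i) (basis j) v) (cong₂ ℤ._-_ (dot-basis i v) (dot-basis j v))
  go : Skew a b ⊎ Proportional a b → ∃[ C ] 0ℚ ≤ C ×
    (∀ n → ∑ (solutions a n) (λ x → 1ℚ * 𝟙 (lookup x i Finₚ.≟ lookup x j)) ≤ C * ℕ→ℚ (n ℕ.^ suc k))
  go (inj₂ prop) = ⊥-elim (a≢0 l (begin
    lookup a l                   ≡⟨ ℤₚ.*-identityʳ (lookup a l) ⟨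
    lookup a l ℤ.* + 1           ≡⟨ cong (lookup a l ℤ.*_) bᵢ≡1 ⟨
    lookup a l ℤ.* lookup b i    ≡⟨ prop l i ⟩
    lookup a i ℤ.* lookup b l    ≡⟨ cong (lookup a i ℤ.*_) bₗ≡0 ⟩
    lookup a i ℤ.* 0ℤ            ≡⟨ ℤₚ.*-zeroʳ (lookup a i) ⟩
    0ℤ                           ∎))
    where
    open ≡-Reasoning
    l = proj₁ (third i j)
    bₗ≡0 : lookup b l ≡ 0ℤ
    bₗ≡0 = trans (Vecₚ.lookup-zipWith ℤ._-_ l (basis i) (basis j))
      (cong₂ ℤ._-_ (lookup-basis-≢ i l (proj₁ (proj₂ (third i j)))) (lookup-basis-≢ j l (proj₂ (proj₂ (third i j)))))
  go (inj₁ skew) = C , proj₁ (proj₂ bounded) , λ n → subst (_≤ C * ℕ→ℚ (n ℕ.^ suc k)) (sym (rewritten n))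
    (∣p∣≤⇒≤ (proj₂ (proj₂ bounded) n 0ℤ 0ℤ))
    where
    bounded = skew-bound zeroKernel zeroKernel-bounded skew
    C = proj₁ bounded
    rewritten : ∀ n → ∑ (solutions a n) (λ x → 1ℚ * 𝟙 (lookup x i Finₚ.≟ lookup x j)) ≡
      ∑ᵛ (upTo n) (3 ℕ.+ k) λ v → zeroKernel (0ℤ ℤ.+ dot a v) (0ℤ ℤ.+ dot b v)
    rewritten n = trans
      (∑-solutions a n _ (λ v → 𝟙 (dot b v ≟0)) λ x → trans (ℚₚ.*-identityˡ (𝟙 (lookup x i Finₚ.≟ lookup x j)))
        (𝟙-cong (lookup x i Finₚ.≟ lookup x j) (dot b (Vec.map toℕ x) ≟0)
          (λ eq → trans (dot-b (Vec.map toℕ x)) (ℤₚ.i≡j⇒i-j≡0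
             (cong val (trans (Vecₚ.lookup-map i toℕ x) (trans (cong toℕ eq) (sym (Vecₚ.lookup-map j toℕ x)))))))
          (λ eq → Finₚ.toℕ-injective (trans (sym (Vecₚ.lookup-map i toℕ x)) (trans (val-injective
             (ℤₚ.i-j≡0⇒i≡j (val (lookup (Vec.map toℕ x) i)) (val (lookup (Vec.map toℕ x) j)) (trans (sym (dot-b (Vec.map toℕ x))) eq)))
             (Vecₚ.lookup-map j toℕ x))))))
      (∑-cong (vecs (upTo n) (3 ℕ.+ k)) λ v → cong₂ zeroKernel (sym (ℤₚ.+-identityˡ (dot a v))) (sym (ℤₚ.+-identityˡ (dot b v))))

degenerate≤collisions : ∀ (x : Vec (Fin n) k) →
  1ℚ - 𝟙 (distinct? x) ≤ ∑ (allFin k) λ i → ∑ (allFin k) λ j → collision x i j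
degenerate≤collisions {n} {k} x = go (distinct? x)
  where
  go : (d : Dec (Distinct x)) → 1ℚ - 𝟙 d ≤ ∑ (allFin k) λ i → ∑ (allFin k) λ j → collision x i j
  go (yes _) = 0≤∑ (allFin k) λ i → 0≤∑ (allFin k) λ j → 0≤collision x i j
  go (no ¬distinct) =
    let i , ¬i = Finₚ.¬∀⟶∃¬ k _ (λ i → Finₚ.all? λ j → (lookup x i Finₚ.≟ lookup x j) →-dec (i Finₚ.≟ j)) ¬distinct
        j , ¬j = Finₚ.¬∀⟶∃¬ k _ (λ j → (lookup x i Finₚ.≟ lookup x j) →-dec (i Finₚ.≟ j)) ¬i
        i≢j : i ≢ j
        i≢j = λ i≡j → ¬j λ _ → i≡j
        equal : lookup x i ≡ lookup x j
        equal = decidable-stable (lookup x i Finₚ.≟ lookup x j) λ ne → ¬j λ eq → ⊥-elim (ne eq)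
    in ℚₚ.≤-trans (ℚₚ.≤-reflexive (sym (cong₂ _*_ (𝟙-yes (¬? (i Finₚ.≟ j)) i≢j) (𝟙-yes (lookup x i Finₚ.≟ lookup x j) equal))))
       (ℚₚ.≤-trans (term≤∑ {f = collision x i} (0≤collision x i) (∈-allFin j))
         (term≤∑ {f = λ i → ∑ (allFin k) (collision x i)} (λ i → 0≤∑ (allFin k) (0≤collision x i)) (∈-allFin i)))

degenerate-bound : ∀ {k} (a : Vec ℤ (3 ℕ.+ k)) → NonzeroCoefficients a →
  ∃[ C ] 0ℚ ≤ C × (∀ n → degenerateCount a n ≤ C * ℕ→ℚ (n ℕ.^ suc k))
degenerate-bound {k} a a≢0 = C , 0≤∑ F (λ i → 0≤∑ F (λ j → proj₁ (proj₂ (collision-bound a a≢0 i j)))) , λ n → begin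
  ∑ (solutions a n) (λ x → 1ℚ - 𝟙 (distinct? x))
    ≤⟨ ∑-mono (solutions a n) degenerate≤collisions ⟩
  ∑ (solutions a n) (λ x → ∑ F λ i → ∑ F λ j → collision x i j)
    ≡⟨ ∑-swap (solutions a n) F (λ x i → ∑ F λ j → collision x i j) ⟩
  ∑ F (λ i → ∑ (solutions a n) λ x → ∑ F λ j → collision x i j)
    ≡⟨ ∑-cong F (λ i → ∑-swap (solutions a n) F λ x j → collision x i j) ⟩
  ∑ F (λ i → ∑ F λ j → ∑ (solutions a n) λ x → collision x i j)
    ≤⟨ ∑-mono F (λ i → ∑-mono F λ j → proj₂ (proj₂ (collision-bound a a≢0 i j)) n) ⟩
  ∑ F (λ i → ∑ F λ j → c i j * ℕ→ℚ (n ℕ.^ suc k))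
    ≡⟨ trans (∑-cong F λ i → ∑-*ʳ F (ℕ→ℚ (n ℕ.^ suc k)) (c i)) (∑-*ʳ F (ℕ→ℚ (n ℕ.^ suc k)) λ i → ∑ F (c i)) ⟩
  C * ℕ→ℚ (n ℕ.^ suc k) ∎
  where
  open ℚₚ.≤-Reasoning
  F = allFin (3 ℕ.+ k)
  c : Fin (3 ℕ.+ k) → Fin (3 ℕ.+ k) → ℚ
  c i j = proj₁ (collision-bound a a≢0 i j)
  C = ∑ F λ i → ∑ F (c i)

-- Lower bound for the number of solutions

data OppositeSigns : ∀ {k} → Vec ℤ (2 ℕ.+ k) → Set where
  -- ε is a sign; recording it by ε² = 1 lets a single ring identity treat both cases.
  here  : ∀ {k a₀ a₁} {as : Vec ℤ k} ε p q → ε ℤ.* ε ≡ + 1 →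
          a₀ ≡ ε ℤ.* + suc p → a₁ ≡ ℤ.- ε ℤ.* + suc q → OppositeSigns (a₀ ∷ a₁ ∷ as)
  there : ∀ {k a₀} {as : Vec ℤ (2 ℕ.+ k)} → OppositeSigns as → OppositeSigns (a₀ ∷ as)

-- A change of sign anywhere forces one between neighbours, so adjacent entries are all that has to
-- be inspected.
opposite-or-same : ∀ {k} (a : Vec ℤ (2 ℕ.+ k)) → NonzeroCoefficients a →
  OppositeSigns a ⊎ (∀ i → 0ℤ ℤ.< lookup a i) ⊎ (∀ i → lookup a i ℤ.< 0ℤ)
opposite-or-same (a₀ ∷ a₁ ∷ as) a≢0 = go a₀ a₁ as a≢0
  where
  go : ∀ {k} a₀ a₁ (as : Vec ℤ k) → NonzeroCoefficients (a₀ ∷ a₁ ∷ as) → OppositeSigns (a₀ ∷ a₁ ∷ as)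
    ⊎ (∀ i → 0ℤ ℤ.< lookup (a₀ ∷ a₁ ∷ as) i) ⊎ (∀ i → lookup (a₀ ∷ a₁ ∷ as) i ℤ.< 0ℤ)
  go (+ zero)   _          as a≢0 = ⊥-elim (a≢0 Fin.zero refl)
  go _          (+ zero)   as a≢0 = ⊥-elim (a≢0 (Fin.suc Fin.zero) refl)
  go (+ suc p)  -[1+ q ]   as a≢0 = inj₁ (here (+ 1) p q refl (sym (ℤₚ.*-identityˡ (+ suc p))) (cong -[1+_] (sym (ℕₚ.+-identityʳ q))))
  go -[1+ p ]   (+ suc q)  as a≢0 = inj₁ (here (ℤ.- + 1) p q refl (cong -[1+_] (sym (ℕₚ.+-identityʳ p))) (sym (ℤₚ.*-identityˡ (+ suc q))))
  go (+ suc p)  (+ suc q)  [] a≢0 = inj₂ (inj₁ λ { Fin.zero → ℤ.+<+ ℕ.z<s ; (Fin.suc Fin.zero) → ℤ.+<+ ℕ.z<s ; (Fin.suc (Fin.suc ())) })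
  go -[1+ p ]   -[1+ q ]   [] a≢0 = inj₂ (inj₂ λ { Fin.zero → ℤ.-<+ ; (Fin.suc Fin.zero) → ℤ.-<+ ; (Fin.suc (Fin.suc ())) })
  go (+ suc p)  (+ suc q)  (a₂ ∷ as) a≢0 with go (+ suc q) a₂ as (a≢0 ∘ Fin.suc)
  ... | inj₁ opp        = inj₁ (there opp)
  ... | inj₂ (inj₁ pos) = inj₂ (inj₁ λ { Fin.zero → ℤ.+<+ ℕ.z<s ; (Fin.suc i) → pos i })
  ... | inj₂ (inj₂ neg) = case neg Fin.zero of λ { (ℤ.+<+ ()) }
  go -[1+ p ]   -[1+ q ]   (a₂ ∷ as) a≢0 with go -[1+ q ] a₂ as (a≢0 ∘ Fin.suc)
  ... | inj₁ opp        = inj₁ (there opp)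
  ... | inj₂ (inj₁ pos) = case pos Fin.zero of λ ()
  ... | inj₂ (inj₂ neg) = inj₂ (inj₂ λ { Fin.zero → ℤ.-<+ ; (Fin.suc i) → neg i })

∑<-mono-range : ∀ {m n} {f : ℕ → ℚ} → (∀ i → 0ℚ ≤ f i) → m ℕ.≤ n → ∑< m f ≤ ∑< n f
∑<-mono-range {m} {n} {f} 0≤f m≤n = subst₂ _≤_ (ℚₚ.+-identityʳ (∑< m f))
  (trans (sym (∑<-+ m (n ℕ.∸ m) f)) (cong (λ l → ∑< l f) (ℕₚ.m+[n∸m]≡n m≤n)))
  (ℚₚ.+-monoʳ-≤ (∑< m f) (0≤∑ (upTo (n ℕ.∸ m)) (λ i → 0≤f (m ℕ.+ i))))

∑<-drop : ∀ u T {f : ℕ → ℚ} → (∀ i → 0ℚ ≤ f i) → ∑< T (λ i → f (u ℕ.+ i)) ≤ ∑< (u ℕ.+ T) f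
∑<-drop u T {f} 0≤f = subst₂ _≤_ (ℚₚ.+-identityˡ (∑< T λ i → f (u ℕ.+ i))) (sym (∑<-+ u T f))
  (ℚₚ.+-monoˡ-≤ (∑< T λ i → f (u ℕ.+ i)) (0≤∑ (upTo u) 0≤f))

-- The index of the number (1 + d)(1 + z).
dilate : ℕ → ℕ → ℕ
dilate d z = d ℕ.+ z ℕ.* suc d

val-dilate : ∀ d z → val (dilate d z) ≡ + suc d ℤ.* val z
val-dilate d z = trans (cong +_ (lemma d z)) (ℤₚ.pos-* (suc d) (suc z))
  where
  lemma : ∀ d z → suc (d ℕ.+ z ℕ.* suc d) ≡ suc d ℕ.* suc z
  lemma = ℕ-Solver.solve-∀

∑<-dilate : ∀ d T {n} {f : ℕ → ℚ} → (∀ i → 0ℚ ≤ f i) → T ℕ.* suc d ℕ.≤ n → ∑< T (f ∘ dilate d) ≤ ∑< n f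
∑<-dilate d T {n} {f} 0≤f Td≤n = ℚₚ.≤-trans (blocks T f 0≤f) (∑<-mono-range 0≤f Td≤n)
  where
  blocks : ∀ T f → (∀ i → 0ℚ ≤ f i) → ∑< T (f ∘ dilate d) ≤ ∑< (T ℕ.* suc d) f
  blocks zero    f 0≤f = ℚₚ.≤-refl
  blocks (suc T) f 0≤f = begin
    ∑< (suc T) (f ∘ dilate d)
      ≡⟨ ∑<-suc T (f ∘ dilate d) ⟩
    f (d ℕ.+ 0) + ∑< T (λ z → f (dilate d (suc z)))
      ≡⟨ cong₂ _+_ (cong f (ℕₚ.+-identityʳ d)) (∑<-cong T λ z → cong f (lemma d z)) ⟩
    f d + ∑< T (λ z → f (suc d ℕ.+ dilate d z))
      ≤⟨ ℚₚ.+-mono-≤ (term≤∑ 0≤f (∈-upTo⁺ (ℕₚ.n<1+n d))) (blocks T (λ i → f (suc d ℕ.+ i)) (λ i → 0≤f (suc d ℕ.+ i))) ⟩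
    ∑< (suc d) f + ∑< (T ℕ.* suc d) (λ i → f (suc d ℕ.+ i))
      ≡⟨ ∑<-+ (suc d) (T ℕ.* suc d) f ⟨
    ∑< (suc d ℕ.+ T ℕ.* suc d) f ∎
    where
    open ℚₚ.≤-Reasoning
    lemma : ∀ d z → d ℕ.+ (suc d ℕ.+ z ℕ.* suc d) ≡ suc d ℕ.+ (d ℕ.+ z ℕ.* suc d)
    lemma = ℕ-Solver.solve-∀

-- Only values divisible by 1 + d are kept, and the dropped terms are non-negative. This makes the
-- rest of the equation a multiple of 1 + d, so that the two variables of opposite sign can solve
-- it.
∑ᵛ-dilate : ∀ d T {n} → T ℕ.* suc d ℕ.≤ n → (a : Vec ℤ k) (φ : ℤ → ℚ) → (∀ z → 0ℚ ≤ φ z) →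
  ∑ᵛ (upTo T) k (λ v → φ (+ suc d ℤ.* dot a v)) ≤ ∑ᵛ (upTo n) k (λ v → φ (dot a v))
∑ᵛ-dilate         d T {n} Td≤n []       φ 0≤φ =
  ℚₚ.≤-reflexive (cong (λ z → φ z + 0ℚ) (ℤₚ.*-zeroʳ (+ suc d)))
∑ᵛ-dilate {suc k} d T {n} Td≤n (a ∷ as) φ 0≤φ = begin
  ∑ᵛ (upTo T) (suc k) (λ v → φ (+ suc d ℤ.* dot (a ∷ as) v))
    ≡⟨ ∑ᵛ-suc (upTo T) k (λ v → φ (+ suc d ℤ.* dot (a ∷ as) v)) ⟩
  ∑< T (λ z → ∑ᵛ (upTo T) k λ v → φ (+ suc d ℤ.* (a ℤ.* val z ℤ.+ dot as v)))
    ≡⟨ ∑<-cong T (λ z → ∑-cong (vecs (upTo T) k) λ v → cong φ (trans (lemma (+ suc d) a (val z) (dot as v)) (cong (λ x → a ℤ.* x ℤ.+ + suc d ℤ.* dot as v) (sym (val-dilate d z))))) ⟩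
  ∑< T (λ z → ∑ᵛ (upTo T) k λ v → φ (a ℤ.* val (dilate d z) ℤ.+ + suc d ℤ.* dot as v))
    ≤⟨ ∑<-dilate d T {f = λ i → ∑ᵛ (upTo T) k λ v → φ (a ℤ.* val i ℤ.+ + suc d ℤ.* dot as v)} (λ i → 0≤∑ (vecs (upTo T) k) λ v → 0≤φ (a ℤ.* val i ℤ.+ + suc d ℤ.* dot as v)) Td≤n ⟩
  ∑< n (λ i → ∑ᵛ (upTo T) k λ v → φ (a ℤ.* val i ℤ.+ + suc d ℤ.* dot as v))
    ≤⟨ ∑<-mono n (λ i → ∑ᵛ-dilate d T Td≤n as (λ z → φ (a ℤ.* val i ℤ.+ z)) (λ z → 0≤φ (a ℤ.* val i ℤ.+ z))) ⟩
  ∑< n (λ i → ∑ᵛ (upTo n) k λ v → φ (a ℤ.* val i ℤ.+ dot as v))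
    ≡⟨ ∑ᵛ-suc (upTo n) k (λ v → φ (dot (a ∷ as) v)) ⟨
  ∑ᵛ (upTo n) (suc k) (λ v → φ (dot (a ∷ as) v)) ∎
  where
  open ℚₚ.≤-Reasoning
  lemma : ∀ d a x y → d ℤ.* (a ℤ.* x ℤ.+ y) ≡ a ℤ.* (d ℤ.* x) ℤ.+ d ℤ.* y
  lemma = ℤ-Solver.solve-∀

∣_∣₁ : Vec ℤ k → ℕ
∣ []     ∣₁ = 0
∣ a ∷ as ∣₁ = ℤ.∣ a ∣ ℕ.+ ∣ as ∣₁

∣+∣≤ : ∀ x y B C T → ℤ.∣ x ∣ ℕ.≤ B ℕ.* T → ℤ.∣ y ∣ ℕ.≤ C ℕ.* T → ℤ.∣ x ℤ.+ y ∣ ℕ.≤ (B ℕ.+ C) ℕ.* T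
∣+∣≤ x y B C T x≤ y≤ = ℕₚ.≤-trans (ℤₚ.∣i+j∣≤∣i∣+∣j∣ x y)
  (ℕₚ.≤-trans (ℕₚ.+-mono-≤ x≤ y≤) (ℕₚ.≤-reflexive (sym (ℕₚ.*-distribʳ-+ T B C))))

∣dot∣≤ : ∀ (a : Vec ℤ k) T {v} → v ∈ vecs (upTo T) k → ℤ.∣ dot a v ∣ ℕ.≤ ∣ a ∣₁ ℕ.* T
∣dot∣≤ []       T {[]}    _  = ℕ.z≤n
∣dot∣≤ (a ∷ as) T {v} v∈ with ∈-cartesianProductWith⁻ _∷_ (upTo T) (vecs (upTo T) _) v∈
... | i , w , i∈ , w∈ , refl = ∣+∣≤ (a ℤ.* val i) (dot as w) ℤ.∣ a ∣ ∣ as ∣₁ T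
  (subst (ℕ._≤ ℤ.∣ a ∣ ℕ.* T) (sym (ℤₚ.∣i*j∣≡∣i∣*∣j∣ a (val i))) (ℕₚ.*-monoʳ-≤ ℤ.∣ a ∣ (∈-upTo⁻ i∈)))
  (∣dot∣≤ as T w∈)

-- The witnesses are x = β(w - εR) and y = αw, where α = 1 + p, β = 1 + q and w > |R|.
pair-count : ∀ ε p q a₀ a₁ → ε ℤ.* ε ≡ + 1 → a₀ ≡ ε ℤ.* + suc p → a₁ ≡ ℤ.- ε ℤ.* + suc q →
  ∀ B n T R → (1 ℕ.+ 2 ℕ.* B) ℕ.* (suc p ℕ.* suc q) ℕ.* T ℕ.≤ n → ℤ.∣ R ∣ ℕ.≤ B ℕ.* T →
  ℕ→ℚ T ≤ ∑∑ n (λ i j → 𝟙 ((+ suc p ℤ.* + suc q) ℤ.* R ℤ.+ (a₀ ℤ.* val i ℤ.+ a₁ ℤ.* val j) ≟0))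
pair-count ε p q a₀ a₁ ε²≡1 a₀≡ a₁≡ B n T R En≤ ∣R∣≤ = begin
  ℕ→ℚ T
    ≡⟨ ℚₚ.*-identityʳ (ℕ→ℚ T) ⟨
  ℕ→ℚ T * 1ℚ
    ≡⟨ ∑<-const T 1ℚ ⟨
  ∑< T (λ _ → 1ℚ)
    ≤⟨ ∑-mono∈ (upTo T) (λ {w} w∈ → witness w (∈-upTo⁻ w∈)) ⟩
  ∑< T (λ w → ∑< n λ i → F i (dilate p (u ℕ.+ w)))
    ≤⟨ ∑<-drop u T {f = λ w → ∑< n λ i → F i (dilate p w)} (λ w → 0≤∑ (upTo n) λ i → 0≤F i (dilate p w)) ⟩
  ∑< (u ℕ.+ T) (λ w → ∑< n λ i → F i (dilate p w))
    ≤⟨ ∑<-dilate p (u ℕ.+ T) {f = λ j → ∑< n λ i → F i j} (λ j → 0≤∑ (upTo n) λ i → 0≤F i j) y≤n ⟩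
  ∑< n (λ j → ∑< n λ i → F i j)
    ≡⟨ ∑-swap (upTo n) (upTo n) (λ j i → F i j) ⟩
  ∑∑ n F ∎
  where
  open ℚₚ.≤-Reasoning
  α = + suc p
  β = + suc q
  D = α ℤ.* β
  u = B ℕ.* T
  F : ℕ → ℕ → ℚ
  F i j = 𝟙 (D ℤ.* R ℤ.+ (a₀ ℤ.* val i ℤ.+ a₁ ℤ.* val j) ≟0)
  0≤F : ∀ i j → 0ℚ ≤ F i j
  0≤F i j = 0≤𝟙 (D ℤ.* R ℤ.+ (a₀ ℤ.* val i ℤ.+ a₁ ℤ.* val j) ≟0)

  y≤n : (u ℕ.+ T) ℕ.* suc p ℕ.≤ n
  y≤n = ℕₚ.≤-trans (subst ((u ℕ.+ T) ℕ.* suc p ℕ.≤_) (lemma B p q T) (ℕₚ.m≤m+n ((u ℕ.+ T) ℕ.* suc p) _)) En≤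
    where
    lemma : ∀ B p q T → (B ℕ.* T ℕ.+ T) ℕ.* suc p ℕ.+ (B ℕ.* T ℕ.* suc p ℕ.+ (1 ℕ.+ 2 ℕ.* B) ℕ.* T ℕ.* suc p ℕ.* q) ≡
      (1 ℕ.+ 2 ℕ.* B) ℕ.* (suc p ℕ.* suc q) ℕ.* T
    lemma = ℕ-Solver.solve-∀

  ∣ε∣≡1 : ℤ.∣ ε ∣ ≡ 1
  ∣ε∣≡1 = ℕₚ.m*n≡1⇒m≡1 ℤ.∣ ε ∣ ℤ.∣ ε ∣ (trans (sym (ℤₚ.∣i*j∣≡∣i∣*∣j∣ ε ε)) (cong ℤ.∣_∣ ε²≡1))

  ∣εR∣≤u : ℤ.∣ ε ℤ.* R ∣ ℕ.≤ u
  ∣εR∣≤u = subst (ℕ._≤ u) (sym (trans (ℤₚ.∣i*j∣≡∣i∣*∣j∣ ε R) (trans (cong (ℕ._* ℤ.∣ R ∣) ∣ε∣≡1) (ℕₚ.*-identityˡ ℤ.∣ R ∣)))) ∣R∣≤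

  -- The shift by `u` = B T ≥ |R| guarantees u - εR ≥ 0, and e ≤ 2u keeps the first coordinate
  -- within n.
  e = ℤ.∣ + u ℤ.- ε ℤ.* R ∣

  0≤u-z : ∀ z → ℤ.∣ z ∣ ℕ.≤ u → 0ℤ ℤ.≤ + u ℤ.- z
  0≤u-z (+ m)    m≤u = ℤₚ.i≤j⇒0≤j-i (ℤ.+≤+ m≤u)
  0≤u-z -[1+ m ] _   = ℤ.+≤+ ℕ.z≤n

  +e≡ : + e ≡ + u ℤ.- ε ℤ.* R
  +e≡ = ℤₚ.0≤i⇒+∣i∣≡i (0≤u-z (ε ℤ.* R) ∣εR∣≤u)

  e≤2u : e ℕ.≤ u ℕ.+ u
  e≤2u = ℕₚ.≤-trans (ℤₚ.∣i-j∣≤∣i∣+∣j∣ (+ u) (ε ℤ.* R)) (ℕₚ.+-monoʳ-≤ u ∣εR∣≤u)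

  x<n : ∀ w → w ℕ.< T → dilate q (e ℕ.+ w) ℕ.< n
  x<n w w<T = ℕₚ.≤-trans (subst₂ ℕ._≤_ (lemma₁ q (e ℕ.+ w)) (lemma₂ B p q T)
    (ℕₚ.≤-trans (ℕₚ.*-monoˡ-≤ (suc q) (subst (ℕ._≤ u ℕ.+ u ℕ.+ T) (ℕₚ.+-suc e w) (ℕₚ.+-mono-≤ e≤2u w<T)))
      (ℕₚ.m≤m+n ((u ℕ.+ u ℕ.+ T) ℕ.* suc q) _))) En≤
    where
    lemma₁ : ∀ q z → suc z ℕ.* suc q ≡ suc (q ℕ.+ z ℕ.* suc q)
    lemma₁ = ℕ-Solver.solve-∀
    lemma₂ : ∀ B p q T → (B ℕ.* T ℕ.+ B ℕ.* T ℕ.+ T) ℕ.* suc q ℕ.+ (1 ℕ.+ 2 ℕ.* B) ℕ.* T ℕ.* suc q ℕ.* p ≡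
      (1 ℕ.+ 2 ℕ.* B) ℕ.* (suc p ℕ.* suc q) ℕ.* T
    lemma₂ = ℕ-Solver.solve-∀

  solves : ∀ w → D ℤ.* R ℤ.+ (a₀ ℤ.* val (dilate q (e ℕ.+ w)) ℤ.+ a₁ ℤ.* val (dilate p (u ℕ.+ w))) ≡ 0ℤ
  solves w = trans
    (cong₂ (λ x y → D ℤ.* R ℤ.+ (x ℤ.+ y))
      (cong₂ ℤ._*_ a₀≡ (trans (val-dilate q (e ℕ.+ w)) (cong (β ℤ.*_) (trans (val-+ e w) (cong (ℤ._+ val w) +e≡)))))
      (cong₂ ℤ._*_ a₁≡ (trans (val-dilate p (u ℕ.+ w)) (cong (α ℤ.*_) (val-+ u w)))))
    (trans (lemma α β ε R (+ u) (val w))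
    (trans (cong (λ z → α ℤ.* β ℤ.* R ℤ.* (+ 1 ℤ.- z)) ε²≡1) (ℤₚ.*-zeroʳ (α ℤ.* β ℤ.* R))))
    where
    lemma : ∀ α β ε R u w → α ℤ.* β ℤ.* R ℤ.+ (ε ℤ.* α ℤ.* (β ℤ.* (u ℤ.- ε ℤ.* R ℤ.+ w)) ℤ.+ ℤ.- ε ℤ.* β ℤ.* (α ℤ.* (u ℤ.+ w)))
      ≡ α ℤ.* β ℤ.* R ℤ.* (+ 1 ℤ.- ε ℤ.* ε)
    lemma = ℤ-Solver.solve-∀

  witness : ∀ w → w ℕ.< T → 1ℚ ≤ ∑< n (λ i → F i (dilate p (u ℕ.+ w)))
  witness w w<T = subst (_≤ ∑< n λ i → F i (dilate p (u ℕ.+ w)))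
    (𝟙-yes (D ℤ.* R ℤ.+ (a₀ ℤ.* val (dilate q (e ℕ.+ w)) ℤ.+ a₁ ℤ.* val (dilate p (u ℕ.+ w))) ≟0) (solves w))
    (term≤∑ {f = λ i → F i (dilate p (u ℕ.+ w))} (λ i → 0≤F i (dilate p (u ℕ.+ w))) (∈-upTo⁺ (x<n w w<T)))

-- Strong enough for induction along the vector: (1 + d) R is the contribution of the entries
-- already passed, B bounds R in terms of T, and E, chosen after B alone, says how large n must be
-- compared with T.
ManySolutions : ℕ → Vec ℤ (2 ℕ.+ k) → Set
ManySolutions {k} d a = ∀ B → ∃[ E ] ∀ n T R → E ℕ.* T ℕ.≤ n → ℤ.∣ R ∣ ℕ.≤ B ℕ.* T →
  ℕ→ℚ (T ℕ.^ suc k) ≤ ∑ᵛ (upTo n) (2 ℕ.+ k) (λ v → 𝟙 (+ suc d ℤ.* R ℤ.+ dot a v ≟0))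

-- Every variable outside the pair runs over T multiples of 1 + d, the product of the absolute
-- values of the pair's coefficients. For each choice the pair still has at least T solutions.
many-solutions : ∀ {k} {a : Vec ℤ (2 ℕ.+ k)} → OppositeSigns a → ∃[ d ] ManySolutions d a
many-solutions {k} (here {a₀ = a₀} {a₁} {as} ε p q ε²≡1 a₀≡ a₁≡) = d , λ B → E B , bound B
  where
  -- One less than suc p * suc q, in the form that makes `suc d` reduce to this product.
  d = q ℕ.+ p ℕ.* suc q
  E : ℕ → ℕ
  E B = (1 ℕ.+ 2 ℕ.* (B ℕ.+ ∣ as ∣₁)) ℕ.* suc d
  bound : ∀ B n T R → E B ℕ.* T ℕ.≤ n → ℤ.∣ R ∣ ℕ.≤ B ℕ.* T →
    ℕ→ℚ (T ℕ.^ suc k) ≤ ∑ᵛ (upTo n) (2 ℕ.+ k) (λ v → 𝟙 (+ suc d ℤ.* R ℤ.+ dot (a₀ ∷ a₁ ∷ as) v ≟0))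
  bound B n T R En≤ ∣R∣≤ = begin
    ℕ→ℚ (T ℕ.^ suc k)
      ≡⟨ trans (cong ℕ→ℚ (ℕₚ.*-comm T (T ℕ.^ k))) (trans (ℕ→ℚ-* (T ℕ.^ k) T)
           (cong (λ l → ℕ→ℚ l * ℕ→ℚ T) (sym (trans (length-vecs (upTo T) k) (cong (ℕ._^ k) (Listₚ.length-upTo T)))))) ⟩
    ℕ→ℚ (length (vecs (upTo T) k)) * ℕ→ℚ T
      ≡⟨ ∑-const (vecs (upTo T) k) (ℕ→ℚ T) ⟨
    ∑ᵛ (upTo T) k (λ _ → ℕ→ℚ T)
      ≤⟨ ∑-mono∈ (vecs (upTo T) k) inner ⟩
    ∑ᵛ (upTo T) k (λ v → φ (+ suc d ℤ.* dot as v))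
      ≤⟨ ∑ᵛ-dilate d T Td≤n as φ (λ z → 0≤∑ (upTo n) λ i → 0≤∑ (upTo n) λ j → 0≤𝟙 (+ suc d ℤ.* R ℤ.+ z ℤ.+ (a₀ ℤ.* val i ℤ.+ a₁ ℤ.* val j) ≟0)) ⟩
    ∑ᵛ (upTo n) k (λ v → φ (dot as v))
      ≡⟨ trans (∑<-cong n λ i → ∑-swap (upTo n) (vecs (upTo n) k) (λ j v → G i j (dot as v)))
           (∑-swap (upTo n) (vecs (upTo n) k) (λ i v → ∑< n λ j → G i j (dot as v))) ⟨
    ∑∑ n (λ i j → ∑ᵛ (upTo n) k λ v → G i j (dot as v))
      ≡⟨ ∑∑-cong n (λ i j → ∑-cong (vecs (upTo n) k) λ v → cong (λ z → 𝟙 (z ≟0)) (sym (lemma (+ suc d ℤ.* R) (a₀ ℤ.* val i) (a₁ ℤ.* val j) (dot as v)))) ⟩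
    ∑∑ n (λ i j → ∑ᵛ (upTo n) k λ v → F (i ∷ j ∷ v))
      ≡⟨ trans (∑ᵛ-suc (upTo n) (suc k) F) (∑<-cong n λ i → ∑ᵛ-suc (upTo n) k (λ v → F (i ∷ v))) ⟨
    ∑ᵛ (upTo n) (2 ℕ.+ k) F ∎
    where
    open ℚₚ.≤-Reasoning
    lemma : ∀ s x y z → s ℤ.+ (x ℤ.+ (y ℤ.+ z)) ≡ s ℤ.+ z ℤ.+ (x ℤ.+ y)
    lemma = ℤ-Solver.solve-∀
    F : Vec ℕ (2 ℕ.+ k) → ℚ
    F v = 𝟙 (+ suc d ℤ.* R ℤ.+ dot (a₀ ∷ a₁ ∷ as) v ≟0)
    G : ℕ → ℕ → ℤ → ℚ
    G i j z = 𝟙 (+ suc d ℤ.* R ℤ.+ z ℤ.+ (a₀ ℤ.* val i ℤ.+ a₁ ℤ.* val j) ≟0)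
    φ : ℤ → ℚ
    φ z = ∑∑ n λ i j → G i j z
    Td≤n : T ℕ.* suc d ℕ.≤ n
    Td≤n = ℕₚ.≤-trans (subst (T ℕ.* suc d ℕ.≤_) (lemma′ (B ℕ.+ ∣ as ∣₁) d T) (ℕₚ.m≤m+n (T ℕ.* suc d) _)) En≤
      where
      lemma′ : ∀ b d T → T ℕ.* suc d ℕ.+ 2 ℕ.* b ℕ.* suc d ℕ.* T ≡ (1 ℕ.+ 2 ℕ.* b) ℕ.* suc d ℕ.* T
      lemma′ = ℕ-Solver.solve-∀
    inner : ∀ {v} → v ∈ vecs (upTo T) k → ℕ→ℚ T ≤ φ (+ suc d ℤ.* dot as v)
    inner {v} v∈ = subst (ℕ→ℚ T ≤_)
      (∑∑-cong n λ i j → cong (λ z → 𝟙 (z ℤ.+ (a₀ ℤ.* val i ℤ.+ a₁ ℤ.* val j) ≟0)) (distrib (+ suc d) R (dot as v)))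
      (pair-count ε p q a₀ a₁ ε²≡1 a₀≡ a₁≡ (B ℕ.+ ∣ as ∣₁) n T (R ℤ.+ dot as v) En≤ (∣+∣≤ R (dot as v) B ∣ as ∣₁ T ∣R∣≤ (∣dot∣≤ as T v∈)))
      where
      distrib : ∀ d x y → d ℤ.* (x ℤ.+ y) ≡ d ℤ.* x ℤ.+ d ℤ.* y
      distrib = ℤ-Solver.solve-∀
many-solutions {suc k} (there {a₀ = a₀} {as} opp) = d , λ B → E B ℕ.+ suc d , bound B
  where
  d = proj₁ (many-solutions opp)
  E : ℕ → ℕ
  E B = proj₁ (proj₂ (many-solutions opp) (B ℕ.+ ℤ.∣ a₀ ∣))
  bound : ∀ B n T R → (E B ℕ.+ suc d) ℕ.* T ℕ.≤ n → ℤ.∣ R ∣ ℕ.≤ B ℕ.* T →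
    ℕ→ℚ (T ℕ.^ suc (suc k)) ≤ ∑ᵛ (upTo n) (3 ℕ.+ k) (λ v → 𝟙 (+ suc d ℤ.* R ℤ.+ dot (a₀ ∷ as) v ≟0))
  bound B n T R En≤ ∣R∣≤ = begin
    ℕ→ℚ (T ℕ.* T ℕ.^ suc k)
      ≡⟨ trans (ℕ→ℚ-* T (T ℕ.^ suc k)) (sym (∑<-const T (ℕ→ℚ (T ℕ.^ suc k)))) ⟩
    ∑< T (λ _ → ℕ→ℚ (T ℕ.^ suc k))
      ≤⟨ ∑-mono∈ (upTo T) inner ⟩
    ∑< T (G ∘ dilate d)
      ≤⟨ ∑<-dilate d T (λ i → 0≤∑ (vecs (upTo n) (2 ℕ.+ k)) λ v → 0≤𝟙 (+ suc d ℤ.* R ℤ.+ (a₀ ℤ.* val i ℤ.+ dot as v) ≟0)) Td≤n ⟩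
    ∑< n G
      ≡⟨ ∑ᵛ-suc (upTo n) (2 ℕ.+ k) (λ v → 𝟙 (+ suc d ℤ.* R ℤ.+ dot (a₀ ∷ as) v ≟0)) ⟨
    ∑ᵛ (upTo n) (3 ℕ.+ k) (λ v → 𝟙 (+ suc d ℤ.* R ℤ.+ dot (a₀ ∷ as) v ≟0)) ∎
    where
    open ℚₚ.≤-Reasoning
    G : ℕ → ℚ
    G i = ∑ᵛ (upTo n) (2 ℕ.+ k) λ v → 𝟙 (+ suc d ℤ.* R ℤ.+ (a₀ ℤ.* val i ℤ.+ dot as v) ≟0)
    Td≤n : T ℕ.* suc d ℕ.≤ n
    Td≤n = ℕₚ.≤-trans (ℕₚ.≤-trans (ℕₚ.≤-reflexive (ℕₚ.*-comm T (suc d))) (ℕₚ.*-monoˡ-≤ T (ℕₚ.m≤n+m (suc d) (E B)))) En≤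
    ET≤n : E B ℕ.* T ℕ.≤ n
    ET≤n = ℕₚ.≤-trans (ℕₚ.*-monoˡ-≤ T (ℕₚ.m≤m+n (E B) (suc d))) En≤
    lemma : ∀ d R a z w → d ℤ.* (R ℤ.+ a ℤ.* z) ℤ.+ w ≡ d ℤ.* R ℤ.+ (a ℤ.* (d ℤ.* z) ℤ.+ w)
    lemma = ℤ-Solver.solve-∀
    inner : ∀ {z} → z ∈ upTo T → ℕ→ℚ (T ℕ.^ suc k) ≤ G (dilate d z)
    inner {z} z∈ = subst (ℕ→ℚ (T ℕ.^ suc k) ≤_)
      (∑-cong (vecs (upTo n) (2 ℕ.+ k)) λ v → cong (λ y → 𝟙 (y ≟0)) (trans (lemma (+ suc d) R a₀ (val z) (dot as v))
        (cong (λ y → + suc d ℤ.* R ℤ.+ (a₀ ℤ.* y ℤ.+ dot as v)) (sym (val-dilate d z)))))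
      (proj₂ (proj₂ (many-solutions opp) (B ℕ.+ ℤ.∣ a₀ ∣)) n T (R ℤ.+ a₀ ℤ.* val z) ET≤n (∣+∣≤ R (a₀ ℤ.* val z) B ℤ.∣ a₀ ∣ T ∣R∣≤
        (subst (ℕ._≤ ℤ.∣ a₀ ∣ ℕ.* T) (sym (ℤₚ.∣i*j∣≡∣i∣*∣j∣ a₀ (val z))) (ℕₚ.*-monoʳ-≤ ℤ.∣ a₀ ∣ (∈-upTo⁻ z∈)))))

-- Only lengths n = (1 + E) T are covered, as infinitely many n suffice to refute commonness. Taking
-- 1 + E instead of E also ensures n ≥ T.
solutionCount-lower : ∀ {k} {a : Vec ℤ (2 ℕ.+ k)} → OppositeSigns a →
  ∃[ E ] ∀ T → ℕ→ℚ (T ℕ.^ suc k) ≤ solutionCount a (suc E ℕ.* T)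
solutionCount-lower {k} {a} opp = E , λ T → subst (ℕ→ℚ (T ℕ.^ suc k) ≤_)
  (trans (∑-cong (vecs (upTo (suc E ℕ.* T)) (2 ℕ.+ k)) λ v → cong (λ z → 𝟙 (z ≟0)) (trans (cong (ℤ._+ dot a v) (ℤₚ.*-zeroʳ (+ suc d))) (ℤₚ.+-identityˡ (dot a v))))
    (sym (solutionCount≡∑ a (suc E ℕ.* T))))
  (proj₂ (many 0) (suc E ℕ.* T) T 0ℤ (ℕₚ.*-monoˡ-≤ T (ℕₚ.n≤1+n E)) ℕ.z≤n)
  where
  d = proj₁ (many-solutions opp)
  many = proj₂ (many-solutions opp)
  E = proj₁ (many 0)

-- Asymptotic form of the criterion

-- The given error and the number of degenerate solutions are both of order at most n ^ suc k,
-- whereas K times the solution count reaches n ^ (2 + k). For large n half of η absorbs them.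
asymptotic-criterion : ∀ {k} (a : Vec ℤ (3 ℕ.+ k)) → NonzeroCoefficients a → ∀ r .{{_ : ℕ.NonZero r}} → 2 ℕ.≤ r →
  ∀ η → 0ℚ < η → η ≤ 1ℚ → ∀ K → 0ℚ < K → ∀ C → 0ℚ ≤ C →
  (∀ N → ∃[ n ] N ℕ.≤ n × ℕ→ℚ (n ℕ.^ (2 ℕ.+ k)) ≤ K * solutionCount a n ×
    ∃[ g ] (∀ i → ∣ g i ∣ ≤ 1ℚ) × twoColourSum a n g ≤ (2ℚ - η) * solutionCount a n + C * ℕ→ℚ (n ℕ.^ suc k)) →
  Uncommon r a
asymptotic-criterion {k} a a≢0 r 2≤r η 0<η η≤1 K 0<K C 0≤C estimate =
  uncommon-criterion a r 2≤r (η * ½) (0<* 0<η (ℚₚ.positive⁻¹ ½)) η½≤1 few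
  where
  P = ℕ→ℚ (r ℕ.^ (3 ℕ.+ k))
  degenerate = degenerate-bound a a≢0
  Cᵈ = proj₁ degenerate
  M = K * (C + P * Cᵈ)
  enough : ∃[ N ] M ≤ ℕ→ℚ N * (η * ½)
  enough = archimedean (η * ½) (0<* 0<η (ℚₚ.positive⁻¹ ½)) M
  η½≤1 : η * ½ ≤ 1ℚ
  η½≤1 = ≤-by (lemma η) (0≤+ (0≤- η≤1) (0≤* (ℚₚ.<⇒≤ 0<η) (ℚₚ.<⇒≤ (ℚₚ.positive⁻¹ ½))))
    where
    lemma : ∀ η → 1ℚ - η * ½ ≡ (1ℚ - η) + η * ½
    lemma = solve-∀ ℚ-ring
  few : ∀ N → ∃[ n ] N ℕ.≤ n × ∃[ g ] (∀ i → ∣ g i ∣ ≤ 1ℚ) ×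
    twoColourSum a n g + P * degenerateCount a n ≤ (2ℚ - η * ½) * solutionCount a n
  few N = n₀ , ℕₚ.≤-trans (ℕₚ.m≤m+n N N₁) N≤n , g , ∣g∣≤1 , (begin
    T + P * degenerateCount a n₀
      ≤⟨ ℚₚ.+-mono-≤ T≤ (*-monoˡ (0≤ℕ→ℚ (r ℕ.^ (3 ℕ.+ k))) (proj₂ (proj₂ degenerate) n₀)) ⟩
    ((2ℚ - η) * s + C * p) + P * (Cᵈ * p)
      ≡⟨ lemma₁ η s C p P Cᵈ ⟩
    (2ℚ - η) * s + (C + P * Cᵈ) * p
      ≤⟨ ℚₚ.+-monoʳ-≤ ((2ℚ - η) * s) error ⟩
    (2ℚ - η) * s + η * ½ * s
      ≡⟨ lemma₂ η s ⟩
    (2ℚ - η * ½) * s ∎)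
    where
    open ℚₚ.≤-Reasoning
    N₁ = proj₁ enough
    chosen = estimate (N ℕ.+ N₁)
    n₀ = proj₁ chosen
    N≤n = proj₁ (proj₂ chosen)
    n₀^≤ = proj₁ (proj₂ (proj₂ chosen))
    g = proj₁ (proj₂ (proj₂ (proj₂ chosen)))
    ∣g∣≤1 = proj₁ (proj₂ (proj₂ (proj₂ (proj₂ chosen))))
    T≤ = proj₂ (proj₂ (proj₂ (proj₂ (proj₂ chosen))))
    T = twoColourSum a n₀ g
    s = solutionCount a n₀
    p = ℕ→ℚ (n₀ ℕ.^ suc k)
    0≤p : 0ℚ ≤ p
    0≤p = 0≤ℕ→ℚ (n₀ ℕ.^ suc k)
    0≤η½ : 0ℚ ≤ η * ½
    0≤η½ = 0≤* (ℚₚ.<⇒≤ 0<η) (ℚₚ.<⇒≤ (ℚₚ.positive⁻¹ ½))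
    lemma₁ : ∀ η s C p P D → ((2ℚ - η) * s + C * p) + P * (D * p) ≡ (2ℚ - η) * s + (C + P * D) * p
    lemma₁ = solve-∀ ℚ-ring
    lemma₂ : ∀ η s → (2ℚ - η) * s + η * ½ * s ≡ (2ℚ - η * ½) * s
    lemma₂ = solve-∀ ℚ-ring
    lemma₃ : ∀ n h p → n * h * p ≡ h * (n * p)
    lemma₃ = solve-∀ ℚ-ring
    lemma₄ : ∀ h K s → h * (K * s) ≡ K * (h * s)
    lemma₄ = solve-∀ ℚ-ring
    error : (C + P * Cᵈ) * p ≤ η * ½ * s
    error = ℚₚ.*-cancelˡ-≤-pos K {{ℚ.positive 0<K}} (begin
      K * ((C + P * Cᵈ) * p)           ≡⟨ ℚₚ.*-assoc K (C + P * Cᵈ) p ⟨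
      M * p                            ≤⟨ *-monoʳ 0≤p (ℚₚ.≤-trans (proj₂ enough) (*-monoʳ 0≤η½ (ℕ→ℚ-mono-≤ (ℕₚ.≤-trans (ℕₚ.m≤n+m N₁ N) N≤n)))) ⟩
      ℕ→ℚ n₀ * (η * ½) * p              ≡⟨ trans (lemma₃ (ℕ→ℚ n₀) (η * ½) p) (cong (η * ½ *_) (sym (ℕ→ℚ-* n₀ (n₀ ℕ.^ suc k)))) ⟩
      η * ½ * ℕ→ℚ (n₀ ℕ.^ (2 ℕ.+ k))    ≤⟨ *-monoˡ 0≤η½ n₀^≤ ⟩
      η * ½ * (K * s)                  ≡⟨ lemma₄ (η * ½) K s ⟩
      K * (η * ½ * s)                  ∎)

-- Expansion of a product of sums of cosines

infixr 8 _^_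
_^_ : ℚ → ℕ → ℚ
p ^ zero  = 1ℚ
p ^ suc k = p * p ^ k

∏-const : ∀ {A : Set} (x : Vec A k) p → ∏ x (λ _ → p) ≡ p ^ k
∏-const []      p = refl
∏-const (_ ∷ x) p = cong (p *_) (∏-const x p)

onClass : ℕ → ℤ → ℤ
onClass b z = if does (ℤ.∣ z ∣ ℕₚ.≟ b) then z else 0ℤ

classSum : ℕ → Vec ℤ k → ℤ
classSum b []       = 0ℤ
classSum b (z ∷ zs) = onClass b z ℤ.+ classSum b zs

onClass-neg : ∀ b z → onClass b (ℤ.- z) ≡ ℤ.- onClass b z
onClass-neg b z rewrite ℤₚ.∣-i∣≡∣i∣ z with does (ℤ.∣ z ∣ ℕₚ.≟ b)
... | true  = refl
... | false = refl

-- The wave averages the cosines of frequencies a_l, those with |a_l| = b being shifted in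
-- phase by t a_l. A letter is a summand of 1 ± wave after each cosine is split into its two
-- exponentials, so that products of letters have slopes ± a_l.
module Expansion {m : ℕ} (a : Vec ℤ (suc m)) (b : ℕ) (t : ℤ) where

  ℓ = suc m

  Letter : Set
  Letter = Maybe (Bool × Fin ℓ)

  slope : Letter → ℤ
  slope nothing            = 0ℤ
  slope (just (true  , l)) = lookup a l
  slope (just (false , l)) = ℤ.- lookup a l

  h : ℚ
  h = ½ * (+ 1 ℚ./ ℓ)

  coefficient : ℚ → Letter → ℚ
  coefficient σ nothing  = 1ℚ
  coefficient σ (just _) = σ * h

  signedIndices : List (Bool × Fin ℓ)
  signedIndices = List.cartesianProduct (true ∷ false ∷ []) (allFin ℓ)

  letters : List Letter
  letters = nothing ∷ List.map just signedIndices

  angle : ℕ → Letter → ℤ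
  angle i λ′ = slope λ′ ℤ.* val i ℤ.+ t ℤ.* onClass b (slope λ′)

  wave : ℕ → ℚ
  wave i = ∑ (allFin ℓ) λ l → + 1 ℚ./ ℓ * cos (angle i (just (true , l)))

  ∣wave∣≤1 : ∀ i → ∣ wave i ∣ ≤ 1ℚ
  ∣wave∣≤1 i = begin
    ∣ wave i ∣
      ≤⟨ ∣∑∣≤∑∣∣ (allFin ℓ) (λ l → u * cos (angle i (just (true , l)))) ⟩
    ∑ (allFin ℓ) (λ l → ∣ u * cos (angle i (just (true , l))) ∣)
      ≤⟨ ∑-mono (allFin ℓ) (λ l → ℚₚ.≤-trans (ℚₚ.≤-reflexive (ℚₚ.∣p*q∣≡∣p∣*∣q∣ u (cos (angle i (just (true , l))))))
           (*-monoˡ (ℚₚ.0≤∣p∣ u) (∣cos∣≤1 (angle i (just (true , l)))))) ⟩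
    ∑ (allFin ℓ) (λ _ → ∣ u ∣ * 1ℚ)
      ≡⟨ trans (∑-const (allFin ℓ) (∣ u ∣ * 1ℚ)) (cong₂ _*_ (cong ℕ→ℚ (Listₚ.length-tabulate {n = ℓ} id)) (trans (ℚₚ.*-identityʳ ∣ u ∣) (ℚₚ.0≤p⇒∣p∣≡p 0≤u))) ⟩
    ℕ→ℚ ℓ * u
      ≡⟨ trans (ℚₚ.*-comm (ℕ→ℚ ℓ) u) (/-* (+ 1) ℓ) ⟩
    1ℚ ∎
    where
    open ℚₚ.≤-Reasoning
    u = + 1 ℚ./ ℓ
    0≤u : 0ℚ ≤ u
    0≤u = ℚₚ.nonNegative⁻¹ u {{ℚₚ.normalize-nonNeg 1 ℓ}}

  ∑-letters : ∀ (f : Letter → ℚ) → ∑ letters f ≡ f nothing + (∑ (allFin ℓ) (λ l → f (just (true , l))) + ∑ (allFin ℓ) (λ l → f (just (false , l))))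
  ∑-letters f = +-congˡ (f nothing) (trans (∑-map just signedIndices f)
    (trans (∑-cartesian _,_ (true ∷ false ∷ []) (allFin ℓ) (f ∘ just))
      (+-congˡ (∑ (allFin ℓ) λ l → f (just (true , l))) (ℚₚ.+-identityʳ (∑ (allFin ℓ) λ l → f (just (false , l)))))))

  -- The factor cos θ takes the place of a complex exponential: by the product formula each cosine
  -- of the wave moves θ up and down, which gives the two letters of its frequency.
  wave-expand : ∀ σ i θ → (1ℚ + σ * wave i) * cos θ ≡ ∑ letters λ λ′ → coefficient σ λ′ * cos (θ ℤ.+ angle i λ′)
  wave-expand σ i θ = sym (begin
    ∑ letters (λ λ′ → coefficient σ λ′ * cos (θ ℤ.+ angle i λ′))
      ≡⟨ ∑-letters (λ λ′ → coefficient σ λ′ * cos (θ ℤ.+ angle i λ′)) ⟩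
    1ℚ * cos (θ ℤ.+ angle i nothing) + (∑ (allFin ℓ) (λ l → σ * h * cos (θ ℤ.+ ω l)) + ∑ (allFin ℓ) (λ l → σ * h * cos (θ ℤ.+ angle i (just (false , l)))))
      ≡⟨ cong₂ _+_ (trans (ℚₚ.*-identityˡ (cos (θ ℤ.+ angle i nothing))) (cong cos constant)) (sym (∑-+ (allFin ℓ) (λ l → σ * h * cos (θ ℤ.+ ω l)) (λ l → σ * h * cos (θ ℤ.+ angle i (just (false , l)))))) ⟩
    cos θ + ∑ (allFin ℓ) (λ l → σ * h * cos (θ ℤ.+ ω l) + σ * h * cos (θ ℤ.+ angle i (just (false , l))))
      ≡⟨ +-congˡ (cos θ) (∑-cong (allFin ℓ) pointwise) ⟩
    cos θ + ∑ (allFin ℓ) (λ l → σ * cos θ * (u * cos (ω l)))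
      ≡⟨ +-congˡ (cos θ) (∑-*ˡ (allFin ℓ) (σ * cos θ) (λ l → u * cos (ω l))) ⟩
    cos θ + σ * cos θ * wave i
      ≡⟨ lemma₀ σ (wave i) (cos θ) ⟩
    (1ℚ + σ * wave i) * cos θ ∎)
    where
    open ≡-Reasoning
    u = + 1 ℚ./ ℓ
    ω : Fin ℓ → ℤ
    ω l = angle i (just (true , l))
    lemma₀ : ∀ σ g c → c + σ * c * g ≡ (1ℚ + σ * g) * c
    lemma₀ = solve-∀ ℚ-ring
    constant : θ ℤ.+ angle i nothing ≡ θ
    constant = trans (cong (λ z → θ ℤ.+ (0ℤ ℤ.* val i ℤ.+ t ℤ.* z)) (onClass-0 b)) (lemma θ (val i) t)
      where
      onClass-0 : ∀ b → onClass b 0ℤ ≡ 0ℤ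
      onClass-0 zero    = refl
      onClass-0 (suc b) = refl
      lemma : ∀ θ v t → θ ℤ.+ (0ℤ ℤ.* v ℤ.+ t ℤ.* 0ℤ) ≡ θ
      lemma = ℤ-Solver.solve-∀
    opposite : ∀ l → θ ℤ.+ angle i (just (false , l)) ≡ θ ℤ.- ω l
    opposite l = trans (cong (λ z → θ ℤ.+ (ℤ.- lookup a l ℤ.* val i ℤ.+ t ℤ.* z)) (onClass-neg b (lookup a l)))
      (lemma θ (lookup a l) (val i) t (onClass b (lookup a l)))
      where
      lemma : ∀ θ x v t z → θ ℤ.+ (ℤ.- x ℤ.* v ℤ.+ t ℤ.* ℤ.- z) ≡ θ ℤ.- (x ℤ.* v ℤ.+ t ℤ.* z)
      lemma = ℤ-Solver.solve-∀
    lemma₁ : ∀ σ u x y → σ * (½ * u) * x + σ * (½ * u) * y ≡ σ * u * ½ * (x + y)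
    lemma₁ = solve-∀ ℚ-ring
    lemma₂ : ∀ σ u x y → σ * u * ½ * (2ℚ * (x * y)) ≡ σ * x * (u * y)
    lemma₂ = solve-∀ ℚ-ring
    pointwise : ∀ l → σ * h * cos (θ ℤ.+ ω l) + σ * h * cos (θ ℤ.+ angle i (just (false , l))) ≡ σ * cos θ * (u * cos (ω l))
    pointwise l = begin
      σ * h * cos (θ ℤ.+ ω l) + σ * h * cos (θ ℤ.+ angle i (just (false , l)))
        ≡⟨ cong (λ z → σ * h * cos (θ ℤ.+ ω l) + σ * h * cos z) (opposite l) ⟩
      σ * h * cos (θ ℤ.+ ω l) + σ * h * cos (θ ℤ.- ω l)
        ≡⟨ lemma₁ σ u (cos (θ ℤ.+ ω l)) (cos (θ ℤ.- ω l)) ⟩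
      σ * u * ½ * (cos (θ ℤ.+ ω l) + cos (θ ℤ.- ω l))
        ≡⟨ cong (σ * u * ½ *_) (cos-product θ (ω l)) ⟩
      σ * u * ½ * (2ℚ * (cos θ * cos (ω l)))
        ≡⟨ lemma₂ σ u (cos θ) (cos (ω l)) ⟩
      σ * cos θ * (u * cos (ω l)) ∎

  slopes : Vec Letter k → Vec ℤ k
  slopes = Vec.map slope

  product-expand : ∀ σ (v : Vec ℕ k) θ → ∏ v (λ i → 1ℚ + σ * wave i) * cos θ ≡
    ∑ᵛ letters k λ τ → ∏ τ (coefficient σ) * cos (θ ℤ.+ (dot (slopes τ) v ℤ.+ t ℤ.* classSum b (slopes τ)))
  product-expand {zero} σ [] θ = trans (cong (λ z → 1ℚ * cos z) (lemma θ t)) (sym (ℚₚ.+-identityʳ _))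
    where
    lemma : ∀ θ t → θ ≡ θ ℤ.+ (0ℤ ℤ.+ t ℤ.* 0ℤ)
    lemma = ℤ-Solver.solve-∀
  product-expand {suc k} σ (i ∷ v) θ = begin
    (1ℚ + σ * wave i) * ∏ v (λ i → 1ℚ + σ * wave i) * cos θ
      ≡⟨ ℚₚ.*-assoc (1ℚ + σ * wave i) (∏ v (λ i → 1ℚ + σ * wave i)) (cos θ) ⟩
    (1ℚ + σ * wave i) * (∏ v (λ i → 1ℚ + σ * wave i) * cos θ)
      ≡⟨ cong ((1ℚ + σ * wave i) *_) (product-expand σ v θ) ⟩
    (1ℚ + σ * wave i) * ∑ᵛ letters k (λ τ → c τ * cos (θ ℤ.+ ω τ))
      ≡⟨ ∑-*ˡ (vecs letters k) (1ℚ + σ * wave i) (λ τ → c τ * cos (θ ℤ.+ ω τ)) ⟨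
    ∑ᵛ letters k (λ τ → (1ℚ + σ * wave i) * (c τ * cos (θ ℤ.+ ω τ)))
      ≡⟨ ∑-cong (vecs letters k) pointwise ⟩
    ∑ᵛ letters k (λ τ → ∑ letters λ λ′ → G (λ′ ∷ τ))
      ≡⟨ ∑-swap (vecs letters k) letters (λ τ λ′ → G (λ′ ∷ τ)) ⟩
    ∑ letters (λ λ′ → ∑ᵛ letters k λ τ → G (λ′ ∷ τ))
      ≡⟨ ∑ᵛ-suc letters k G ⟨
    ∑ᵛ letters (suc k) G ∎
    where
    open ≡-Reasoning
    c : Vec Letter k → ℚ
    c τ = ∏ τ (coefficient σ)
    ω : Vec Letter k → ℤ
    ω τ = dot (slopes τ) v ℤ.+ t ℤ.* classSum b (slopes τ)
    G : Vec Letter (suc k) → ℚ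
    G τ = ∏ τ (coefficient σ) * cos (θ ℤ.+ (dot (slopes τ) (i ∷ v) ℤ.+ t ℤ.* classSum b (slopes τ)))
    lemma₁ : ∀ x y z → x * (y * z) ≡ y * (x * z)
    lemma₁ = solve-∀ ℚ-ring
    lemma₂ : ∀ x y z → x * (y * z) ≡ y * x * z
    lemma₂ = solve-∀ ℚ-ring
    lemma₃ : ∀ θ d p s o t → θ ℤ.+ (d ℤ.+ t ℤ.* p) ℤ.+ (s ℤ.+ t ℤ.* o) ≡ θ ℤ.+ (s ℤ.+ d ℤ.+ t ℤ.* (o ℤ.+ p))
    lemma₃ = ℤ-Solver.solve-∀
    pointwise : ∀ τ → (1ℚ + σ * wave i) * (c τ * cos (θ ℤ.+ ω τ)) ≡ ∑ letters λ λ′ → G (λ′ ∷ τ)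
    pointwise τ = begin
      (1ℚ + σ * wave i) * (c τ * cos (θ ℤ.+ ω τ))
        ≡⟨ lemma₁ (1ℚ + σ * wave i) (c τ) (cos (θ ℤ.+ ω τ)) ⟩
      c τ * ((1ℚ + σ * wave i) * cos (θ ℤ.+ ω τ))
        ≡⟨ cong (c τ *_) (wave-expand σ i (θ ℤ.+ ω τ)) ⟩
      c τ * ∑ letters (λ λ′ → coefficient σ λ′ * cos (θ ℤ.+ ω τ ℤ.+ angle i λ′))
        ≡⟨ ∑-*ˡ letters (c τ) _ ⟨
      ∑ letters (λ λ′ → c τ * (coefficient σ λ′ * cos (θ ℤ.+ ω τ ℤ.+ angle i λ′)))
        ≡⟨ ∑-cong letters (λ λ′ → trans (lemma₂ (c τ) (coefficient σ λ′) _)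
             (cong (λ z → coefficient σ λ′ * c τ * cos z) (lemma₃ θ (dot (slopes τ) v) (classSum b (slopes τ)) (slope λ′ ℤ.* val i) (onClass b (slope λ′)) t))) ⟩
      ∑ letters (λ λ′ → G (λ′ ∷ τ)) ∎

  -- Equal to 2 h ^ j or 0 according to the parity of the number j of wave letters: odd words cancel
  -- between the two colours.
  evenPart : Vec Letter k → ℚ
  evenPart τ = ∏ τ (coefficient 1ℚ) + ∏ τ (coefficient (- 1ℚ))

  waveSum : Vec Letter ℓ → ℕ → ℚ
  waveSum τ n = ∑ᵛ (upTo n) ℓ λ v → cosKernel (0ℤ ℤ.+ dot a v) (t ℤ.* classSum b (slopes τ) ℤ.+ dot (slopes τ) v)

  twoColourSum-expand : ∀ n → twoColourSum a n wave ≡ ∑ᵛ letters ℓ λ τ → evenPart τ * waveSum τ n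
  twoColourSum-expand n = begin
    twoColourSum a n wave
      ≡⟨ ∑-solutions a n _ (λ v → ∏ v (λ i → 1ℚ + 1ℚ * wave i) + ∏ v (λ i → 1ℚ + - 1ℚ * wave i)) (λ x → cong₂ _+_
           (trans (∏-cong x λ i → lemma₁ (wave (toℕ i))) (sym (∏-map toℕ x (λ i → 1ℚ + 1ℚ * wave i))))
           (trans (∏-cong x λ i → lemma₂ (wave (toℕ i))) (sym (∏-map toℕ x (λ i → 1ℚ + - 1ℚ * wave i))))) ⟩
    ∑ᵛ (upTo n) ℓ (λ v → 𝟙 (dot a v ≟0) * (∏ v (λ i → 1ℚ + 1ℚ * wave i) + ∏ v (λ i → 1ℚ + - 1ℚ * wave i)))
      ≡⟨ ∑-cong (vecs (upTo n) ℓ) pointwise ⟩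
    ∑ᵛ (upTo n) ℓ (λ v → ∑ᵛ letters ℓ λ τ → evenPart τ * K τ v)
      ≡⟨ ∑-swap (vecs (upTo n) ℓ) (vecs letters ℓ) (λ v τ → evenPart τ * K τ v) ⟩
    ∑ᵛ letters ℓ (λ τ → ∑ᵛ (upTo n) ℓ λ v → evenPart τ * K τ v)
      ≡⟨ ∑-cong (vecs letters ℓ) (λ τ → ∑-*ˡ (vecs (upTo n) ℓ) (evenPart τ) (K τ)) ⟩
    ∑ᵛ letters ℓ (λ τ → evenPart τ * waveSum τ n) ∎
    where
    open ≡-Reasoning
    K : Vec Letter ℓ → Vec ℕ ℓ → ℚ
    K τ v = cosKernel (0ℤ ℤ.+ dot a v) (t ℤ.* classSum b (slopes τ) ℤ.+ dot (slopes τ) v)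
    lemma₁ : ∀ g → 1ℚ + g ≡ 1ℚ + 1ℚ * g
    lemma₁ = solve-∀ ℚ-ring
    lemma₂ : ∀ g → 1ℚ - g ≡ 1ℚ + - 1ℚ * g
    lemma₂ = solve-∀ ℚ-ring
    lemma₃ : ∀ d x y k → d * (x * k + y * k) ≡ (x + y) * (d * k)
    lemma₃ = solve-∀ ℚ-ring
    lemma₄ : ∀ p d → 0ℤ ℤ.+ (d ℤ.+ p) ≡ p ℤ.+ d
    lemma₄ = ℤ-Solver.solve-∀
    expand : ∀ σ v → ∏ v (λ i → 1ℚ + σ * wave i) ≡
      ∑ᵛ letters ℓ λ τ → ∏ τ (coefficient σ) * cos (0ℤ ℤ.+ (dot (slopes τ) v ℤ.+ t ℤ.* classSum b (slopes τ)))
    expand σ v = trans (sym (ℚₚ.*-identityʳ _)) (product-expand σ v 0ℤ)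
    pointwise : ∀ v → 𝟙 (dot a v ≟0) * (∏ v (λ i → 1ℚ + 1ℚ * wave i) + ∏ v (λ i → 1ℚ + - 1ℚ * wave i)) ≡ ∑ᵛ letters ℓ λ τ → evenPart τ * K τ v
    pointwise v = begin
      d * (∏ v (λ i → 1ℚ + 1ℚ * wave i) + ∏ v (λ i → 1ℚ + - 1ℚ * wave i))
        ≡⟨ cong (d *_) (trans (cong₂ _+_ (expand 1ℚ v) (expand (- 1ℚ) v)) (sym (∑-+ (vecs letters ℓ) _ _))) ⟩
      d * ∑ᵛ letters ℓ (λ τ → ∏ τ (coefficient 1ℚ) * cos (ω τ) + ∏ τ (coefficient (- 1ℚ)) * cos (ω τ))
        ≡⟨ ∑-*ˡ (vecs letters ℓ) d _ ⟨
      ∑ᵛ letters ℓ (λ τ → d * (∏ τ (coefficient 1ℚ) * cos (ω τ) + ∏ τ (coefficient (- 1ℚ)) * cos (ω τ)))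
        ≡⟨ ∑-cong (vecs letters ℓ) (λ τ → trans (lemma₃ d (∏ τ (coefficient 1ℚ)) (∏ τ (coefficient (- 1ℚ))) (cos (ω τ)))
             (cong₂ (λ x y → evenPart τ * (𝟙 (x ≟0) * cos y)) (sym (ℤₚ.+-identityˡ (dot a v))) (lemma₄ (t ℤ.* classSum b (slopes τ)) (dot (slopes τ) v)))) ⟩
      ∑ᵛ letters ℓ (λ τ → evenPart τ * K τ v) ∎
      where
      d = 𝟙 (dot a v ≟0)
      ω : Vec Letter ℓ → ℤ
      ω τ = 0ℤ ℤ.+ (dot (slopes τ) v ℤ.+ t ℤ.* classSum b (slopes τ))

  -- On solutions the form with the slopes of τ vanishes too, so the wave is constant there and only
  -- its phase is left.
  waveSum-proportional : NonzeroCoefficients a → ∀ τ → Proportional a (slopes τ) →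
    ∀ n → waveSum τ n ≡ cos (t ℤ.* classSum b (slopes τ)) * solutionCount a n
  waveSum-proportional a≢0 τ prop n = trans (∑-cong (vecs (upTo n) ℓ) λ v → pointwise v (dot a v ≟0))
    (trans (∑-*ˡ (vecs (upTo n) ℓ) (cos φ) (λ v → 𝟙 (dot a v ≟0))) (cong (cos φ *_) (sym (solutionCount≡∑ a n))))
    where
    φ = t ℤ.* classSum b (slopes τ)
    pointwise : ∀ v → Dec (dot a v ≡ 0ℤ) → cosKernel (0ℤ ℤ.+ dot a v) (φ ℤ.+ dot (slopes τ) v) ≡ cos φ * 𝟙 (dot a v ≟0)
    pointwise v (yes eq) = trans
      (cong₂ (λ x y → 𝟙 (x ≟0) * cos y) (ℤₚ.+-identityˡ (dot a v))
        (trans (cong (λ z → φ ℤ.+ z) (proportional-dot a (slopes τ) a≢0 prop v eq)) (ℤₚ.+-identityʳ φ)))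
      (ℚₚ.*-comm (𝟙 (dot a v ≟0)) (cos φ))
    pointwise v (no ne) = trans
      (trans (cong (_* cos (φ ℤ.+ dot (slopes τ) v)) (trans (cong (λ z → 𝟙 (z ≟0)) (ℤₚ.+-identityˡ (dot a v))) (𝟙-no (dot a v ≟0) ne)))
        (ℚₚ.*-zeroˡ (cos (φ ℤ.+ dot (slopes τ) v))))
      (sym (trans (cong (cos φ *_) (𝟙-no (dot a v ≟0) ne)) (ℚₚ.*-zeroʳ (cos φ))))

∣∣-≡ : ∀ x y → ℤ.∣ x ∣ ≡ ℤ.∣ y ∣ → x ≡ y ⊎ x ≡ ℤ.- y
∣∣-≡ (+ m)     (+ n)     eq   = inj₁ (cong +_ eq)
∣∣-≡ (+ m)     -[1+ n ]  refl = inj₂ refl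
∣∣-≡ -[1+ m ]  (+ suc n) refl = inj₂ refl
∣∣-≡ -[1+ m ]  -[1+ n ]  refl = inj₁ refl

if-yes : ∀ {A P : Set} (d : Dec P) → P → ∀ {x y : A} → (if does d then x else y) ≡ x
if-yes (yes _) p = refl
if-yes (no ¬p) p = ⊥-elim (¬p p)

if-no : ∀ {A P : Set} (d : Dec P) → ¬ P → ∀ {x y : A} → (if does d then x else y) ≡ y
if-no (yes p) ¬p = ⊥-elim (¬p p)
if-no (no _)  ¬p = refl

onClass-≡ : ∀ {b} z → ℤ.∣ z ∣ ≡ b → onClass b z ≡ z
onClass-≡ {b} z eq = if-yes (ℤ.∣ z ∣ ℕₚ.≟ b) eq

onClass-≢ : ∀ {b} z → ℤ.∣ z ∣ ≢ b → onClass b z ≡ 0ℤ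
onClass-≢ {b} z ne = if-no (ℤ.∣ z ∣ ℕₚ.≟ b) ne

-- Canceling partitions

module Canceling {k : ℕ} (a : Vec ℤ k) (a≢0 : NonzeroCoefficients a) where

  indexSum : ℕ → List (Fin k) → ℤ
  indexSum b []       = 0ℤ
  indexSum b (i ∷ is) = onClass b (lookup a i) ℤ.+ indexSum b is

  indexSum-middle : ∀ b j is js →
    indexSum b (is ++ j ∷ js) ≡ onClass b (lookup a j) ℤ.+ indexSum b (is ++ js)
  indexSum-middle b j []       js = refl
  indexSum-middle b j (i ∷ is) js = trans (cong (λ z → onClass b (lookup a i) ℤ.+ z) (indexSum-middle b j is js))
    (lemma (onClass b (lookup a i)) (onClass b (lookup a j)) (indexSum b (is ++ js)))
    where
    lemma : ∀ x y z → x ℤ.+ (y ℤ.+ z) ≡ y ℤ.+ (x ℤ.+ z)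
    lemma = ℤ-Solver.solve-∀

  -- Without a partner -aᵢ in the list, all entries of absolute value |aᵢ| equal aᵢ and cannot
  -- cancel.
  class-multiple : ∀ i is → ¬ Any.Any (λ j → lookup a j ≡ ℤ.- lookup a i) is →
    ∃[ m ] indexSum ℤ.∣ lookup a i ∣ is ≡ + m ℤ.* lookup a i
  class-multiple i []       none = 0 , refl
  class-multiple i (j ∷ is) none with class-multiple i is (none ∘ there)
  ... | m , eq with ℤ.∣ lookup a j ∣ ℕₚ.≟ ℤ.∣ lookup a i ∣
  ...   | no  ne   = m , trans (cong₂ ℤ._+_ (onClass-≢ (lookup a j) ne) eq) (ℤₚ.+-identityˡ _)
  ...   | yes same with ∣∣-≡ (lookup a j) (lookup a i) same
  ...     | inj₂ aⱼ≡-aᵢ = ⊥-elim (none (here aⱼ≡-aᵢ))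
  ...     | inj₁ aⱼ≡aᵢ  = suc m , trans (cong₂ ℤ._+_ (trans (onClass-≡ (lookup a j) same) aⱼ≡aᵢ) eq) (lemma (+ m) (lookup a i))
    where
    lemma : ∀ m x → x ℤ.+ m ℤ.* x ≡ (+ 1 ℤ.+ m) ℤ.* x
    lemma = ℤ-Solver.solve-∀

  Partition : List (Fin k) → Set
  Partition is = Σ[ ps ∈ List (Fin k × Fin k) ]
    (concatMap (λ (i , j) → i ∷ j ∷ []) ps ↭ is) × All (λ (i , j) → lookup a i ℤ.+ lookup a j ≡ 0ℤ) ps

  -- Greedy pairing: the class sum of the first index vanishes, so it has a partner, and removing
  -- both leaves all class sums at 0. The bound m on the length carries the recursion, because the
  -- partner is taken from the middle of the list.
  partition : ∀ m is → length is ℕ.≤ m → (∀ l → indexSum ℤ.∣ lookup a l ∣ is ≡ 0ℤ) → Partition is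
  partition m       []       _        _    = [] , ↭.refl , []
  partition (suc m) (i ∷ is) (ℕ.s≤s len) zeros =
    find (Any.any? (λ j → lookup a j ℤₚ.≟ ℤ.- lookup a i) is)
    where
    aᵢ = lookup a i
    find : Dec (Any.Any (λ j → lookup a j ≡ ℤ.- lookup a i) is) → Partition (i ∷ is)
    find (no none) = ⊥-elim (case ℤₚ.i*j≡0⇒i≡0∨j≡0 (+ suc (proj₁ multiple)) zero-multiple of λ where
        (inj₁ ())
        (inj₂ aᵢ≡0) → a≢0 i aᵢ≡0)
      where
      multiple = class-multiple i is none
      lemma : ∀ m x → (+ 1 ℤ.+ m) ℤ.* x ≡ x ℤ.+ m ℤ.* x
      lemma = ℤ-Solver.solve-∀
      zero-multiple : + suc (proj₁ multiple) ℤ.* aᵢ ≡ 0ℤ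
      zero-multiple = trans (lemma (+ proj₁ multiple) aᵢ)
        (trans (cong₂ ℤ._+_ (sym (onClass-≡ aᵢ refl)) (sym (proj₂ multiple))) (zeros i))
    find (yes found) = pair (∈ₚ.∈-∃++ (proj₁ (proj₂ located)))
      where
      located : ∃[ j ] j ∈ is × lookup a j ≡ ℤ.- aᵢ
      located = find-∈ found
        where
        find-∈ : ∀ {js} → Any.Any (λ j → lookup a j ≡ ℤ.- aᵢ) js → ∃[ j ] j ∈ js × lookup a j ≡ ℤ.- aᵢ
        find-∈ (here eq)  = _ , here refl , eq
        find-∈ (there js) with find-∈ js
        ... | j , j∈ , eq = j , there j∈ , eq
      j = proj₁ located
      pair : (∃[ xs ] ∃[ ys ] is ≡ xs ++ j ∷ ys) → Partition (i ∷ is)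
      pair (xs , ys , is≡) =
        let ps , perm , cancel = partition m (xs ++ ys) shorter rest-zero in
        (i , j) ∷ ps , ↭.prep i (↭.trans (↭.prep j perm) (↭.trans (↭.↭-sym (↭ₚ.shift j xs ys)) (↭.↭-reflexive (sym is≡)))) ,
        trans (cong (λ z → aᵢ ℤ.+ z) (proj₂ (proj₂ located))) (ℤₚ.+-inverseʳ aᵢ) ∷ cancel
        where
        shorter : length (xs ++ ys) ℕ.≤ m
        shorter = ℕₚ.≤-trans (ℕₚ.n≤1+n (length (xs ++ ys))) (ℕₚ.≤-trans (ℕₚ.≤-reflexive (trans (sym (↭ₚ.↭-length (↭ₚ.shift j xs ys))) (cong length (sym is≡)))) len)
        rest-zero : ∀ l → indexSum ℤ.∣ lookup a l ∣ (xs ++ ys) ≡ 0ℤ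
        rest-zero l = trans (lemma (onClass b aᵢ) (indexSum b (xs ++ ys)))
          (trans (cong (λ z → onClass b aᵢ ℤ.+ (z ℤ.+ indexSum b (xs ++ ys)))
                   (sym (trans (cong (onClass b) (proj₂ (proj₂ located))) (onClass-neg b aᵢ))))
          (trans (cong (λ z → onClass b aᵢ ℤ.+ z) (trans (sym (indexSum-middle b j xs ys)) (cong (indexSum b) (sym is≡)))) (zeros l)))
          where
          b = ℤ.∣ lookup a l ∣
          lemma : ∀ x y → y ≡ x ℤ.+ (ℤ.- x ℤ.+ y)
          lemma = ℤ-Solver.solve-∀

  unbalanced-class : ¬ HasCancelingPartition a → ∃[ l ] indexSum ℤ.∣ lookup a l ∣ (allFin k) ≢ 0ℤ
  unbalanced-class ¬partition = find (Finₚ.any? λ l → ¬? (indexSum ℤ.∣ lookup a l ∣ (allFin k) ℤₚ.≟ 0ℤ))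
    where
    find : Dec (∃[ l ] indexSum ℤ.∣ lookup a l ∣ (allFin k) ≢ 0ℤ) → ∃[ l ] indexSum ℤ.∣ lookup a l ∣ (allFin k) ≢ 0ℤ
    find (yes found) = found
    find (no none)   = ⊥-elim (¬partition (partition _ (allFin k) ℕₚ.≤-refl λ l →
      decidable-stable (indexSum ℤ.∣ lookup a l ∣ (allFin k) ℤₚ.≟ 0ℤ) λ ne → none (l , ne)))

  indexSum-allFin : ∀ b → indexSum b (allFin k) ≡ classSum b a
  indexSum-allFin b = go a id (λ _ → refl)
    where
    go : ∀ {j} (c : Vec ℤ j) (ι : Fin j → Fin k) → (∀ i → lookup a (ι i) ≡ lookup c i) → indexSum b (tabulate ι) ≡ classSum b c
    go []      ι eq = refl
    go (c ∷ cs) ι eq = cong₂ ℤ._+_ (cong (onClass b) (eq Fin.zero)) (go cs (ι ∘ Fin.suc) (eq ∘ Fin.suc))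

-- Frequencies proportional to the coefficients

-- The ratio |bⱼ| / |aⱼ| does not depend on j. At the largest |a| it is at most 1 and at the
-- smallest at least 1, because every |b| is one of the |a|.
proportional-∣∣ : ∀ {k} (a b : Vec ℤ (suc k)) → NonzeroCoefficients a → Proportional a b →
  (∀ j → ∃[ l ] ℤ.∣ lookup b j ∣ ≡ ℤ.∣ lookup a l ∣) → ∀ j → ℤ.∣ lookup b j ∣ ≡ ℤ.∣ lookup a j ∣
proportional-∣∣ {k} a b a≢0 prop values j = ℕₚ.≤-antisym upper lower
  where
  A : Fin (suc k) → ℕ
  A i = ℤ.∣ lookup a i ∣
  B : Fin (suc k) → ℕ
  B i = ℤ.∣ lookup b i ∣
  cross : ∀ i → A i ℕ.* B j ≡ A j ℕ.* B i
  cross i = trans (sym (ℤₚ.∣i*j∣≡∣i∣*∣j∣ (lookup a i) (lookup b j)))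
    (trans (cong ℤ.∣_∣ (prop i j)) (ℤₚ.∣i*j∣≡∣i∣*∣j∣ (lookup a j) (lookup b i)))
  instance
    A≢0 : ∀ {i} → ℕ.NonZero (A i)
    A≢0 {i} = ℕ.≢-nonZero (a≢0 i ∘ ℤₚ.∣i∣≡0⇒i≡0)
  M = Extremaℕ.argmax A Fin.zero (allFin (suc k))
  m = Extremaℕ.argmin A Fin.zero (allFin (suc k))
  A≤M : ∀ l → A l ℕ.≤ A M
  A≤M l = All.lookup (Extremaℕ.f[xs]≤f[argmax] {f = A} Fin.zero (allFin (suc k))) (∈-allFin l)
  m≤A : ∀ l → A m ℕ.≤ A l
  m≤A l = All.lookup (Extremaℕ.f[argmin]≤f[xs] {f = A} Fin.zero (allFin (suc k))) (∈-allFin l)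
  upper : B j ℕ.≤ A j
  upper = ℕₚ.*-cancelˡ-≤ (A M) (ℕₚ.≤-trans (ℕₚ.≤-reflexive (cross M))
    (ℕₚ.≤-trans (ℕₚ.*-monoʳ-≤ (A j) (subst (ℕ._≤ A M) (sym (proj₂ (values M))) (A≤M _))) (ℕₚ.≤-reflexive (ℕₚ.*-comm (A j) (A M)))))
  lower : A j ℕ.≤ B j
  lower = ℕₚ.*-cancelˡ-≤ (A m) (ℕₚ.≤-trans (ℕₚ.≤-reflexive (ℕₚ.*-comm (A m) (A j)))
    (ℕₚ.≤-trans (ℕₚ.*-monoʳ-≤ (A j) (subst (A m ℕ.≤_) (sym (proj₂ (values m))) (m≤A _))) (ℕₚ.≤-reflexive (sym (cross m)))))

-- Equal absolute values make `onClass` select the same positions in both vectors.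
classSum-scale : ∀ c p q (a b : Vec ℤ k) → (∀ j → p ℤ.* lookup b j ≡ q ℤ.* lookup a j) →
  (∀ j → ℤ.∣ lookup b j ∣ ≡ ℤ.∣ lookup a j ∣) → p ℤ.* classSum c b ≡ q ℤ.* classSum c a
classSum-scale c p q []       []       eq same = trans (ℤₚ.*-zeroʳ p) (sym (ℤₚ.*-zeroʳ q))
classSum-scale c p q (x ∷ xs) (y ∷ ys) eq same = trans (ℤₚ.*-distribˡ-+ p (onClass c y) (classSum c ys))
  (trans (cong₂ ℤ._+_ head (classSum-scale c p q xs ys (eq ∘ Fin.suc) (same ∘ Fin.suc)))
    (sym (ℤₚ.*-distribˡ-+ q (onClass c x) (classSum c xs))))
  where
  head : p ℤ.* onClass c y ≡ q ℤ.* onClass c x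
  head rewrite same Fin.zero with does (ℤ.∣ x ∣ ℕₚ.≟ c)
  ... | true  = eq Fin.zero
  ... | false = trans (ℤₚ.*-zeroʳ p) (sym (ℤₚ.*-zeroʳ q))

∣classSum∣-proportional : ∀ {k} c (a b : Vec ℤ (suc k)) → NonzeroCoefficients a → Proportional a b →
  (∀ j → ℤ.∣ lookup b j ∣ ≡ ℤ.∣ lookup a j ∣) → ℤ.∣ classSum c b ∣ ≡ ℤ.∣ classSum c a ∣
∣classSum∣-proportional c a b a≢0 prop same = ℕₚ.*-cancelˡ-≡ _ _ ℤ.∣ a₀ ∣ {{ℕ.≢-nonZero (a≢0 Fin.zero ∘ ℤₚ.∣i∣≡0⇒i≡0)}} (begin
  ℤ.∣ a₀ ∣ ℕ.* ℤ.∣ classSum c b ∣     ≡⟨ ℤₚ.∣i*j∣≡∣i∣*∣j∣ a₀ (classSum c b) ⟨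
  ℤ.∣ a₀ ℤ.* classSum c b ∣           ≡⟨ cong ℤ.∣_∣ (classSum-scale c a₀ b₀ a b (λ j → trans (prop Fin.zero j) (ℤₚ.*-comm (lookup a j) b₀)) same) ⟩
  ℤ.∣ b₀ ℤ.* classSum c a ∣           ≡⟨ ℤₚ.∣i*j∣≡∣i∣*∣j∣ b₀ (classSum c a) ⟩
  ℤ.∣ b₀ ∣ ℕ.* ℤ.∣ classSum c a ∣     ≡⟨ cong (ℕ._* ℤ.∣ classSum c a ∣) (same Fin.zero) ⟩
  ℤ.∣ a₀ ∣ ℕ.* ℤ.∣ classSum c a ∣     ∎)
  where
  open ≡-Reasoning
  a₀ = lookup a Fin.zero
  b₀ = lookup b Fin.zero

-- Estimate of the two-colour sum of the wave

^-mono-half : ∀ p k → 0ℚ ≤ p → p ≤ ½ → (0ℚ ≤ p ^ k) × (p ^ suc k ≤ ½)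
^-mono-half p zero    0≤p p≤½ = 0≤1 , subst (_≤ ½) (sym (ℚₚ.*-identityʳ p)) p≤½
^-mono-half p (suc k) 0≤p p≤½ with ^-mono-half p k 0≤p p≤½
... | 0≤ , ≤½ = 0≤* 0≤p 0≤ , (begin
  p * (p * p ^ k)     ≤⟨ *-monoˡ 0≤p ≤½ ⟩
  p * ½               ≤⟨ *-monoʳ (ℚₚ.<⇒≤ (ℚₚ.positive⁻¹ ½)) p≤½ ⟩
  ½ * ½               ≤⟨ ≤-by {½ * ½} {½} {½ * ½} refl (ℚₚ.<⇒≤ (ℚₚ.positive⁻¹ (½ * ½))) ⟩
  ½                   ∎)
  where open ℚₚ.≤-Reasoning

0<^ : ∀ {p} k → 0ℚ < p → 0ℚ < p ^ k
0<^ zero    0<p = ℚₚ.positive⁻¹ 1ℚ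
0<^ (suc k) 0<p = 0<* 0<p (0<^ k 0<p)

^-even : ∀ p m → p ^ (2 ℕ.* m) ≡ (p * p) ^ m
^-even p zero    = refl
^-even p (suc m) = trans (cong (p ^_) (cong suc (ℕₚ.+-suc m (m ℕ.+ 0))))
  (trans (cong (λ y → p * (p * y)) (^-even p m)) (sym (ℚₚ.*-assoc p p ((p * p) ^ m))))

*-^ : ∀ m n k → (m ℕ.* n) ℕ.^ k ≡ m ℕ.^ k ℕ.* n ℕ.^ k
*-^ m n zero    = refl
*-^ m n (suc k) = trans (cong (m ℕ.* n ℕ.*_) (*-^ m n k)) (lemma m n (m ℕ.^ k) (n ℕ.^ k))
  where
  lemma : ∀ m n x y → m ℕ.* n ℕ.* (x ℕ.* y) ≡ m ℕ.* x ℕ.* (n ℕ.* y)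
  lemma = ℕ-Solver.solve-∀

vecs-unique : ∀ {A : Set} {xs : List A} → Unique xs → ∀ k → Unique (vecs xs k)
vecs-unique xs! zero    = [] ∷ []
vecs-unique xs! (suc k) = Uniqueₚ.cartesianProductWith⁺ _∷_ (λ eq → Vecₚ.∷-injective eq) xs! (vecs-unique xs! k)

∈-vecs : ∀ {A : Set} {xs : List A} → (∀ x → x ∈ xs) → ∀ {k} (v : Vec A k) → v ∈ vecs xs k
∈-vecs all []      = here refl
∈-vecs all (x ∷ v) = ∈ₚ.∈-cartesianProductWith⁺ _∷_ (all x) (∈-vecs all v)

module UnbalancedClass {k m : ℕ} (a : Vec ℤ (3 ℕ.+ k)) (even : 3 ℕ.+ k ≡ 2 ℕ.* m) (a≢0 : NonzeroCoefficients a)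
  (b : ℕ) (t : ℤ) (c<0 : cos (t ℤ.* classSum b a) < 0ℚ) where

  open Expansion a b t

  cA : ℚ
  cA = cos (t ℤ.* classSum b a)

  _≟ˡ_ : (x y : Letter) → Dec (x ≡ y)
  _≟ˡ_ = Maybeₚ.≡-dec (Productₚ.≡-dec Boolₚ._≟_ Finₚ._≟_)

  _≟ᵛ_ : (σ τ : Vec Letter ℓ) → Dec (σ ≡ τ)
  _≟ᵛ_ = Vecₚ.≡-dec _≟ˡ_

  letters-unique : Unique letters
  letters-unique = All.tabulate (λ {y} y∈ eq → nothing∉ (subst (_∈ List.map just signedIndices) (sym eq) y∈)) ∷
    Uniqueₚ.map⁺ Maybeₚ.just-injective (Uniqueₚ.cartesianProduct⁺ (((λ ()) ∷ []) ∷ [] ∷ []) (allFin⁺ ℓ))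
    where
    nothing∉ : nothing ∉ List.map just signedIndices
    nothing∉ n∈ with ∈ₚ.∈-map⁻ just n∈
    ... | _ , _ , ()

  ∈-letters : ∀ x → x ∈ letters
  ∈-letters nothing            = here refl
  ∈-letters (just (true  , l)) = there (∈ₚ.∈-map⁺ just (∈ₚ.∈-cartesianProduct⁺ {xs = true ∷ false ∷ []} {ys = allFin ℓ} (here refl) (∈-allFin l)))
  ∈-letters (just (false , l)) = there (∈ₚ.∈-map⁺ just (∈ₚ.∈-cartesianProduct⁺ {xs = true ∷ false ∷ []} {ys = allFin ℓ} (there (here refl)) (∈-allFin l)))

  -- The words that decide the estimate: `constant` has slopes 0 and gives the main term 2,
  -- `diagonal` has the slopes a themselves and gives the negative term.
  constant diagonal : Vec Letter ℓ
  constant = Vec.replicate ℓ nothing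
  diagonal = Vec.tabulate λ l → just (true , l)

  0<h : 0ℚ < h
  0<h = 0<* (ℚₚ.positive⁻¹ ½) (ℚₚ.positive⁻¹ (+ 1 ℚ./ ℓ) {{ℚₚ.normalize-pos 1 ℓ}})

  h≤½ : h ≤ ½
  h≤½ = subst (h ≤_) (ℚₚ.*-identityʳ ½) (*-monoˡ (ℚₚ.<⇒≤ (ℚₚ.positive⁻¹ ½)) u≤1)
    where
    u = + 1 ℚ./ ℓ
    u≤1 : u ≤ 1ℚ
    u≤1 = subst₂ _≤_ (ℚₚ.*-identityʳ u) (/-* (+ 1) ℓ)
      (*-monoˡ (ℚₚ.nonNegative⁻¹ u {{ℚₚ.normalize-nonNeg 1 ℓ}}) (ℕ→ℚ-mono-≤ {1} {ℓ} (ℕ.s≤s ℕ.z≤n)))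

  Full : ∀ {j} → Vec Letter j → Set
  Full τ = ∀ j → ∃[ y ] lookup τ j ≡ just y

  full-coefficient : ∀ {k} σ (τ : Vec Letter k) → Full τ → ∏ τ (coefficient σ) ≡ (σ * h) ^ k
  full-coefficient σ []      full = refl
  full-coefficient σ (x ∷ τ) full = cong₂ _*_ (cong (coefficient σ) (proj₂ (full Fin.zero))) (full-coefficient σ τ (full ∘ Fin.suc))

  evenPart-full : ∀ (τ : Vec Letter ℓ) → Full τ → evenPart τ ≡ 2ℚ * h ^ ℓ
  evenPart-full τ full = trans (cong₂ _+_ (trans (full-coefficient 1ℚ τ full) (cong (_^ ℓ) (ℚₚ.*-identityˡ h)))
      (trans (full-coefficient (- 1ℚ) τ full) flip))
    (lemma (h ^ ℓ))
    where
    lemma : ∀ x → x + x ≡ 2ℚ * x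
    lemma = solve-∀ ℚ-ring
    square : ∀ h → (- 1ℚ * h) * (- 1ℚ * h) ≡ h * h
    square = solve-∀ ℚ-ring
    -- The length is even, so the signs disappear; otherwise these words would cancel between the
    -- colours.
    flip : (- 1ℚ * h) ^ ℓ ≡ h ^ ℓ
    flip = trans (cong ((- 1ℚ * h) ^_) even) (trans (^-even (- 1ℚ * h) m)
      (trans (cong (_^ m) (square h)) (trans (sym (^-even h m)) (cong (h ^_) (sym even)))))

  -- The saving from `diagonal` alone: 2 h ^ ℓ is the `evenPart` of a word without `nothing`.
  η : ℚ
  η = 2ℚ * h ^ ℓ * (0ℚ - cA)

  0<η : 0ℚ < η
  0<η = 0<* (0<* (ℚₚ.positive⁻¹ 2ℚ) (0<^ ℓ 0<h)) (0<- c<0)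

  η≤1 : η ≤ 1ℚ
  η≤1 = begin
    2ℚ * h ^ ℓ * (0ℚ - cA)
      ≤⟨ *-mono {q = 1ℚ} 0≤1 (0≤- (ℚₚ.<⇒≤ c<0)) 2h≤1 -c≤1 ⟩
    1ℚ * 1ℚ
      ≡⟨ ℚₚ.*-identityʳ 1ℚ ⟩
    1ℚ ∎
    where
    open ℚₚ.≤-Reasoning
    2h≤1 : 2ℚ * h ^ ℓ ≤ 1ℚ
    2h≤1 = *-monoˡ {2ℚ} {h ^ ℓ} {½} (0≤ℕ→ℚ 2) (proj₂ (^-mono-half h (2 ℕ.+ k) (ℚₚ.<⇒≤ 0<h) h≤½))
    -c≤1 : 0ℚ - cA ≤ 1ℚ
    -c≤1 = ≤-by (lemma cA) (0≤- (∣p∣≤⇒-≤ (∣cos∣≤1 (t ℤ.* classSum b a))))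
      where
      lemma : ∀ c → 1ℚ - (0ℚ - c) ≡ c - - 1ℚ
      lemma = solve-∀ ℚ-ring

  evenPart-constant : evenPart constant ≡ 2ℚ
  evenPart-constant = cong₂ _+_ (ones 1ℚ ℓ) (ones (- 1ℚ) ℓ)
    where
    ones : ∀ σ k → ∏ (Vec.replicate k nothing) (coefficient σ) ≡ 1ℚ
    ones σ zero    = refl
    ones σ (suc k) = trans (ℚₚ.*-identityˡ _) (ones σ k)

  slopes-constant : ∀ j → lookup (slopes constant) j ≡ 0ℤ
  slopes-constant j = trans (Vecₚ.lookup-map j slope constant) (cong slope (Vecₚ.lookup-replicate j nothing))

  proportional-constant : Proportional a (slopes constant)
  proportional-constant i j = trans (cong (lookup a i ℤ.*_) (slopes-constant j)) (trans (ℤₚ.*-zeroʳ (lookup a i))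
    (sym (trans (cong (lookup a j ℤ.*_) (slopes-constant i)) (ℤₚ.*-zeroʳ (lookup a j)))))

  classSum-constant : classSum b (slopes constant) ≡ 0ℤ
  classSum-constant = zeros (slopes constant) slopes-constant
    where
    onClass-0 : ∀ b → onClass b 0ℤ ≡ 0ℤ
    onClass-0 zero    = refl
    onClass-0 (suc b) = refl
    zeros : ∀ {k} (v : Vec ℤ k) → (∀ j → lookup v j ≡ 0ℤ) → classSum b v ≡ 0ℤ
    zeros []      eq = refl
    zeros (z ∷ v) eq = cong₂ ℤ._+_ (trans (cong (onClass b) (eq Fin.zero)) (onClass-0 b)) (zeros v (eq ∘ Fin.suc))

  slopes-diagonal : slopes diagonal ≡ a
  slopes-diagonal = trans (sym (Vecₚ.tabulate-∘ slope (λ l → just (true , l)))) (Vecₚ.tabulate∘lookup a)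

  full-diagonal : Full diagonal
  full-diagonal j = (true , j) , Vecₚ.lookup∘tabulate (λ l → just (true , l)) j

  ∣slope∣ : ∀ y → ∃[ l ] ℤ.∣ slope (just y) ∣ ≡ ℤ.∣ lookup a l ∣
  ∣slope∣ (true  , l) = l , refl
  ∣slope∣ (false , l) = l , ℤₚ.∣-i∣≡∣i∣ (lookup a l)

  -- A letter `nothing` has slope 0, and proportionality to a vector without zero entries spreads
  -- this to all slopes, hence to all letters.
  constant-or-full : ∀ τ → Proportional a (slopes τ) → τ ≡ constant ⊎ Full τ
  constant-or-full τ prop = go (Finₚ.any? λ j → lookup τ j ≟ˡ nothing)
    where
    slope≡0 : ∀ x → slope x ≡ 0ℤ → x ≡ nothing
    slope≡0 nothing            _  = refl
    slope≡0 (just (true  , l)) eq = ⊥-elim (a≢0 l eq)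
    slope≡0 (just (false , l)) eq = ⊥-elim (a≢0 l (ℤₚ.neg-injective {lookup a l} {0ℤ} eq))
    go : Dec (∃[ j ] lookup τ j ≡ nothing) → τ ≡ constant ⊎ Full τ
    go (yes (i , τᵢ≡nothing)) = inj₁ (all-nothing τ λ j → slope≡0 (lookup τ j) (slopeⱼ≡0 j))
      where
      all-nothing : ∀ {k} (τ : Vec Letter k) → (∀ j → lookup τ j ≡ nothing) → τ ≡ Vec.replicate k nothing
      all-nothing []      eq = refl
      all-nothing (x ∷ τ) eq = cong₂ _∷_ (eq Fin.zero) (all-nothing τ (eq ∘ Fin.suc))
      slopeᵢ≡0 : lookup (slopes τ) i ≡ 0ℤ
      slopeᵢ≡0 = trans (Vecₚ.lookup-map i slope τ) (cong slope τᵢ≡nothing)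
      slopeⱼ≡0 : ∀ j → slope (lookup τ j) ≡ 0ℤ
      slopeⱼ≡0 j = trans (sym (Vecₚ.lookup-map j slope τ))
        (ℤₚ.*-cancelˡ-≡ (lookup a i) _ _ {{ℤ.≢-nonZero (a≢0 i)}}
          (trans (prop i j) (trans (cong (lookup a j ℤ.*_) slopeᵢ≡0) (trans (ℤₚ.*-zeroʳ (lookup a j)) (sym (ℤₚ.*-zeroʳ (lookup a i)))))))
    go (no none) = inj₂ λ j → just-of (lookup τ j) refl (λ eq → none (j , eq))
      where
      just-of : ∀ x {y} → x ≡ y → y ≢ nothing → ∃[ z ] x ≡ just z
      just-of nothing  refl ne = ⊥-elim (ne refl)
      just-of (just z) refl ne = z , refl

  -- Such slopes are proportional to a with the same absolute values, so their class sum is plus or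
  -- minus that of a, and cosine is even.
  full-cos : ∀ τ → Proportional a (slopes τ) → Full τ → cos (t ℤ.* classSum b (slopes τ)) ≡ cA
  full-cos τ prop full = cong cosℕ (trans (ℤₚ.∣i*j∣≡∣i∣*∣j∣ t (classSum b (slopes τ)))
    (trans (cong (ℤ.∣ t ∣ ℕ.*_) (∣classSum∣-proportional b a (slopes τ) a≢0 prop (proportional-∣∣ a (slopes τ) a≢0 prop values)))
      (sym (ℤₚ.∣i*j∣≡∣i∣*∣j∣ t (classSum b a)))))
    where
    values : ∀ j → ∃[ l ] ℤ.∣ lookup (slopes τ) j ∣ ≡ ℤ.∣ lookup a l ∣
    values j = let y , eq = full j ; l , eq′ = ∣slope∣ y in
      l , trans (cong ℤ.∣_∣ (trans (Vecₚ.lookup-map j slope τ) (cong slope eq))) eq′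

  -- An upper bound for the coefficient of the solution count. Further proportional words would
  -- contribute -η each and are estimated by 0; skew words enter only the error.
  share : Vec Letter ℓ → ℚ
  share τ = 𝟙 (τ ≟ᵛ constant) * 2ℚ - 𝟙 (τ ≟ᵛ diagonal) * η

  TermBound : Vec Letter ℓ → ℚ → Set
  TermBound τ x = ∃[ C ] 0ℚ ≤ C × ∀ n → evenPart τ * waveSum τ n ≤ x * solutionCount a n + C * ℕ→ℚ (n ℕ.^ suc k)

  term-exact : ∀ τ x → (∀ n → evenPart τ * waveSum τ n ≤ x * solutionCount a n) → TermBound τ x
  term-exact τ x le = 0ℚ , ℚₚ.≤-refl , λ n → ℚₚ.≤-trans (le n)
    (ℚₚ.≤-reflexive (sym (trans (+-congˡ (x * solutionCount a n) (ℚₚ.*-zeroˡ (ℕ→ℚ (n ℕ.^ suc k)))) (ℚₚ.+-identityʳ (x * solutionCount a n)))))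

  term-bound : ∀ τ → TermBound τ (share τ)
  term-bound τ = go (τ ≟ᵛ constant) (τ ≟ᵛ diagonal)
    where
    termValue : ∀ τ → Proportional a (slopes τ) → ∀ n →
      evenPart τ * waveSum τ n ≡ evenPart τ * (cos (t ℤ.* classSum b (slopes τ)) * solutionCount a n)
    termValue τ prop n = cong (evenPart τ *_) (waveSum-proportional a≢0 τ prop n)
    fullValue : ∀ τ → Proportional a (slopes τ) → Full τ → ∀ n →
      evenPart τ * waveSum τ n ≡ - η * solutionCount a n
    fullValue τ prop full n = trans (termValue τ prop n)
      (trans (cong₂ (λ x y → x * (y * solutionCount a n)) (evenPart-full τ full) (full-cos τ prop full))
        (lemma (2ℚ * h ^ ℓ) cA (solutionCount a n)))
      where
      lemma : ∀ x c s → x * (c * s) ≡ - (x * (0ℚ - c)) * s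
      lemma = solve-∀ ℚ-ring
    go : (d : Dec (τ ≡ constant)) (e : Dec (τ ≡ diagonal)) → TermBound τ (𝟙 d * 2ℚ - 𝟙 e * η)
    go (yes refl) (yes ())
    go (yes refl) (no _) = term-exact constant (1ℚ * 2ℚ - 0ℚ * η) λ n → ℚₚ.≤-reflexive (trans (termValue constant proportional-constant n)
      (trans (cong₂ (λ x y → x * (cos y * solutionCount a n)) evenPart-constant
          (trans (cong (t ℤ.*_) classSum-constant) (ℤₚ.*-zeroʳ t)))
        (lemma (solutionCount a n) η)))
      where
      lemma : ∀ s η → 2ℚ * (1ℚ * s) ≡ (1ℚ * 2ℚ - 0ℚ * η) * s
      lemma = solve-∀ ℚ-ring
    go (no _) (yes refl) = term-exact diagonal (0ℚ * 2ℚ - 1ℚ * η) λ n → ℚₚ.≤-reflexive (trans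
      (fullValue diagonal (subst (Proportional a) (sym slopes-diagonal) λ i j → ℤₚ.*-comm (lookup a i) (lookup a j)) full-diagonal n)
      (lemma (solutionCount a n) η))
      where
      lemma : ∀ s η → - η * s ≡ (0ℚ * 2ℚ - 1ℚ * η) * s
      lemma = solve-∀ ℚ-ring
    go (no τ≢const) (no _) = case skew-or-proportional a (slopes τ) a≢0 of λ where
        (inj₁ skew) → skewed skew
        (inj₂ prop) → case constant-or-full τ prop of λ where
          (inj₁ τ≡const) → ⊥-elim (τ≢const τ≡const)
          (inj₂ full)    → term-exact τ (0ℚ * 2ℚ - 0ℚ * η) λ n → ℚₚ.≤-trans (ℚₚ.≤-reflexive (fullValue τ prop full n))
            (≤-by (lemma (solutionCount a n) η) (0≤* (ℚₚ.<⇒≤ 0<η) (0≤ℕ→ℚ (length (solutions a n)))))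
      where
      lemma : ∀ s η → (0ℚ * 2ℚ - 0ℚ * η) * s - (- η * s) ≡ η * s
      lemma = solve-∀ ℚ-ring
      lemma′ : ∀ s η c p q → (q * c) * p ≡ (0ℚ * 2ℚ - 0ℚ * η) * s + (q * c) * p
      lemma′ = solve-∀ ℚ-ring
      skewed : Skew a (slopes τ) → TermBound τ (0ℚ * 2ℚ - 0ℚ * η)
      skewed skew = Q * C , 0≤* (ℚₚ.0≤∣p∣ (evenPart τ)) 0≤C , λ n → (begin
        evenPart τ * waveSum τ n
          ≤⟨ ∣p∣≤⇒≤ (ℚₚ.≤-reflexive (ℚₚ.∣p*q∣≡∣p∣*∣q∣ (evenPart τ) (waveSum τ n))) ⟩
        Q * ∣ waveSum τ n ∣
          ≤⟨ *-monoˡ (ℚₚ.0≤∣p∣ (evenPart τ)) (proj₂ (proj₂ bounded) n 0ℤ (t ℤ.* classSum b (slopes τ))) ⟩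
        Q * (C * ℕ→ℚ (n ℕ.^ suc k))
          ≡⟨ ℚₚ.*-assoc Q C (ℕ→ℚ (n ℕ.^ suc k)) ⟨
        Q * C * ℕ→ℚ (n ℕ.^ suc k)
          ≡⟨ lemma′ (solutionCount a n) η C (ℕ→ℚ (n ℕ.^ suc k)) Q ⟩
        (0ℚ * 2ℚ - 0ℚ * η) * solutionCount a n + Q * C * ℕ→ℚ (n ℕ.^ suc k) ∎)
        where
        open ℚₚ.≤-Reasoning
        Q = ∣ evenPart τ ∣
        bounded = skew-bound cosKernel cosKernel-bounded skew
        C = proj₁ bounded
        0≤C = proj₁ (proj₂ bounded)

  total-share : ∑ᵛ letters ℓ share ≡ 2ℚ - η
  total-share = trans (∑-- (vecs letters ℓ) (λ τ → 𝟙 (τ ≟ᵛ constant) * 2ℚ) (λ τ → 𝟙 (τ ≟ᵛ diagonal) * η))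
    (cong₂ _-_ (pick constant 2ℚ) (pick diagonal η))
    where
    pick : ∀ σ x → ∑ᵛ letters ℓ (λ τ → 𝟙 (τ ≟ᵛ σ) * x) ≡ x
    pick σ x = ∑-δ _≟ᵛ_ (vecs-unique letters-unique ℓ) (∈-vecs ∈-letters σ) (λ _ → x)

  C : ℚ
  C = ∑ᵛ letters ℓ λ τ → proj₁ (term-bound τ)

  0≤C : 0ℚ ≤ C
  0≤C = 0≤∑ (vecs letters ℓ) λ τ → proj₁ (proj₂ (term-bound τ))

  twoColourSum-bound : ∀ n → twoColourSum a n wave ≤ (2ℚ - η) * solutionCount a n + C * ℕ→ℚ (n ℕ.^ suc k)
  twoColourSum-bound n = begin
    twoColourSum a n wave
      ≡⟨ twoColourSum-expand n ⟩
    ∑ᵛ letters ℓ (λ τ → evenPart τ * waveSum τ n)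
      ≤⟨ ∑-mono (vecs letters ℓ) (λ τ → proj₂ (proj₂ (term-bound τ)) n) ⟩
    ∑ᵛ letters ℓ (λ τ → share τ * s + proj₁ (term-bound τ) * p)
      ≡⟨ ∑-+ (vecs letters ℓ) (λ τ → share τ * s) (λ τ → proj₁ (term-bound τ) * p) ⟩
    ∑ᵛ letters ℓ (λ τ → share τ * s) + ∑ᵛ letters ℓ (λ τ → proj₁ (term-bound τ) * p)
      ≡⟨ cong₂ _+_ (trans (∑-*ʳ (vecs letters ℓ) s share) (cong (_* s) total-share)) (∑-*ʳ (vecs letters ℓ) p (λ τ → proj₁ (term-bound τ))) ⟩
    (2ℚ - η) * s + C * p ∎
    where
    open ℚₚ.≤-Reasoning
    s = solutionCount a n
    p = ℕ→ℚ (n ℕ.^ suc k)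

-- Serves the case of coefficients of one sign. All sums in the criterion are empty, so g = 0 will
-- do and n can be N itself.
unsolvable-uncommon : ∀ {k} (a : Vec ℤ (suc k)) → (∀ n (x : Vec (Fin n) (suc k)) → ¬ IsSolution a x) →
  ∀ r .{{_ : ℕ.NonZero r}} → 2 ℕ.≤ r → Uncommon r a
unsolvable-uncommon {k} a none r 2≤r = uncommon-criterion a r 2≤r 1ℚ (ℚₚ.positive⁻¹ 1ℚ) ℚₚ.≤-refl λ N →
  N , ℕₚ.≤-refl , (λ _ → 0ℚ) , (λ _ → 0≤1) , bound N (solutions a N) (Listₚ.filter-none (isSolution? a) (All.universal (none N) (tuples N (suc k))))
  where
  P = ℕ→ℚ (r ℕ.^ suc k)
  bound : ∀ N xs → xs ≡ [] → ∑ xs (λ x → ∏ x (λ _ → 1ℚ + 0ℚ) + ∏ x (λ _ → 1ℚ - 0ℚ)) + P * ∑ xs (λ (x : Vec (Fin N) (suc k)) → 1ℚ - 𝟙 (distinct? x)) ≤ (2ℚ - 1ℚ) * ℕ→ℚ (length xs)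
  bound N .[] refl = ℚₚ.≤-reflexive (trans (ℚₚ.+-identityˡ (P * 0ℚ)) (ℚₚ.*-zeroʳ P))

same-sign-unsolvable : ∀ {k} (a : Vec ℤ (suc k)) → (∀ i → 0ℤ ℤ.< lookup a i) ⊎ (∀ i → lookup a i ℤ.< 0ℤ) →
  ∀ n (x : Vec (Fin n) (suc k)) → ¬ IsSolution a x
same-sign-unsolvable a signs n x eq = case signs of λ where
    (inj₁ pos) → ℤₚ.<-irrefl (sym zero-dot) (positive a pos (Vec.map toℕ x))
    (inj₂ neg) → ℤₚ.<-irrefl zero-dot (negative a neg (Vec.map toℕ x))
  where
  zero-dot : dot a (Vec.map toℕ x) ≡ 0ℤ
  zero-dot = trans (sym (evaluate≡dot a x)) eq
  positive : ∀ {k} (a : Vec ℤ (suc k)) → (∀ i → 0ℤ ℤ.< lookup a i) → ∀ v → 0ℤ ℤ.< dot a v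
  positive (a ∷ [])      pos (i ∷ [])    = subst (0ℤ ℤ.<_) (sym (ℤₚ.+-identityʳ (a ℤ.* val i))) (ℤₚ.*-monoʳ-<-pos (val i) (pos Fin.zero))
  positive (a ∷ a′ ∷ as) pos (i ∷ j ∷ v) = ℤₚ.+-mono-< (ℤₚ.*-monoʳ-<-pos (val i) (pos Fin.zero)) (positive (a′ ∷ as) (pos ∘ Fin.suc) (j ∷ v))
  negative : ∀ {k} (a : Vec ℤ (suc k)) → (∀ i → lookup a i ℤ.< 0ℤ) → ∀ v → dot a v ℤ.< 0ℤ
  negative (a ∷ [])      neg (i ∷ [])    = subst (ℤ._< 0ℤ) (sym (ℤₚ.+-identityʳ (a ℤ.* val i))) (ℤₚ.*-monoʳ-<-pos (val i) (neg Fin.zero))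
  negative (a ∷ a′ ∷ as) neg (i ∷ j ∷ v) = ℤₚ.+-mono-< (ℤₚ.*-monoʳ-<-pos (val i) (neg Fin.zero)) (negative (a′ ∷ as) (neg ∘ Fin.suc) (j ∷ v))

-- The length is a variable l with two equations, because 2 * m does not reduce to the form 3 + k.
-- The first equation is matched away, and the second stays as the statement of evenness.
no-canceling-uncommon : ∀ {l k m} → l ≡ 3 ℕ.+ k → l ≡ 2 ℕ.* m → (a : Vec ℤ l) → NonzeroCoefficients a →
  ¬ HasCancelingPartition a → ∀ r .{{_ : ℕ.NonZero r}} → 2 ℕ.≤ r → Uncommon r a
no-canceling-uncommon {k = k} {m} refl even a a≢0 ¬partition r 2≤r = case opposite-or-same a a≢0 of λ where
    (inj₂ same) → unsolvable-uncommon a (same-sign-unsolvable a same) r 2≤r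
    (inj₁ opp)  → mixed opp
  where
  unbalanced = Canceling.unbalanced-class a a≢0 ¬partition
  b = ℤ.∣ lookup a (proj₁ unbalanced) ∣
  classSum≢0 : classSum b a ≢ 0ℤ
  classSum≢0 eq = proj₂ unbalanced (trans (Canceling.indexSum-allFin a a≢0 b) eq)
  phase = negative-cos classSum≢0
  module U = UnbalancedClass {m = m} a even a≢0 b (proj₁ phase) (proj₂ phase)
  mixed : OppositeSigns a → Uncommon r a
  mixed opp = asymptotic-criterion a a≢0 r 2≤r U.η U.0<η U.η≤1 K 0<K U.C U.0≤C λ N →
    suc E ℕ.* N , ℕₚ.m≤n*m N (suc E) ,
    subst (_≤ K * solutionCount a (suc E ℕ.* N))
      (trans (sym (ℕ→ℚ-* (suc E ℕ.^ (2 ℕ.+ k)) (N ℕ.^ (2 ℕ.+ k)))) (cong ℕ→ℚ (sym (*-^ (suc E) N (2 ℕ.+ k)))))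
      (*-monoˡ (ℚₚ.<⇒≤ 0<K) (proj₂ lower N)) ,
    Expansion.wave a b (proj₁ phase) , Expansion.∣wave∣≤1 a b (proj₁ phase) , U.twoColourSum-bound (suc E ℕ.* N)
    where
    lower = solutionCount-lower opp
    E = proj₁ lower
    K = ℕ→ℚ (suc E ℕ.^ (2 ℕ.+ k))
    0<K : 0ℚ < K
    0<K = ℚₚ.<-≤-trans (ℚₚ.positive⁻¹ 1ℚ) (ℕ→ℚ-mono-≤ {1} {suc E ℕ.^ (2 ℕ.+ k)} (ℕₚ.m^n>0 (suc E) (2 ℕ.+ k)))

-- Kept in the integers so that the finite checks below evaluate by `refl` without normalising
-- fractions.
∑ℤ : ∀ {A : Set} → List A → (A → ℤ) → ℤ
∑ℤ []       f = 0ℤ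
∑ℤ (x ∷ xs) f = f x ℤ.+ ∑ℤ xs f

ι-∑ : ∀ {A : Set} (xs : List A) (f : A → ℤ) → ι (∑ℤ xs f) ≡ ∑ xs (ι ∘ f)
ι-∑ []       f = refl
ι-∑ (x ∷ xs) f = trans (ι-+ (f x) (∑ℤ xs f)) (+-congˡ (ι (f x)) (ι-∑ xs f))

∏ℤ : ∀ {A : Set} {k} → Vec A k → (A → ℤ) → ℤ
∏ℤ []       f = + 1
∏ℤ (x ∷ xs) f = f x ℤ.* ∏ℤ xs f

∏-ι : ∀ {A : Set} {k} u (xs : Vec A k) (f : A → ℤ) → ∏ xs (λ x → u * ι (f x)) ≡ u ^ k * ι (∏ℤ xs f)
∏-ι u []       f = refl
∏-ι {k = suc k} u (x ∷ xs) f = trans (cong (u * ι (f x) *_) (∏-ι u xs f))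
  (trans (lemma u (ι (f x)) (u ^ k) (ι (∏ℤ xs f))) (cong (u * u ^ k *_) (sym (ι-* (f x) (∏ℤ xs f)))))
  where
  lemma : ∀ u x v y → u * x * (v * y) ≡ u * v * (x * y)
  lemma = solve-∀ ℚ-ring

-- Decomposition of {0, …, BM - 1} into B blocks of length M

∑<-blocks : ∀ B M f → ∑< (B ℕ.* M) f ≡ ∑< B λ b → ∑< M λ o → f (b ℕ.* M ℕ.+ o)
∑<-blocks zero    M f = refl
∑<-blocks (suc B) M f = trans (∑<-+ M (B ℕ.* M) f)
  (trans (+-congˡ (∑< M f) (trans (∑<-blocks B M (λ i → f (M ℕ.+ i)))
      (∑<-cong B λ b → ∑<-cong M λ o → cong f (sym (ℕₚ.+-assoc M (b ℕ.* M) o)))))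
    (sym (∑<-suc B (λ b → ∑< M λ o → f (b ℕ.* M ℕ.+ o)))))

-- The position with offset o in block b stands for the number b M + (o + 1). The shift by one
-- belongs to the offset, so block numbers enter unshifted.
dot₀ : ∀ {k} → Vec ℤ k → Vec ℕ k → ℤ
dot₀ []       []      = 0ℤ
dot₀ (a ∷ as) (b ∷ β) = a ℤ.* + b ℤ.+ dot₀ as β

-- φ is arbitrary so that the induction can move the first coordinate into it. H sees only blocks,
-- since division by M recovers b from b M + o for o < M.
∑ᵛ-blocks : ∀ {k} B M .{{_ : ℕ.NonZero M}} (a : Vec ℤ k) (φ : ℤ → ℚ) (H : Vec ℕ k → ℚ) →
  ∑ᵛ (upTo (B ℕ.* M)) k (λ v → φ (dot a v) * H (Vec.map (ℕ._/ M) v)) ≡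
  ∑ᵛ (upTo B) k λ β → H β * ∑ᵛ (upTo M) k λ o → φ (+ M ℤ.* dot₀ a β ℤ.+ dot a o)
∑ᵛ-blocks         B M []       φ H = cong (_+ 0ℚ) (trans (ℚₚ.*-comm (φ 0ℤ) (H []))
  (cong (H [] *_) (trans (cong φ (sym (trans (ℤₚ.+-identityʳ _) (ℤₚ.*-zeroʳ (+ M))))) (sym (ℚₚ.+-identityʳ _)))))
∑ᵛ-blocks {suc k} B M (a ∷ as) φ H = begin
  ∑ᵛ (upTo (B ℕ.* M)) (suc k) F
    ≡⟨ ∑ᵛ-suc (upTo (B ℕ.* M)) k F ⟩
  ∑< (B ℕ.* M) (λ i → ∑ᵛ (upTo (B ℕ.* M)) k λ v → F (i ∷ v))
    ≡⟨ ∑<-blocks B M (λ i → ∑ᵛ (upTo (B ℕ.* M)) k λ v → F (i ∷ v)) ⟩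
  ∑< B (λ b → ∑< M λ o → ∑ᵛ (upTo (B ℕ.* M)) k λ v → F (b ℕ.* M ℕ.+ o ∷ v))
    ≡⟨ ∑<-cong B (λ b → ∑-cong∈ (upTo M) λ {o} o∈ → trans
         (∑-cong (vecs (upTo (B ℕ.* M)) k) λ v → cong (λ q → φ (a ℤ.* val (b ℕ.* M ℕ.+ o) ℤ.+ dot as v) * H (q ∷ Vec.map (ℕ._/ M) v)) (quotient b o (∈-upTo⁻ o∈)))
         (∑ᵛ-blocks B M as (λ z → φ (a ℤ.* val (b ℕ.* M ℕ.+ o) ℤ.+ z)) (λ β → H (b ∷ β)))) ⟩
  ∑< B (λ b → ∑< M λ o → ∑ᵛ (upTo B) k λ β → H (b ∷ β) * ∑ᵛ (upTo M) k λ v → φ (a ℤ.* val (b ℕ.* M ℕ.+ o) ℤ.+ (+ M ℤ.* dot₀ as β ℤ.+ dot as v)))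
    ≡⟨ ∑<-cong B (λ b → trans (∑-swap (upTo M) (vecs (upTo B) k) _) (∑-cong (vecs (upTo B) k) λ β → ∑-*ˡ (upTo M) (H (b ∷ β)) _)) ⟩
  ∑< B (λ b → ∑ᵛ (upTo B) k λ β → H (b ∷ β) * ∑< M λ o → ∑ᵛ (upTo M) k λ v → φ (a ℤ.* val (b ℕ.* M ℕ.+ o) ℤ.+ (+ M ℤ.* dot₀ as β ℤ.+ dot as v)))
    ≡⟨ ∑<-cong B (λ b → ∑-cong (vecs (upTo B) k) λ β → cong (H (b ∷ β) *_) (trans
         (∑<-cong M λ o → ∑-cong (vecs (upTo M) k) λ v → cong φ (rearrange b o (dot₀ as β) (dot as v)))
         (sym (∑ᵛ-suc (upTo M) k λ o → φ (+ M ℤ.* dot₀ (a ∷ as) (b ∷ β) ℤ.+ dot (a ∷ as) o))))) ⟩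
  ∑< B (λ b → ∑ᵛ (upTo B) k λ β → H (b ∷ β) * ∑ᵛ (upTo M) (suc k) λ o → φ (+ M ℤ.* dot₀ (a ∷ as) (b ∷ β) ℤ.+ dot (a ∷ as) o))
    ≡⟨ ∑ᵛ-suc (upTo B) k (λ β → H β * ∑ᵛ (upTo M) (suc k) λ o → φ (+ M ℤ.* dot₀ (a ∷ as) β ℤ.+ dot (a ∷ as) o)) ⟨
  ∑ᵛ (upTo B) (suc k) (λ β → H β * ∑ᵛ (upTo M) (suc k) λ o → φ (+ M ℤ.* dot₀ (a ∷ as) β ℤ.+ dot (a ∷ as) o)) ∎
  where
  open ≡-Reasoning
  F : Vec ℕ (suc k) → ℚ
  F v = φ (dot (a ∷ as) v) * H (Vec.map (ℕ._/ M) v)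
  quotient : ∀ b o → o ℕ.< M → (b ℕ.* M ℕ.+ o) ℕ./ M ≡ b
  quotient b o o<M = trans (DivMod.+-distrib-/-∣ˡ o (Divisibility.n∣m*n b)) (trans (cong₂ ℕ._+_ (DivMod.m*n/n≡m b M) (DivMod.m<n⇒m/n≡0 o<M)) (ℕₚ.+-identityʳ b))
  lemma : ∀ a M b v p d → a ℤ.* (b ℤ.* M ℤ.+ v) ℤ.+ (M ℤ.* p ℤ.+ d) ≡ M ℤ.* (a ℤ.* b ℤ.+ p) ℤ.+ (a ℤ.* v ℤ.+ d)
  lemma = ℤ-Solver.solve-∀
  rearrange : ∀ b o p d → a ℤ.* val (b ℕ.* M ℕ.+ o) ℤ.+ (+ M ℤ.* p ℤ.+ d) ≡ + M ℤ.* (a ℤ.* + b ℤ.+ p) ℤ.+ (a ℤ.* val o ℤ.+ d)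
  rearrange b o p d = trans
    (cong (λ z → a ℤ.* z ℤ.+ (+ M ℤ.* p ℤ.+ d)) (trans (val-+ (b ℕ.* M) o) (cong (ℤ._+ val o) (ℤₚ.pos-* b M))))
    (lemma a (+ M) (+ b) (val o) p d)

-- The equation x + 2y - z - 2w = 0

E₄ : Vec ℤ 4
E₄ = + 1 ∷ + 2 ∷ ℤ.- + 1 ∷ ℤ.- + 2 ∷ []

-- The number of solutions in a given 4-tuple β of blocks of length M depends on β only through s =
-- `dot₀ E₄ β`.
volume : ℕ → ℤ → ℚ
volume M s = ∑ᵛ (upTo M) 4 λ o → 𝟙 (+ M ℤ.* s ℤ.+ dot E₄ o ≟0)

-- Each block of length 2M is cut into halves, and β in {0, 1}⁴ records the half chosen by each
-- coordinate.
volume-double : ∀ M .{{_ : ℕ.NonZero M}} s →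
  volume (2 ℕ.* M) s ≡ ∑ᵛ (upTo 2) 4 λ β → volume M (+ 2 ℤ.* s ℤ.+ dot₀ E₄ β)
volume-double M s = begin
  volume (2 ℕ.* M) s
    ≡⟨ ∑-cong (vecs (upTo (2 ℕ.* M)) 4) (λ v → ℚₚ.*-identityʳ (𝟙 (+ (2 ℕ.* M) ℤ.* s ℤ.+ dot E₄ v ≟0))) ⟨
  ∑ᵛ (upTo (2 ℕ.* M)) 4 (λ v → 𝟙 (+ (2 ℕ.* M) ℤ.* s ℤ.+ dot E₄ v ≟0) * 1ℚ)
    ≡⟨ ∑ᵛ-blocks 2 M E₄ (λ z → 𝟙 (+ (2 ℕ.* M) ℤ.* s ℤ.+ z ≟0)) (λ _ → 1ℚ) ⟩
  ∑ᵛ (upTo 2) 4 (λ β → 1ℚ * ∑ᵛ (upTo M) 4 λ o → 𝟙 (+ (2 ℕ.* M) ℤ.* s ℤ.+ (+ M ℤ.* dot₀ E₄ β ℤ.+ dot E₄ o) ≟0))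
    ≡⟨ ∑-cong (vecs (upTo 2) 4) (λ β → trans (ℚₚ.*-identityˡ _) (∑-cong (vecs (upTo M) 4) λ o → cong (λ z → 𝟙 (z ≟0))
         (trans (cong (λ z → z ℤ.* s ℤ.+ (+ M ℤ.* dot₀ E₄ β ℤ.+ dot E₄ o)) (ℤₚ.pos-* 2 M)) (lemma (+ M) s (dot₀ E₄ β) (dot E₄ o))))) ⟩
  ∑ᵛ (upTo 2) 4 (λ β → volume M (+ 2 ℤ.* s ℤ.+ dot₀ E₄ β)) ∎
  where
  open ≡-Reasoning
  lemma : ∀ M s p d → + 2 ℤ.* M ℤ.* s ℤ.+ (M ℤ.* p ℤ.+ d) ≡ M ℤ.* (+ 2 ℤ.* s ℤ.+ p) ℤ.+ d
  lemma = ℤ-Solver.solve-∀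

-- The offsets contribute (x - z) + 2 (y - w), which is less than 3M in absolute value.
volume-zero : ∀ M s → 3 ℕ.≤ ℤ.∣ s ∣ → volume M s ≡ 0ℚ
volume-zero M s 3≤s = trans (∑-cong∈ (vecs (upTo M) 4) λ {o} o∈ → 𝟙-no (+ M ℤ.* s ℤ.+ dot E₄ o ≟0) (impossible o o∈)) (∑-zero (vecs (upTo M) 4))
  where
  lemma : ∀ x y z w → + 1 ℤ.* x ℤ.+ (+ 2 ℤ.* y ℤ.+ (ℤ.- + 1 ℤ.* z ℤ.+ (ℤ.- + 2 ℤ.* w ℤ.+ 0ℤ))) ≡ (x ℤ.- z) ℤ.+ + 2 ℤ.* (y ℤ.- w)
  lemma = ℤ-Solver.solve-∀
  gap : ∀ {i j} → i ℕ.< M → j ℕ.< M → ℤ.∣ val i ℤ.- val j ∣ ℕ.< M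
  gap {i} {j} i<M j<M = ℕₚ.≤-<-trans (ℕₚ.≤-trans (ℕₚ.≤-reflexive (cong ℤ.∣_∣ (ℤₚ.[1+m]⊖[1+n]≡m⊖n i j))) (ℤₚ.∣m⊝n∣≤m⊔n i j)) (ℕₚ.⊔-lub i<M j<M)
  small : ∀ o → o ∈ vecs (upTo M) 4 → ℤ.∣ dot E₄ o ∣ ℕ.< 3 ℕ.* M
  small o@(x ∷ y ∷ z ∷ w ∷ []) o∈ = subst (λ d → ℤ.∣ d ∣ ℕ.< 3 ℕ.* M) (sym (lemma (val x) (val y) (val z) (val w)))
    (ℕₚ.≤-<-trans (ℤₚ.∣i+j∣≤∣i∣+∣j∣ (val x ℤ.- val z) (+ 2 ℤ.* (val y ℤ.- val w)))
      (ℕₚ.+-mono-<-≤ (gap (bound Fin.zero) (bound (Fin.suc (Fin.suc Fin.zero))))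
        (ℕₚ.≤-trans (ℕₚ.≤-reflexive (ℤₚ.∣i*j∣≡∣i∣*∣j∣ (+ 2) (val y ℤ.- val w)))
          (ℕₚ.*-monoʳ-≤ 2 (ℕₚ.<⇒≤ (gap (bound (Fin.suc Fin.zero)) (bound (Fin.suc (Fin.suc (Fin.suc Fin.zero))))))))))
    where
    entries : ∀ {k} (v : Vec ℕ k) → v ∈ vecs (upTo M) k → ∀ i → lookup v i ℕ.< M
    entries {suc k} v v∈ i with ∈-cartesianProductWith⁻ _∷_ (upTo M) (vecs (upTo M) k) v∈
    entries {suc k} .(x ∷ u) v∈ Fin.zero    | x , u , x∈ , u∈ , refl = ∈-upTo⁻ x∈
    entries {suc k} .(x ∷ u) v∈ (Fin.suc i) | x , u , x∈ , u∈ , refl = entries u u∈ i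
    bound : ∀ i → lookup o i ℕ.< M
    bound = entries o o∈
  impossible : ∀ o → o ∈ vecs (upTo M) 4 → + M ℤ.* s ℤ.+ dot E₄ o ≢ 0ℤ
  impossible o o∈ eq = ℕₚ.<-irrefl refl (ℕₚ.<-≤-trans (small o o∈) (ℕₚ.≤-trans (ℕₚ.≤-trans (ℕₚ.*-monoˡ-≤ M 3≤s) (ℕₚ.≤-reflexive (ℕₚ.*-comm ℤ.∣ s ∣ M)))
    (ℕₚ.≤-reflexive (trans (sym (ℤₚ.∣i*j∣≡∣i∣*∣j∣ (+ M) s)) (trans (cong ℤ.∣_∣ (cancel (+ M ℤ.* s) (dot E₄ o) eq)) (ℤₚ.∣-i∣≡∣i∣ (dot E₄ o)))))))
    where
    lemma′ : ∀ x y → x ≡ x ℤ.+ y ℤ.- y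
    lemma′ = ℤ-Solver.solve-∀
    cancel : ∀ x y → x ℤ.+ y ≡ 0ℤ → x ≡ ℤ.- y
    cancel x y eq = trans (lemma′ x y) (trans (cong (ℤ._- y) eq) (ℤₚ.+-identityˡ (ℤ.- y)))

-- The recursion volume-double has the eigenvalues 8, 2 and 0 on functions of |s| ≤ 2, with
-- eigenvectors cubic and linear for 8 and 2; the third component is gone from M = 2 on.
cubic linear : ℤ → ℤ
cubic s = go ℤ.∣ s ∣
  where
  go : ℕ → ℤ
  go 0 = + 10
  go 1 = + 6
  go 2 = + 1
  go _ = + 0
linear s = go ℤ.∣ s ∣
  where
  go : ℕ → ℤ
  go 0 = + 2
  go 2 = ℤ.- + 1
  go _ = + 0

closed : ℚ → ℤ → ℚ
closed y s = ι (cubic s) * (y * y * y) + ι (linear s) * y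

closed-double : ∀ y s → ℤ.∣ s ∣ ℕ.≤ 2 → ∑ᵛ (upTo 2) 4 (λ β → closed y (+ 2 ℤ.* s ℤ.+ dot₀ E₄ β)) ≡ closed (2ℚ * y) s
closed-double y s s≤2 = begin
  ∑ᵛ (upTo 2) 4 (λ β → closed y (+ 2 ℤ.* s ℤ.+ dot₀ E₄ β))
    ≡⟨ ∑-+ (vecs (upTo 2) 4) (λ β → ι (cubic (z β)) * (y * y * y)) (λ β → ι (linear (z β)) * y) ⟩
  ∑ᵛ (upTo 2) 4 (λ β → ι (cubic (z β)) * (y * y * y)) + ∑ᵛ (upTo 2) 4 (λ β → ι (linear (z β)) * y)
    ≡⟨ cong₂ _+_ (∑-*ʳ (vecs (upTo 2) 4) (y * y * y) (ι ∘ cubic ∘ z)) (∑-*ʳ (vecs (upTo 2) 4) y (ι ∘ linear ∘ z)) ⟩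
  ∑ᵛ (upTo 2) 4 (ι ∘ cubic ∘ z) * (y * y * y) + ∑ᵛ (upTo 2) 4 (ι ∘ linear ∘ z) * y
    ≡⟨ cong₂ (λ p q → p * (y * y * y) + q * y) (eigen cubic (+ 8) (λ s s≤2 → proj₁ (check s s≤2))) (eigen linear (+ 2) (λ s s≤2 → proj₂ (check s s≤2))) ⟩
  ι (+ 8) * ι (cubic s) * (y * y * y) + ι (+ 2) * ι (linear s) * y
    ≡⟨ lemma (ι (cubic s)) (ι (linear s)) y ⟩
  closed (2ℚ * y) s ∎
  where
  open ≡-Reasoning
  z : Vec ℕ 4 → ℤ
  z β = + 2 ℤ.* s ℤ.+ dot₀ E₄ β
  lemma : ∀ p q y → ι (+ 8) * p * (y * y * y) + ι (+ 2) * q * y ≡ p * (2ℚ * y * (2ℚ * y) * (2ℚ * y)) + q * (2ℚ * y)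
  lemma = solve-∀ ℚ-ring
  sums : (ℤ → ℤ) → ℤ → ℤ
  sums f s = ∑ℤ (vecs (upTo 2) 4) λ β → f (+ 2 ℤ.* s ℤ.+ dot₀ E₄ β)
  -- Five values of s, with 16 summands each.
  check : ∀ s → ℤ.∣ s ∣ ℕ.≤ 2 → sums cubic s ≡ + 8 ℤ.* cubic s × sums linear s ≡ + 2 ℤ.* linear s
  check (+ 0)     _ = refl , refl
  check (+ 1)     _ = refl , refl
  check (+ 2)     _ = refl , refl
  check -[1+ 0 ]  _ = refl , refl
  check -[1+ 1 ]  _ = refl , refl
  check (+ suc (suc (suc _))) (ℕ.s≤s (ℕ.s≤s ()))
  check -[1+ suc (suc _) ]    (ℕ.s≤s (ℕ.s≤s ()))
  eigen : ∀ f c → (∀ s → ℤ.∣ s ∣ ℕ.≤ 2 → sums f s ≡ c ℤ.* f s) → ∑ᵛ (upTo 2) 4 (ι ∘ f ∘ z) ≡ ι c * ι (f s)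
  eigen f c eq = trans (sym (ι-∑ (vecs (upTo 2) 4) (f ∘ z))) (trans (cong ι (eq s s≤2)) (ι-* c (f s)))

-- The factor 3 clears the denominator of the closed form. The induction runs over all s at once,
-- because 2s + `dot₀ E₄ β` can leave the range |s| ≤ 2; outside it both sides vanish.
volume-closed : ∀ j s → ℕ→ℚ 3 * volume (2 ℕ.^ suc j) s ≡ closed (ℕ→ℚ (2 ℕ.^ j)) s
volume-closed j s with 3 ℕₚ.≤? ℤ.∣ s ∣
... | yes 3≤s = trans (cong (ℕ→ℚ 3 *_) (volume-zero (2 ℕ.^ suc j) s 3≤s)) (trans (ℚₚ.*-zeroʳ (ℕ→ℚ 3)) (sym (outside s 3≤s)))
  where
  y = ℕ→ℚ (2 ℕ.^ j)
  lemma : ∀ y → 0ℚ * (y * y * y) + 0ℚ * y ≡ 0ℚ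
  lemma = solve-∀ ℚ-ring
  outside : ∀ s → 3 ℕ.≤ ℤ.∣ s ∣ → closed y s ≡ 0ℚ
  outside (+ suc (suc (suc _))) _ = lemma y
  outside -[1+ suc (suc _) ]    _ = lemma y
  outside (+ 1)    (ℕ.s≤s ())
  outside (+ 2)    (ℕ.s≤s (ℕ.s≤s ()))
  outside -[1+ 0 ] (ℕ.s≤s ())
  outside -[1+ 1 ] (ℕ.s≤s (ℕ.s≤s ()))
volume-closed zero s | no s<3 = base s (ℕₚ.≤-pred (ℕₚ.≰⇒> s<3))
  where
  base : ∀ s → ℤ.∣ s ∣ ℕ.≤ 2 → ℕ→ℚ 3 * volume 2 s ≡ closed (ℕ→ℚ 1) s
  base (+ 0)    _ = refl
  base (+ 1)    _ = refl
  base (+ 2)    _ = refl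
  base -[1+ 0 ] _ = refl
  base -[1+ 1 ] _ = refl
  base (+ suc (suc (suc _))) (ℕ.s≤s (ℕ.s≤s ()))
  base -[1+ suc (suc _) ]    (ℕ.s≤s (ℕ.s≤s ()))
volume-closed (suc j) s | no s<3 = begin
  ℕ→ℚ 3 * volume (2 ℕ.* 2 ℕ.^ suc j) s
    ≡⟨ cong (ℕ→ℚ 3 *_) (volume-double (2 ℕ.^ suc j) {{ℕₚ.m^n≢0 2 (suc j)}} s) ⟩
  ℕ→ℚ 3 * ∑ᵛ (upTo 2) 4 (λ β → volume (2 ℕ.^ suc j) (+ 2 ℤ.* s ℤ.+ dot₀ E₄ β))
    ≡⟨ ∑-*ˡ (vecs (upTo 2) 4) (ℕ→ℚ 3) (λ β → volume (2 ℕ.^ suc j) (+ 2 ℤ.* s ℤ.+ dot₀ E₄ β)) ⟨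
  ∑ᵛ (upTo 2) 4 (λ β → ℕ→ℚ 3 * volume (2 ℕ.^ suc j) (+ 2 ℤ.* s ℤ.+ dot₀ E₄ β))
    ≡⟨ ∑-cong (vecs (upTo 2) 4) (λ β → volume-closed j (+ 2 ℤ.* s ℤ.+ dot₀ E₄ β)) ⟩
  ∑ᵛ (upTo 2) 4 (λ β → closed (ℕ→ℚ (2 ℕ.^ j)) (+ 2 ℤ.* s ℤ.+ dot₀ E₄ β))
    ≡⟨ closed-double (ℕ→ℚ (2 ℕ.^ j)) s (ℕₚ.≤-pred (ℕₚ.≰⇒> s<3)) ⟩
  closed (2ℚ * ℕ→ℚ (2 ℕ.^ j)) s
    ≡⟨ cong (λ y → closed y s) (ℕ→ℚ-* 2 (2 ℕ.^ j)) ⟨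
  closed (ℕ→ℚ (2 ℕ.^ suc j)) s ∎
  where open ≡-Reasoning

-- Found numerically: a step function along which the second variation of the two-colour sum
-- is negative. Scaling it by 1/100 makes this outweigh the quartic term.
profile : List ℤ
profile = + 0 ∷ + 2 ∷ ℤ.- + 2 ∷ ℤ.- + 3 ∷ + 3 ∷ + 0 ∷ + 0 ∷ + 3 ∷ ℤ.- + 3 ∷ ℤ.- + 2 ∷ + 2 ∷ + 0 ∷ []

nth : List ℤ → ℕ → ℤ
nth []       _       = 0ℤ
nth (z ∷ zs) zero    = z
nth (z ∷ zs) (suc i) = nth zs i

-- The two products of 1 ± g with g = `profile` / 100, multiplied by 100⁴ to become integers.
twoColourWeight : Vec ℕ 4 → ℤ
twoColourWeight β = ∏ℤ β (λ b → + 100 ℤ.+ nth profile b) ℤ.+ ∏ℤ β (λ b → + 100 ℤ.- nth profile b)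

tally : ℕ → (Vec ℕ 4 → ℤ) → (ℤ → ℤ) → ℤ
tally B G f = ∑ℤ (vecs (upTo B) 4) λ β → G β ℤ.* f (dot₀ E₄ β)

weighted-volume : ∀ B j (G : Vec ℕ 4 → ℤ) → let y = ℕ→ℚ (2 ℕ.^ j) in
  ℕ→ℚ 3 * ∑ᵛ (upTo B) 4 (λ β → ι (G β) * volume (2 ℕ.^ suc j) (dot₀ E₄ β)) ≡
  ι (tally B G cubic) * (y * y * y) + ι (tally B G linear) * y
weighted-volume B j G = begin
  ℕ→ℚ 3 * ∑ᵛ (upTo B) 4 (λ β → ι (G β) * volume (2 ℕ.^ suc j) (p β))
    ≡⟨ ∑-*ˡ (vecs (upTo B) 4) (ℕ→ℚ 3) (λ β → ι (G β) * volume (2 ℕ.^ suc j) (p β)) ⟨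
  ∑ᵛ (upTo B) 4 (λ β → ℕ→ℚ 3 * (ι (G β) * volume (2 ℕ.^ suc j) (p β)))
    ≡⟨ ∑-cong (vecs (upTo B) 4) (λ β → trans (lemma₁ (ℕ→ℚ 3) (ι (G β)) (volume (2 ℕ.^ suc j) (p β)))
         (trans (cong (ι (G β) *_) (volume-closed j (p β)))
         (trans (lemma₂ (ι (G β)) (ι (cubic (p β))) (ι (linear (p β))) y)
           (cong₂ (λ u v → u * (y * y * y) + v * y) (sym (ι-* (G β) (cubic (p β)))) (sym (ι-* (G β) (linear (p β)))))))) ⟩
  ∑ᵛ (upTo B) 4 (λ β → ι (G β ℤ.* cubic (p β)) * (y * y * y) + ι (G β ℤ.* linear (p β)) * y)
    ≡⟨ ∑-+ (vecs (upTo B) 4) (λ β → ι (G β ℤ.* cubic (p β)) * (y * y * y)) (λ β → ι (G β ℤ.* linear (p β)) * y) ⟩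
  ∑ᵛ (upTo B) 4 (λ β → ι (G β ℤ.* cubic (p β)) * (y * y * y)) + ∑ᵛ (upTo B) 4 (λ β → ι (G β ℤ.* linear (p β)) * y)
    ≡⟨ cong₂ _+_ (collect cubic (y * y * y)) (collect linear y) ⟩
  ι (tally B G cubic) * (y * y * y) + ι (tally B G linear) * y ∎
  where
  open ≡-Reasoning
  y = ℕ→ℚ (2 ℕ.^ j)
  p : Vec ℕ 4 → ℤ
  p = dot₀ E₄
  lemma₁ : ∀ x y z → x * (y * z) ≡ y * (x * z)
  lemma₁ = solve-∀ ℚ-ring
  lemma₂ : ∀ g c l y → g * (c * (y * y * y) + l * y) ≡ g * c * (y * y * y) + g * l * y
  lemma₂ = solve-∀ ℚ-ring
  collect : ∀ f c → ∑ᵛ (upTo B) 4 (λ β → ι (G β ℤ.* f (p β)) * c) ≡ ι (tally B G f) * c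
  collect f c = trans (∑-*ʳ (vecs (upTo B) 4) c (λ β → ι (G β ℤ.* f (p β))))
    (cong (_* c) (sym (ι-∑ (vecs (upTo B) 4) (λ β → G β ℤ.* f (p β)))))

-- Four sums over the 12⁴ tuples of blocks, evaluated by the type checker. The last two fall short
-- of 2 · 10⁸ times the first two, by 254288 and 2047144.
tally-one-cubic : tally 12 (λ _ → + 1) cubic ≡ + 17280
tally-one-cubic = refl

tally-one-linear : tally 12 (λ _ → + 1) linear ≡ + 24
tally-one-linear = refl

tally-cubic : tally 12 twoColourWeight cubic ≡ + 3455999745712
tally-cubic = refl

tally-linear : tally 12 twoColourWeight linear ≡ + 4797952856
tally-linear = refl

u₁₀₀ : ℚ
u₁₀₀ = + 1 ℚ./ 100

blockWave : ∀ M .{{_ : ℕ.NonZero M}} → ℕ → ℚ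
blockWave M i = u₁₀₀ * ι (nth profile (i ℕ./ M))

∣blockWave∣≤1 : ∀ M .{{_ : ℕ.NonZero M}} i → ∣ blockWave M i ∣ ≤ 1ℚ
∣blockWave∣≤1 M i = bound profile (toWitness {a? = All.all? (λ z → ∣ u₁₀₀ * ι z ∣ ℚₚ.≤? 1ℚ) profile} _) (i ℕ./ M)
  where
  bound : ∀ zs → All (λ z → ∣ u₁₀₀ * ι z ∣ ≤ 1ℚ) zs → ∀ b → ∣ u₁₀₀ * ι (nth zs b) ∣ ≤ 1ℚ
  bound []       []       b       = 0≤1
  bound (z ∷ zs) (p ∷ ps) zero    = p
  bound (z ∷ zs) (p ∷ ps) (suc b) = bound zs ps b

solutionCount-blocks : ∀ B j → let y = ℕ→ℚ (2 ℕ.^ j) in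
  ℕ→ℚ 3 * solutionCount E₄ (B ℕ.* 2 ℕ.^ suc j) ≡
  ι (tally B (λ _ → + 1) cubic) * (y * y * y) + ι (tally B (λ _ → + 1) linear) * y
solutionCount-blocks B j = trans (cong (ℕ→ℚ 3 *_) blocks) (weighted-volume B j (λ _ → + 1))
  where
  M = 2 ℕ.^ suc j
  blocks : solutionCount E₄ (B ℕ.* M) ≡ ∑ᵛ (upTo B) 4 λ β → 1ℚ * volume M (dot₀ E₄ β)
  blocks = trans (solutionCount≡∑ E₄ (B ℕ.* M))
    (trans (∑-cong (vecs (upTo (B ℕ.* M)) 4) λ v → sym (ℚₚ.*-identityʳ (𝟙 (dot E₄ v ≟0))))
      (∑ᵛ-blocks B M {{ℕₚ.m^n≢0 2 (suc j)}} E₄ (λ z → 𝟙 (z ≟0)) (λ _ → 1ℚ)))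

twoColourSum-blocks : ∀ B j → let y = ℕ→ℚ (2 ℕ.^ j) in
  ℕ→ℚ 3 * twoColourSum E₄ (B ℕ.* 2 ℕ.^ suc j) (blockWave (2 ℕ.^ suc j) {{ℕₚ.m^n≢0 2 (suc j)}}) ≡
  u₁₀₀ ^ 4 * (ι (tally B twoColourWeight cubic) * (y * y * y) + ι (tally B twoColourWeight linear) * y)
twoColourSum-blocks B j = begin
  ℕ→ℚ 3 * twoColourSum E₄ (B ℕ.* M) (blockWave M)
    ≡⟨ cong (ℕ→ℚ 3 *_) (trans (∑-solutions E₄ (B ℕ.* M) _ (λ v → H (Vec.map (ℕ._/ M) v)) products)
         (∑ᵛ-blocks B M E₄ (λ z → 𝟙 (z ≟0)) H)) ⟩
  ℕ→ℚ 3 * ∑ᵛ (upTo B) 4 (λ β → e * ι (twoColourWeight β) * volume M (dot₀ E₄ β))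
    ≡⟨ cong (ℕ→ℚ 3 *_) (trans (∑-cong (vecs (upTo B) 4) λ β → ℚₚ.*-assoc e (ι (twoColourWeight β)) (volume M (dot₀ E₄ β)))
         (∑-*ˡ (vecs (upTo B) 4) e (λ β → ι (twoColourWeight β) * volume M (dot₀ E₄ β)))) ⟩
  ℕ→ℚ 3 * (e * ∑ᵛ (upTo B) 4 (λ β → ι (twoColourWeight β) * volume M (dot₀ E₄ β)))
    ≡⟨ trans (lemma₁ (ℕ→ℚ 3) e (∑ᵛ (upTo B) 4 (λ β → ι (twoColourWeight β) * volume M (dot₀ E₄ β))))
         (cong (e *_) (weighted-volume B j twoColourWeight)) ⟩
  e * (ι (tally B twoColourWeight cubic) * (y * y * y) + ι (tally B twoColourWeight linear) * y) ∎
  where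
  open ≡-Reasoning
  M = 2 ℕ.^ suc j
  instance
    M≢0 : ℕ.NonZero M
    M≢0 = ℕₚ.m^n≢0 2 (suc j)
  y = ℕ→ℚ (2 ℕ.^ j)
  e = u₁₀₀ ^ 4
  H : Vec ℕ 4 → ℚ
  H β = e * ι (twoColourWeight β)
  lemma₁ : ∀ x y z → x * (y * z) ≡ y * (x * z)
  lemma₁ = solve-∀ ℚ-ring
  plus : ∀ z → 1ℚ + u₁₀₀ * z ≡ u₁₀₀ * (ℕ→ℚ 100 + z)
  plus = solve-∀ ℚ-ring
  minus : ∀ z → 1ℚ - u₁₀₀ * z ≡ u₁₀₀ * (ℕ→ℚ 100 + - z)
  minus = solve-∀ ℚ-ring
  plus′ : ∀ i → 1ℚ + blockWave M i ≡ u₁₀₀ * ι (+ 100 ℤ.+ nth profile (i ℕ./ M))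
  plus′ i = trans (plus (ι (nth profile (i ℕ./ M)))) (cong (u₁₀₀ *_) (sym (ι-+ (+ 100) (nth profile (i ℕ./ M)))))
  minus′ : ∀ i → 1ℚ - blockWave M i ≡ u₁₀₀ * ι (+ 100 ℤ.- nth profile (i ℕ./ M))
  minus′ i = trans (minus (ι (nth profile (i ℕ./ M))))
    (cong (u₁₀₀ *_) (trans (+-congˡ (ℕ→ℚ 100) (sym (ι-neg (nth profile (i ℕ./ M))))) (sym (ι-+ (+ 100) (ℤ.- nth profile (i ℕ./ M))))))
  product : ∀ {n} (x : Vec (Fin n) 4) (f : ℕ → ℚ) (h : ℕ → ℤ) → (∀ i → f i ≡ u₁₀₀ * ι (h (i ℕ./ M))) →
    ∏ x (f ∘ toℕ) ≡ e * ι (∏ℤ (Vec.map (ℕ._/ M) (Vec.map toℕ x)) h)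
  product x f h eq = trans (sym (∏-map toℕ x f)) (trans (∏-cong (Vec.map toℕ x) eq)
    (trans (sym (∏-map (ℕ._/ M) (Vec.map toℕ x) (λ b → u₁₀₀ * ι (h b)))) (∏-ι u₁₀₀ (Vec.map (ℕ._/ M) (Vec.map toℕ x)) h)))
  products : ∀ {n} (x : Vec (Fin n) 4) →
    ∏ x (λ i → 1ℚ + blockWave M (toℕ i)) + ∏ x (λ i → 1ℚ - blockWave M (toℕ i)) ≡ H (Vec.map (ℕ._/ M) (Vec.map toℕ x))
  products x = trans
    (cong₂ _+_ (product x (λ i → 1ℚ + blockWave M i) (λ b → + 100 ℤ.+ nth profile b) plus′)
               (product x (λ i → 1ℚ - blockWave M i) (λ b → + 100 ℤ.- nth profile b) minus′))
    (trans (sym (ℚₚ.*-distribˡ-+ e (ι p) (ι q))) (cong (e *_) (sym (ι-+ p q))))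
    where
    β = Vec.map (ℕ._/ M) (Vec.map toℕ x)
    p = ∏ℤ β (λ b → + 100 ℤ.+ nth profile b)
    q = ∏ℤ β (λ b → + 100 ℤ.- nth profile b)

E₄-uncommon : ∀ r .{{_ : ℕ.NonZero r}} → 2 ℕ.≤ r → Uncommon r E₄
E₄-uncommon r 2≤r = asymptotic-criterion E₄ nonzero r 2≤r η (ℚₚ.positive⁻¹ η) (toWitness {a? = η ℚₚ.≤? 1ℚ} _) (ℕ→ℚ 3) (ℚₚ.positive⁻¹ (ℕ→ℚ 3)) 0ℚ ℚₚ.≤-refl λ N →
  12 ℕ.* 2 ℕ.^ suc N , large N , many N , blockWave (2 ℕ.^ suc N) {{ℕₚ.m^n≢0 2 (suc N)}} , ∣blockWave∣≤1 (2 ℕ.^ suc N) {{ℕₚ.m^n≢0 2 (suc N)}} ,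
  subst (T N ≤_) (sym (trans (+-congˡ ((2ℚ - η) * s N) (ℚₚ.*-zeroˡ (ℕ→ℚ ((12 ℕ.* 2 ℕ.^ suc N) ℕ.^ 2)))) (ℚₚ.+-identityʳ ((2ℚ - η) * s N)))) (few N)
  where
  -- Equal to `u₁₀₀ ^ 4`, the unit in which the tallies are scaled. It is small enough because the
  -- shortfalls 254288 and 2047144 exceed 17280 and 24.
  η : ℚ
  η = + 1 ℚ./ 100000000
  nonzero : NonzeroCoefficients E₄
  nonzero Fin.zero                               ()
  nonzero (Fin.suc Fin.zero)                     ()
  nonzero (Fin.suc (Fin.suc Fin.zero))           ()
  nonzero (Fin.suc (Fin.suc (Fin.suc Fin.zero))) ()
  s T y : ℕ → ℚ
  s j = solutionCount E₄ (12 ℕ.* 2 ℕ.^ suc j)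
  T j = twoColourSum E₄ (12 ℕ.* 2 ℕ.^ suc j) (blockWave (2 ℕ.^ suc j) {{ℕₚ.m^n≢0 2 (suc j)}})
  y j = ℕ→ℚ (2 ℕ.^ j)
  0≤y : ∀ j → 0ℚ ≤ y j
  0≤y j = 0≤ℕ→ℚ (2 ℕ.^ j)
  0≤y³ : ∀ j → 0ℚ ≤ y j * y j * y j
  0≤y³ j = 0≤* (0≤* (0≤y j) (0≤y j)) (0≤y j)
  3s : ∀ j → ℕ→ℚ 3 * s j ≡ ι (+ 17280) * (y j * y j * y j) + ι (+ 24) * y j
  3s j = trans (solutionCount-blocks 12 j)
    (cong₂ (λ p q → ι p * (y j * y j * y j) + ι q * y j) tally-one-cubic tally-one-linear)
  3T : ∀ j → ℕ→ℚ 3 * T j ≡ η * (ι (+ 3455999745712) * (y j * y j * y j) + ι (+ 4797952856) * y j)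
  3T j = trans (twoColourSum-blocks 12 j)
    (cong₂ (λ p q → u₁₀₀ ^ 4 * (ι p * (y j * y j * y j) + ι q * y j)) tally-cubic tally-linear)
  large : ∀ N → N ℕ.≤ 12 ℕ.* 2 ℕ.^ suc N
  large N = ℕₚ.≤-trans (n≤2^n N) (ℕₚ.≤-trans (ℕₚ.m≤n*m (2 ℕ.^ N) 2) (ℕₚ.m≤n*m (2 ℕ.^ suc N) 12))
  -- n = 24 y, so n³ = 13824 y³ ≤ 17280 y³ ≤ 3 s; this is the origin of K = 3.
  many : ∀ N → ℕ→ℚ ((12 ℕ.* 2 ℕ.^ suc N) ℕ.^ 3) ≤ ℕ→ℚ 3 * s N
  many N = subst₂ _≤_ (sym cube) (sym (3s N))
    (≤-by (lemma₂ (y N * y N * y N) (y N)) (0≤+ (0≤* (0≤ℕ→ℚ 3456) (0≤y³ N)) (0≤* (0≤ℕ→ℚ 24) (0≤y N))))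
    where
    m = 2 ℕ.^ N
    lemma₁ : ∀ m → 12 ℕ.* (2 ℕ.* m) ℕ.* (12 ℕ.* (2 ℕ.* m) ℕ.* (12 ℕ.* (2 ℕ.* m) ℕ.* 1)) ≡ 13824 ℕ.* (m ℕ.* m ℕ.* m)
    lemma₁ = ℕ-Solver.solve-∀
    lemma₂ : ∀ x y → ι (+ 17280) * x + ι (+ 24) * y - ℕ→ℚ 13824 * x ≡ ℕ→ℚ 3456 * x + ℕ→ℚ 24 * y
    lemma₂ = solve-∀ ℚ-ring
    cube : ℕ→ℚ ((12 ℕ.* 2 ℕ.^ suc N) ℕ.^ 3) ≡ ℕ→ℚ 13824 * (y N * y N * y N)
    cube = trans (cong ℕ→ℚ (lemma₁ m)) (trans (ℕ→ℚ-* 13824 (m ℕ.* m ℕ.* m))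
      (cong (ℕ→ℚ 13824 *_) (trans (ℕ→ℚ-* (m ℕ.* m) m) (cong (_* ℕ→ℚ m) (ℕ→ℚ-* m m)))))
  few : ∀ j → T j ≤ (2ℚ - η) * s j
  few j = ℚₚ.*-cancelˡ-≤-pos (ℕ→ℚ 3) (subst₂ _≤_ (sym (3T j))
    (trans (cong ((2ℚ - η) *_) (sym (3s j))) (lemma₁ (2ℚ - η) (ℕ→ℚ 3) (s j)))
    -- What is left of the shortfalls: 237008 = 254288 - 17280 and 2047120 = 2047144 - 24.
    (≤-by difference
      (0≤* (ℚₚ.<⇒≤ (ℚₚ.positive⁻¹ η)) (0≤+ (0≤* (0≤ℕ→ℚ 237008) (0≤y³ j)) (0≤* (0≤ℕ→ℚ 2047120) (0≤y j))))))
    where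
    h = ℕ→ℚ 100000000
    x = y j * y j * y j
    lemma₁ : ∀ x y z → x * (y * z) ≡ y * (x * z)
    lemma₁ = solve-∀ ℚ-ring
    -- Stated for symbols in place of the large numerals, which `expand` supplies by integer
    -- arithmetic. X and Y are the remaining surpluses, and the term with 1 - e h vanishes because h
    -- is the inverse of η.
    lemma₂ : ∀ e h p q X Y x y → (2ℚ - e) * (p * x + q * y) - e * ((2ℚ * h * p - p - X) * x + (2ℚ * h * q - q - Y) * y) ≡
      e * (X * x + Y * y) + 2ℚ * (1ℚ - e * h) * (p * x + q * y)
    lemma₂ = solve-∀ ℚ-ring
    lemma₃ : ∀ z w → z + 2ℚ * (1ℚ - 1ℚ) * w ≡ z
    lemma₃ = solve-∀ ℚ-ring
    expand : ∀ H p X → ι (+ 2 ℤ.* H ℤ.* p ℤ.- p ℤ.- X) ≡ 2ℚ * ι H * ι p - ι p - ι X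
    expand H p X = trans (ι-- (+ 2 ℤ.* H ℤ.* p ℤ.- p) X) (cong (_- ι X) (trans (ι-- (+ 2 ℤ.* H ℤ.* p) p)
      (cong (_- ι p) (trans (ι-* (+ 2 ℤ.* H) p) (cong (_* ι p) (ι-* (+ 2) H))))))
    difference : (2ℚ - η) * (ι (+ 17280) * x + ι (+ 24) * y j) - η * (ι (+ 3455999745712) * x + ι (+ 4797952856) * y j) ≡
      η * (ι (+ 237008) * x + ι (+ 2047120) * y j)
    difference = trans
      (cong₂ (λ P Q → (2ℚ - η) * (ι (+ 17280) * x + ι (+ 24) * y j) - η * (P * x + Q * y j))
        (expand (+ 100000000) (+ 17280) (+ 237008)) (expand (+ 100000000) (+ 24) (+ 2047120)))
      (trans (lemma₂ η h (ι (+ 17280)) (ι (+ 24)) (ι (+ 237008)) (ι (+ 2047120)) x (y j))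
      (trans (cong (λ z → η * (ι (+ 237008) * x + ι (+ 2047120) * y j) + 2ℚ * (1ℚ - z) * (ι (+ 17280) * x + ι (+ 24) * y j)) (/-* (+ 1) 100000000))
        (lemma₃ (η * (ι (+ 237008) * x + ι (+ 2047120) * y j)) (ι (+ 17280) * x + ι (+ 24) * y j))))

corollary1p4 : ∀ (r : ℕ) .{{_ : ℕ.NonZero r}} → 3 ℕ.≤ r →
  (∀ (m : ℕ) → 2 ℕ.≤ m → (a : Vec ℤ (2 ℕ.* m)) → NonzeroCoefficients a →
    ¬ HasCancelingPartition a → Uncommon r a)
  × Uncommon r (+ 1 ∷ + 2 ∷ ℤ.- (+ 1) ∷ ℤ.- (+ 2) ∷ [])
corollary1p4 r 3≤r = noCanceling , E₄-uncommon r 2≤r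
  where
  2≤r : 2 ℕ.≤ r
  2≤r = ℕₚ.≤-trans (ℕₚ.n≤1+n 2) 3≤r
  noCanceling : ∀ (m : ℕ) → 2 ℕ.≤ m → (a : Vec ℤ (2 ℕ.* m)) → NonzeroCoefficients a →
    ¬ HasCancelingPartition a → Uncommon r a
  noCanceling (suc (suc m)) (ℕ.s≤s (ℕ.s≤s ℕ.z≤n)) a a≢0 ¬partition =
    no-canceling-uncommon {k = 1 ℕ.+ 2 ℕ.* m} {m = suc (suc m)} (length-eq m) refl a a≢0 ¬partition r 2≤r
    where
    length-eq : ∀ m → 2 ℕ.* suc (suc m) ≡ 3 ℕ.+ (1 ℕ.+ 2 ℕ.* m)
    length-eq = ℕ-Solver.solve-∀
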